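{- Let $\mathtt{A}$ and $\mathtt{B}$ be any types. Let $\mathtt{s1}$ and $\mathtt{s2}$ be two closed terms of type $\mathtt{A}$ with $\mathtt{s1} \neq_{\beta\eta c} \mathtt{s2}$, and let $\mathtt{u1}$ and $\mathtt{u2}$ be any closed terms of type $\mathtt{B}$. Then there is a closed term $\mathtt{t}$ that is poly-typable by $\mathtt{A \to B}$ (with respect to $\mathtt{s1}$ and with respect to $\mathtt{s2}$) such that \[ \mathtt{t}\,\mathtt{s1} =_{\beta\eta c} \mathtt{u1} \quad\text{and}\quad \mathtt{t}\,\mathtt{s2} =_{\beta\eta c} \mathtt{u2}. \]
   Context: Linear $\lambda$-calculus in ML-like notation. Types: $\mathtt{A} ::= \mathtt{'a} \mid \mathtt{A1 * A2} \mid \mathtt{A1 \to A2}$, where $\mathtt{'a}$ ranges over type variables, $*$ is the tensor product and $\to$ is linear implication. Terms: $\mathtt{t} ::= \mathtt{x} \mid \mathtt{t}\,\mathtt{s} \mid \mathtt{fn\ x => t} \mid \mathtt{(s,t)} \mid \mathtt{let\ val\ (x,y)=s\ in\ t\ end}$. Typing judgements $\Gamma \vdash \mathtt{t:A}$ ($\Gamma$ a list of declarations of distinct variables) are derived by: $\mathtt{x:A}\vdash\mathtt{x:A}$; exchange of declarations in $\Gamma$; from $\mathtt{x:A},\Gamma\vdash \mathtt{t:B}$ infer $\Gamma\vdash\mathtt{fn\ x=>t : A\to B}$; from $\Gamma\vdash\mathtt{t:A\to B}$ and $\Delta\vdash\mathtt{s:A}$ infer $\Gamma,\Delta\vdash\mathtt{t\,s:B}$;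 from $\Gamma\vdash\mathtt{s:A}$ and $\Delta\vdash\mathtt{t:B}$ infer $\Gamma,\Delta\vdash\mathtt{(s,t):A*B}$; from $\Gamma\vdash\mathtt{s:A*B}$ and $\mathtt{x:A},\mathtt{y:B},\Delta\vdash\mathtt{t:C}$ infer $\Gamma,\Delta\vdash\mathtt{let\ val\ (x,y)=s\ in\ t\ end:C}$ (with $\Gamma,\Delta$ disjoint, so each variable is used exactly once). A closed term of type $\mathtt{A}$ is a term $\mathtt{t}$ with $\vdash\mathtt{t:A}$ derivable. The equality $=_{\beta\eta c}$ is the least congruence on typed terms (reflexive, symmetric, transitive, compatible with all term constructors) containing: $(\mathtt{fn\ x=>t})\,\mathtt{s} = \mathtt{t[s/x]}$; $\mathtt{let\ val\ (x,y)=(u,v)\ in\ w\ end} = \mathtt{w[u/x,v/y]}$; $\mathtt{fn\ x=>(t\ x)} = \mathtt{t}$; $\mathtt{let\ val\ (x,y)=t\ in\ (x,y)\ end} = \mathtt{t}$; and $C[\mathtt{let\ val\ (x,y)=t\ in\ u\ end}] = \mathtt{let\ val\ (x,y)=t\ in}\ C[\mathtt{u}]\ \mathtt{end}$ for every one-hole term context $C$ in which $\mathtt{x},\mathtt{y}$ are not free and whose binders capture no free variable of $\mathtt{t}$. Poly-typability: a type substitution maps type variables to types (extended homomorphically to types). The principal type $\mathrm{PT}(\mathtt{t})$ of a typable term $\mathtt{t}$ is a type $\mathtt{A}$ such that $\Gamma\vdash\mathtt{t:A}$ is derivable for some $\Gamma$ and every derivable $\Gamma'\vdash\mathtt{t:A'}$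 is a substitution instance of it. For closed terms $\mathtt{t},\mathtt{s}_1,\dots,\mathtt{s}_n$ such that $\vdash \mathtt{t : A'_1\to\cdots\to A'_n\to B'}$ is derivable for some types and $\vdash\mathtt{s}_i\mathtt{:A}_i$, the term $\mathtt{t}$ is poly-typable by $\mathtt{A_1\to\cdots\to A_n\to B}$ with respect to $\mathtt{s}_1,\dots,\mathtt{s}_n$ if there is a type substitution $\theta$ with $\theta(\mathrm{PT}(\mathtt{t})) = \mathtt{A''_1\to\cdots\to A''_n\to B}$ and $\theta(\mathrm{PT}(\mathtt{s}_i)) = \mathtt{A''_i}$ for each $i$. (This does not require $\vdash\mathtt{t : A_1\to\cdots\to A_n\to B}$.) -}

module Defs where

open import Data.Nat using (ℕ; zero; suc)
open import Data.Fin using (Fin; zero; suc)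
open import Data.Maybe using (Maybe; just; nothing)
open import Data.Vec using (Vec; []; _∷_; replicate)
import Data.Vec as Vec
open import Data.Product using (Σ; _×_; _,_; ∃)
open import Relation.Binary.PropositionalEquality using (_≡_)

infixr 7 _⊸_
infixr 8 _⊗_

data Ty : Set where
  tvar : ℕ → Ty
  _⊗_  : Ty → Ty → Ty
  _⊸_  : Ty → Ty → Ty

TySubst : Set
TySubst = ℕ → Ty

_⟪_⟫ : Ty → TySubst → Ty
tvar a  ⟪ θ ⟫ = θ a
(A ⊗ B) ⟪ θ ⟫ = A ⟪ θ ⟫ ⊗ B ⟪ θ ⟫
(A ⊸ B) ⟪ θ ⟫ = A ⟪ θ ⟫ ⊸ B ⟪ θ ⟫

-- Raw terms, scoped de Bruijn syntax (Tm n = terms with n variables in scope).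
--   ƛ t        : fn x => t            (x is index 0 in t)
--   letp s t   : let val (x,y)=s in t end   (x is index 0, y is index 1 in t)

data Tm (n : ℕ) : Set where
  `_   : Fin n → Tm n
  _·_  : Tm n → Tm n → Tm n
  ƛ_   : Tm (suc n) → Tm n
  ⟨_,_⟩ : Tm n → Tm n → Tm n
  letp : Tm n → Tm (suc (suc n)) → Tm n

infixl 6 _·_

ext : ∀ {n m} → (Fin n → Fin m) → Fin (suc n) → Fin (suc m)
ext ρ zero    = zero
ext ρ (suc i) = suc (ρ i)

ren : ∀ {n m} → (Fin n → Fin m) → Tm n → Tm m
ren ρ (` i)       = ` ρ i
ren ρ (t · s)     = ren ρ t · ren ρ s
ren ρ (ƛ t)       = ƛ ren (ext ρ) t
ren ρ ⟨ s , t ⟩   = ⟨ ren ρ s , ren ρ t ⟩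
ren ρ (letp s t)  = letp (ren ρ s) (ren (ext (ext ρ)) t)

exts : ∀ {n m} → (Fin n → Tm m) → Fin (suc n) → Tm (suc m)
exts σ zero    = ` zero
exts σ (suc i) = ren suc (σ i)

sub : ∀ {n m} → (Fin n → Tm m) → Tm n → Tm m
sub σ (` i)       = σ i
sub σ (t · s)     = sub σ t · sub σ s
sub σ (ƛ t)       = ƛ sub (exts σ) t
sub σ ⟨ s , t ⟩   = ⟨ sub σ s , sub σ t ⟩
sub σ (letp s t)  = letp (sub σ s) (sub (exts (exts σ)) t)

σ₁ : ∀ {n} → Tm n → Fin (suc n) → Tm n
σ₁ s zero    = s
σ₁ s (suc i) = ` i

σ₂ : ∀ {n} → Tm n → Tm n → Fin (suc (suc n)) → Tm n
σ₂ u v zero          = u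
σ₂ u v (suc zero)    = v
σ₂ u v (suc (suc i)) = ` i

wk₁ : ∀ {n} → Tm n → Tm (suc n)
wk₁ = ren suc

suc₂ : ∀ {n} → Fin n → Fin (suc (suc n))
suc₂ i = suc (suc i)

wk₂ : ∀ {n} → Tm n → Tm (suc (suc n))
wk₂ = ren suc₂

swap22 : ∀ {n} → Fin (suc (suc (suc (suc n)))) → Fin (suc (suc (suc (suc n))))
swap22 zero                      = suc (suc zero)
swap22 (suc zero)                = suc (suc (suc zero))
swap22 (suc (suc zero))          = zero
swap22 (suc (suc (suc zero)))    = suc zero
swap22 (suc (suc (suc (suc i)))) = suc (suc (suc (suc i)))

rot3 : ∀ {n} → Fin (suc (suc (suc n))) → Fin (suc (suc (suc n)))
rot3 zero                   = suc zero
rot3 (suc zero)             = suc (suc zero)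
rot3 (suc (suc zero))       = zero
rot3 (suc (suc (suc i)))    = suc (suc (suc i))

-- Linear typing.  A context over n variables records, for every variable in
-- scope, the declared type (just A) or that the variable is not declared
-- (nothing).  Exchange is built into the positional representation;
-- disjointness of Γ,Δ is the relation Split.

Ctx : ℕ → Set
Ctx n = Vec (Maybe Ty) n

only : ∀ {n} → Fin n → Ty → Ctx n
only zero    A = just A ∷ replicate _ nothing
only (suc i) A = nothing ∷ only i A

data Split : ∀ {n} → Ctx n → Ctx n → Ctx n → Set where
  []   : Split [] [] []
  none : ∀ {n} {Γ Γ₁ Γ₂ : Ctx n} → Split Γ Γ₁ Γ₂ →
         Split (nothing ∷ Γ) (nothing ∷ Γ₁) (nothing ∷ Γ₂)
  left : ∀ {n} {Γ Γ₁ Γ₂ : Ctx n} {A} → Split Γ Γ₁ Γ₂ →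
         Split (just A ∷ Γ) (just A ∷ Γ₁) (nothing ∷ Γ₂)
  right : ∀ {n} {Γ Γ₁ Γ₂ : Ctx n} {A} → Split Γ Γ₁ Γ₂ →
         Split (just A ∷ Γ) (nothing ∷ Γ₁) (just A ∷ Γ₂)

infix 4 _⊢_∶_

data _⊢_∶_ {n} : Ctx n → Tm n → Ty → Set where
  ⊢var  : ∀ (i : Fin n) {A} → only i A ⊢ ` i ∶ A
  ⊢lam  : ∀ {Γ t A B} → (just A ∷ Γ) ⊢ t ∶ B → Γ ⊢ ƛ t ∶ A ⊸ B
  ⊢app  : ∀ {Γ Γ₁ Γ₂ t s A B} → Split Γ Γ₁ Γ₂ →
          Γ₁ ⊢ t ∶ A ⊸ B → Γ₂ ⊢ s ∶ A → Γ ⊢ t · s ∶ B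
  ⊢pair : ∀ {Γ Γ₁ Γ₂ s t A B} → Split Γ Γ₁ Γ₂ →
          Γ₁ ⊢ s ∶ A → Γ₂ ⊢ t ∶ B → Γ ⊢ ⟨ s , t ⟩ ∶ A ⊗ B
  ⊢let  : ∀ {Γ Γ₁ Γ₂ s t A B C} → Split Γ Γ₁ Γ₂ →
          Γ₁ ⊢ s ∶ A ⊗ B → (just A ∷ just B ∷ Γ₂) ⊢ t ∶ C →
          Γ ⊢ letp s t ∶ C

-- The βηc axioms (raw).  The commuting conversions are given for each
-- one-layer context (frame); closure under congruence and transitivity
-- yields them for all one-hole contexts C.  Scoping (weakening of t, resp.
-- of the other parts of C) enforces the side conditions.

data Ax {n} : Tm n → Tm n → Set where
  β     : ∀ (t : Tm (suc n)) s → Ax ((ƛ t) · s) (sub (σ₁ s) t)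
  βlet  : ∀ u v (w : Tm (suc (suc n))) → Ax (letp ⟨ u , v ⟩ w) (sub (σ₂ u v) w)
  η     : ∀ t → Ax (ƛ (wk₁ t · ` zero)) t
  ηlet  : ∀ t → Ax (letp t ⟨ ` zero , ` suc zero ⟩) t
  c-appL  : ∀ t u s → Ax (letp t u · s) (letp t (u · wk₂ s))
  c-appR  : ∀ s t u → Ax (s · letp t u) (letp t (wk₂ s · u))
  c-pairL : ∀ t u s → Ax ⟨ letp t u , s ⟩ (letp t ⟨ u , wk₂ s ⟩)
  c-pairR : ∀ s t u → Ax ⟨ s , letp t u ⟩ (letp t ⟨ wk₂ s , u ⟩)
  c-lam   : ∀ t (u : Tm (suc (suc (suc n)))) →
            Ax (ƛ (letp (wk₁ t) u)) (letp t (ƛ ren rot3 u))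
  c-letL  : ∀ t u (w : Tm (suc (suc n))) →
            Ax (letp (letp t u) w) (letp t (letp u (ren (ext (ext suc₂)) w)))
  c-letR  : ∀ s t (u : Tm (suc (suc (suc (suc n))))) →
            Ax (letp s (letp (wk₂ t) u)) (letp t (letp (wk₂ s) (ren swap22 u)))

infix 4 _⊢_≐_∶_

data _⊢_≐_∶_ {n} : Ctx n → Tm n → Tm n → Ty → Set where
  ax    : ∀ {Γ t s A} → Ax t s → Γ ⊢ t ∶ A → Γ ⊢ s ∶ A → Γ ⊢ t ≐ s ∶ A
  refl  : ∀ {Γ t A} → Γ ⊢ t ∶ A → Γ ⊢ t ≐ t ∶ A
  sym   : ∀ {Γ t s A} → Γ ⊢ t ≐ s ∶ A → Γ ⊢ s ≐ t ∶ A
  trans : ∀ {Γ t s r A} → Γ ⊢ t ≐ s ∶ A → Γ ⊢ s ≐ r ∶ A → Γ ⊢ t ≐ r ∶ A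
  c-lam  : ∀ {Γ t t' A B} → (just A ∷ Γ) ⊢ t ≐ t' ∶ B → Γ ⊢ ƛ t ≐ ƛ t' ∶ A ⊸ B
  c-app  : ∀ {Γ Γ₁ Γ₂ t t' s s' A B} → Split Γ Γ₁ Γ₂ →
           Γ₁ ⊢ t ≐ t' ∶ A ⊸ B → Γ₂ ⊢ s ≐ s' ∶ A → Γ ⊢ t · s ≐ t' · s' ∶ B
  c-pair : ∀ {Γ Γ₁ Γ₂ s s' t t' A B} → Split Γ Γ₁ Γ₂ →
           Γ₁ ⊢ s ≐ s' ∶ A → Γ₂ ⊢ t ≐ t' ∶ B → Γ ⊢ ⟨ s , t ⟩ ≐ ⟨ s' , t' ⟩ ∶ A ⊗ B
  c-let  : ∀ {Γ Γ₁ Γ₂ s s' t t' A B C} → Split Γ Γ₁ Γ₂ →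
           Γ₁ ⊢ s ≐ s' ∶ A ⊗ B → (just A ∷ just B ∷ Γ₂) ⊢ t ≐ t' ∶ C →
           Γ ⊢ letp s t ≐ letp s' t' ∶ C

substCtx : ∀ {n} → TySubst → Ctx n → Ctx n
substCtx θ = Vec.map (Data.Maybe.map (_⟪ θ ⟫))
  where import Data.Maybe

IsPrincipalType : ∀ {n} → Tm n → Ty → Set
IsPrincipalType {n} t P =
  Σ (Ctx n) λ Γ → (Γ ⊢ t ∶ P) ×
    (∀ (Γ' : Ctx n) (A' : Ty) → Γ' ⊢ t ∶ A' →
       Σ TySubst λ θ → (substCtx θ Γ ≡ Γ') × (P ⟪ θ ⟫ ≡ A'))

-- closed t is poly-typable by A → B with respect to closed s (n = 1).
-- Since principal types are unique only up to renaming of type variables,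
-- we take them renamed apart, i.e. allow independent substitutions θ₁, θ₂.
PolyTypable : Tm 0 → Tm 0 → Ty → Ty → Set
PolyTypable t s A B =
  (Σ Ty λ A' → Σ Ty λ B' → [] ⊢ t ∶ A' ⊸ B') × ([] ⊢ s ∶ A) ×
  Σ Ty λ Pt → Σ Ty λ Ps → IsPrincipalType t Pt × IsPrincipalType s Ps ×
  Σ Ty λ A'' → Σ TySubst λ θ₁ → Σ TySubst λ θ₂ →
    (Pt ⟪ θ₁ ⟫ ≡ A'' ⊸ B) × (Ps ⟪ θ₂ ⟫ ≡ A'')

module Submission where

-- The theorem is about axiom links.  A closed term s of type A links each
-- negative atom occurrence of A to a positive one, and s can be typed with a
-- variable-for-variable generalization of A in which every link has its own
-- type variable (linearize).
--
-- If s₁ and s₂ have the same links, they inhabit a common type in which every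
-- variable occurs at most once positively and at most once negatively, and any two
-- inhabitants of such a type are equal (coherent).  As in the coherence
-- theorem for symmetric monoidal closed categories, a redex-free term is
-- decomposed along an application of a variable f : X ⊸ Y; the assumptions
-- consumed by the argument are those connected to X by links, so every other
-- inhabitant can be decomposed in the same way (extract).
--
-- If the links differ, s₁ links some negative atom n to a positive atom p and
-- s₂ does not.  A raw linear environment for A lets a token start at n; the first
-- positive atom that it reaches marks it, with one mark for p and another one for
-- all others, and the marked token travels on to the result, where it selects
-- u₁ or u₂ and erases the other term.  This environment is not typed uniformly,
-- but linear terms satisfy subject expansion, so t s₁ and t s₂, which
-- reduce to u₁ and u₂, have type B.  The poly-typing follows with unification.

open import Defs
open import Data.Vec using ([])
open import Data.Product using (Σ; _×_)
open import Relation.Nullary using (¬_)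

open import Algebra.Bundles using (CommutativeMonoid)
import Algebra.Solver.CommutativeMonoid
open import Data.Bool using (Bool; true; false; not) renaming (T to IsTrue)
import Data.Bool as Bool
open import Data.Bool.Properties using (not-involutive; ¬-not; not-¬)
open import Data.Empty using (⊥; ⊥-elim)
open import Data.Fin using (Fin; zero; suc)
import Data.Fin as Fin
import Data.Fin.Properties as Finₚ
open import Data.List using (List; []; _∷_; _++_; map)
open import Data.List.Membership.Propositional using (_∈_; find)
open import Data.List.Membership.Propositional.Properties using (∈-++⁺ˡ; ∈-++⁺ʳ)
open import Data.List.Properties using (map-++; map-∘; map-id; ++-identityʳ; ++-assoc)
open import Data.List.Relation.Unary.All using (All; []; _∷_)
import Data.List.Relation.Unary.All as All
open import Data.List.Relation.Unary.All.Properties using (++⁻ˡ; ++⁻ʳ)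
open import Data.List.Relation.Unary.Any using (here; there)
open import Data.Maybe using (Maybe; just; nothing; _>>=_)
import Data.Maybe as Maybe
open import Data.Nat using (ℕ; zero; suc; _+_; _≤_; _<_; z≤n; s≤s; s≤s⁻¹; _≟_)
open import Data.Nat.Properties using
  ( +-assoc; +-comm; +-identityʳ; +-cancelˡ-≡; +-mono-≤; +-monoˡ-≤; +-monoʳ-≤; suc-injective
  ; ≤-refl; ≤-reflexive; ≤-trans; ≤-antisym; <-irrefl; <⇒≤; m≤m+n; m≤n+m; n≤1+n; n≤0⇒n≡0 )
open import Data.Nat.Solver using (module +-*-Solver)
open import Data.Product using (_,_; ∃; ∃₂; -,_; proj₁; proj₂; map₂)
open import Data.Product.Properties using (≡-dec)
open import Data.Sum using (_⊎_; inj₁; inj₂)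
open import Data.Unit using (⊤; tt)
open import Data.Vec using (_∷_; replicate; lookup; tabulate; tail)
import Data.Vec as Vec
open import Data.Vec.Properties using (tabulate∘lookup; tabulate-cong; lookup-replicate; ∷-injective)
open import Function using (_∘_; id; const)
open import Level using (0ℓ)
open import Relation.Nullary using (Dec; yes; no; contradiction)
open import Relation.Binary.PropositionalEquality
  using (_≡_; _≢_; _≗_; refl; cong; cong₂; subst; module ≡-Reasoning)
import Relation.Binary.PropositionalEquality as Eq

-- Substitution in raw terms

-- The obstacle to separation is that a linear term can neither drop nor copy: after a test, the
-- result that is not wanted is still there. What helps is that a closed linear term can be
-- consumed. Fed with identities, it collapses to an identity; this gives `eraser B` and makes a
-- choice between closed terms definable. Token values are therefore rearrangements of arguments:
-- the argument brought to the front survives, and the others are erased. The atoms of `A` may share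
-- names, so linkings are compared on `skeleton A`, where all atoms are named differently. A
-- linearized typing is then a renaming `ρ`, and a link is an equation `ρ p ≡ ρ n`. Both halves rest
-- on one realizability relation graded by a natural number that adds up along linear contexts. It
-- counts tokens in the separation, and assumptions of the wrong colour in `connected`, the lemma
-- that forces two inhabitants to divide their context alike. For coherence, a let on a variable
-- would block the head of a term. Hence tensor assumptions are split by `⊢ηlet` before a head is
-- analysed.

exts-cong : ∀ {n m} {σ σ' : Fin n → Tm m} → σ ≗ σ' → exts σ ≗ exts σ'
exts-cong e zero    = Eq.refl
exts-cong e (suc i) = cong wk₁ (e i)

sub-cong : ∀ {n m} {σ σ' : Fin n → Tm m} → σ ≗ σ' → sub σ ≗ sub σ'
sub-cong e (` i)      = e i
sub-cong e (t · s)    = cong₂ _·_ (sub-cong e t) (sub-cong e s)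
sub-cong e (ƛ t)      = cong ƛ_ (sub-cong (exts-cong e) t)
sub-cong e ⟨ s , t ⟩  = cong₂ ⟨_,_⟩ (sub-cong e s) (sub-cong e t)
sub-cong e (letp s t) = cong₂ letp (sub-cong e s) (sub-cong (exts-cong (exts-cong e)) t)

ext-ext : ∀ {n m k} {ρ : Fin n → Fin m} {ρ' : Fin m → Fin k} {ρ'' : Fin n → Fin k} →
  ρ' ∘ ρ ≗ ρ'' → ext ρ' ∘ ext ρ ≗ ext ρ''
ext-ext e zero    = Eq.refl
ext-ext e (suc i) = cong suc (e i)

ren-ren : ∀ {n m k} {ρ : Fin n → Fin m} {ρ' : Fin m → Fin k} {ρ'' : Fin n → Fin k} →
  ρ' ∘ ρ ≗ ρ'' → ren ρ' ∘ ren ρ ≗ ren ρ''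
ren-ren e (` i)      = cong `_ (e i)
ren-ren e (t · s)    = cong₂ _·_ (ren-ren e t) (ren-ren e s)
ren-ren e (ƛ t)      = cong ƛ_ (ren-ren (ext-ext e) t)
ren-ren e ⟨ s , t ⟩  = cong₂ ⟨_,_⟩ (ren-ren e s) (ren-ren e t)
ren-ren e (letp s t) = cong₂ letp (ren-ren e s) (ren-ren (ext-ext (ext-ext e)) t)

exts-ext : ∀ {n m k} {ρ : Fin n → Fin m} {σ : Fin m → Tm k} {σ' : Fin n → Tm k} →
  σ ∘ ρ ≗ σ' → exts σ ∘ ext ρ ≗ exts σ'
exts-ext e zero    = Eq.refl
exts-ext e (suc i) = cong wk₁ (e i)

sub-ren : ∀ {n m k} {ρ : Fin n → Fin m} {σ : Fin m → Tm k} {σ' : Fin n → Tm k} →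
  σ ∘ ρ ≗ σ' → sub σ ∘ ren ρ ≗ sub σ'
sub-ren e (` i)      = e i
sub-ren e (t · s)    = cong₂ _·_ (sub-ren e t) (sub-ren e s)
sub-ren e (ƛ t)      = cong ƛ_ (sub-ren (exts-ext e) t)
sub-ren e ⟨ s , t ⟩  = cong₂ ⟨_,_⟩ (sub-ren e s) (sub-ren e t)
sub-ren e (letp s t) = cong₂ letp (sub-ren e s) (sub-ren (exts-ext (exts-ext e)) t)

ren-wk : ∀ {n m} (ρ : Fin n → Fin m) (t : Tm n) → ren (ext ρ) (wk₁ t) ≡ wk₁ (ren ρ t)
ren-wk ρ t = Eq.trans (ren-ren (λ _ → Eq.refl) t) (Eq.sym (ren-ren (λ _ → Eq.refl) t))

ext-exts : ∀ {n m k} {σ : Fin n → Tm m} {ρ : Fin m → Fin k} {σ' : Fin n → Tm k} →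
  ren ρ ∘ σ ≗ σ' → ren (ext ρ) ∘ exts σ ≗ exts σ'
ext-exts e zero = Eq.refl
ext-exts {σ = σ} {ρ} e (suc i) = Eq.trans (ren-wk ρ (σ i)) (cong wk₁ (e i))

ren-sub : ∀ {n m k} {σ : Fin n → Tm m} {ρ : Fin m → Fin k} {σ' : Fin n → Tm k} →
  ren ρ ∘ σ ≗ σ' → ren ρ ∘ sub σ ≗ sub σ'
ren-sub e (` i)      = e i
ren-sub e (t · s)    = cong₂ _·_ (ren-sub e t) (ren-sub e s)
ren-sub e (ƛ t)      = cong ƛ_ (ren-sub (ext-exts e) t)
ren-sub e ⟨ s , t ⟩  = cong₂ ⟨_,_⟩ (ren-sub e s) (ren-sub e t)
ren-sub e (letp s t) = cong₂ letp (ren-sub e s) (ren-sub (ext-exts (ext-exts e)) t)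

sub-wk : ∀ {n m} (σ : Fin n → Tm m) (t : Tm n) → sub (exts σ) (wk₁ t) ≡ wk₁ (sub σ t)
sub-wk σ t = Eq.trans (sub-ren (λ _ → Eq.refl) t) (Eq.sym (ren-sub (λ _ → Eq.refl) t))

exts-exts : ∀ {n m k} {σ : Fin n → Tm m} {τ : Fin m → Tm k} {σ' : Fin n → Tm k} →
  sub τ ∘ σ ≗ σ' → sub (exts τ) ∘ exts σ ≗ exts σ'
exts-exts e zero = Eq.refl
exts-exts {σ = σ} {τ} e (suc i) = Eq.trans (sub-wk τ (σ i)) (cong wk₁ (e i))

sub-sub : ∀ {n m k} {σ : Fin n → Tm m} {τ : Fin m → Tm k} {σ' : Fin n → Tm k} →
  sub τ ∘ σ ≗ σ' → sub τ ∘ sub σ ≗ sub σ'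
sub-sub e (` i)      = e i
sub-sub e (t · s)    = cong₂ _·_ (sub-sub e t) (sub-sub e s)
sub-sub e (ƛ t)      = cong ƛ_ (sub-sub (exts-exts e) t)
sub-sub e ⟨ s , t ⟩  = cong₂ ⟨_,_⟩ (sub-sub e s) (sub-sub e t)
sub-sub e (letp s t) = cong₂ letp (sub-sub e s) (sub-sub (exts-exts (exts-exts e)) t)

exts-id : ∀ {n} {σ : Fin n → Tm n} → σ ≗ `_ → exts σ ≗ `_
exts-id e zero    = Eq.refl
exts-id e (suc i) = cong wk₁ (e i)

sub-id : ∀ {n} {σ : Fin n → Tm n} → σ ≗ `_ → sub σ ≗ id
sub-id e (` i)      = e i
sub-id e (t · s)    = cong₂ _·_ (sub-id e t) (sub-id e s)
sub-id e (ƛ t)      = cong ƛ_ (sub-id (exts-id e) t)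
sub-id e ⟨ s , t ⟩  = cong₂ ⟨_,_⟩ (sub-id e s) (sub-id e t)
sub-id e (letp s t) = cong₂ letp (sub-id e s) (sub-id (exts-id (exts-id e)) t)

sub-ren-id : ∀ {n m} {ρ : Fin n → Fin m} {σ : Fin m → Tm n} →
  σ ∘ ρ ≗ `_ → sub σ ∘ ren ρ ≗ id
sub-ren-id e t = Eq.trans (sub-ren e t) (sub-id (λ _ → Eq.refl) t)

infixr 5 _∙_
_∙_ : ∀ {n m} → Tm m → (Fin n → Tm m) → Fin (suc n) → Tm m
(a ∙ γ) zero    = a
(a ∙ γ) (suc i) = γ i

sub-σ₁ : ∀ {n m} (γ : Fin n → Tm m) a t → sub (σ₁ a) (sub (exts γ) t) ≡ sub (a ∙ γ) t
sub-σ₁ γ a = sub-sub λ where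
  zero    → Eq.refl
  (suc i) → sub-ren-id (λ _ → Eq.refl) (γ i)

sub-σ₂ : ∀ {n m} (γ : Fin n → Tm m) a b t →
  sub (σ₂ a b) (sub (exts (exts γ)) t) ≡ sub (a ∙ b ∙ γ) t
sub-σ₂ γ a b = sub-sub λ where
  zero          → Eq.refl
  (suc zero)    → Eq.refl
  (suc (suc i)) → Eq.trans (cong (sub (σ₂ a b)) (ren-ren (λ _ → Eq.refl) (γ i)))
                           (sub-ren-id (λ _ → Eq.refl) (γ i))

-- Contexts and linear substitutions

∅ : ∀ {n} → Ctx n
∅ = replicate _ nothing

Split-comm : ∀ {n} {Γ Γ₁ Γ₂ : Ctx n} → Split Γ Γ₁ Γ₂ → Split Γ Γ₂ Γ₁
Split-comm []        = []
Split-comm (none s)  = none (Split-comm s)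
Split-comm (left s)  = right (Split-comm s)
Split-comm (right s) = left (Split-comm s)

Split-∅ˡ : ∀ {n} (Γ : Ctx n) → Split Γ ∅ Γ
Split-∅ˡ []            = []
Split-∅ˡ (nothing ∷ Γ) = none (Split-∅ˡ Γ)
Split-∅ˡ (just A ∷ Γ)  = right (Split-∅ˡ Γ)

Split-∅ʳ : ∀ {n} (Γ : Ctx n) → Split Γ Γ ∅
Split-∅ʳ Γ = Split-comm (Split-∅ˡ Γ)

Split-∅ˡ⁻¹ : ∀ {n} {Γ Δ : Ctx n} → Split Γ ∅ Δ → Γ ≡ Δ
Split-∅ˡ⁻¹ []        = refl
Split-∅ˡ⁻¹ (none s)  = cong (nothing ∷_) (Split-∅ˡ⁻¹ s)
Split-∅ˡ⁻¹ (right s) = cong (just _ ∷_) (Split-∅ˡ⁻¹ s)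

Split-∅ʳ⁻¹ : ∀ {n} {Γ Δ : Ctx n} → Split Γ Δ ∅ → Γ ≡ Δ
Split-∅ʳ⁻¹ s = Split-∅ˡ⁻¹ (Split-comm s)

Split-∅⁻¹ : ∀ {n} {Γ Δ : Ctx n} → Split ∅ Γ Δ → Γ ≡ ∅ × Δ ≡ ∅
Split-∅⁻¹ []       = refl , refl
Split-∅⁻¹ (none s) with Split-∅⁻¹ s
... | refl , refl = refl , refl

Split-assocʳ : ∀ {n} {Γ Γ₁₂ Γ₁ Γ₂ Γ₃ : Ctx n} → Split Γ Γ₁₂ Γ₃ → Split Γ₁₂ Γ₁ Γ₂ →
  ∃ λ Γ₂₃ → Split Γ Γ₁ Γ₂₃ × Split Γ₂₃ Γ₂ Γ₃
Split-assocʳ []        []        = -, [] , []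
Split-assocʳ (none s)  (none r)  with _ , p , q ← Split-assocʳ s r = -, none p , none q
Split-assocʳ (left s)  (left r)  with _ , p , q ← Split-assocʳ s r = -, left p , none q
Split-assocʳ (left s)  (right r) with _ , p , q ← Split-assocʳ s r = -, right p , left q
Split-assocʳ (right s) (none r)  with _ , p , q ← Split-assocʳ s r = -, right p , right q

Split-assocˡ : ∀ {n} {Γ Γ₁ Γ₂₃ Γ₂ Γ₃ : Ctx n} → Split Γ Γ₁ Γ₂₃ → Split Γ₂₃ Γ₂ Γ₃ →
  ∃ λ Γ₁₂ → Split Γ Γ₁₂ Γ₃ × Split Γ₁₂ Γ₁ Γ₂
Split-assocˡ s r with _ , p , q ← Split-assocʳ (Split-comm s) (Split-comm r) =
  -, Split-comm p , Split-comm q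

Split-exchange : ∀ {n} {Γ Γ₁ Γ₂₃ Γ₂ Γ₃ : Ctx n} → Split Γ Γ₁ Γ₂₃ → Split Γ₂₃ Γ₂ Γ₃ →
  ∃ λ Γ₁₃ → Split Γ Γ₂ Γ₁₃ × Split Γ₁₃ Γ₁ Γ₃
Split-exchange s r with _ , p , q ← Split-assocˡ s r = Split-assocʳ p (Split-comm q)

-- Typing with the shape constraints on function and pair types abstracted:
-- equality constraints give _⊢_∶_, trivial ones give linearity of raw terms.
module Judgement (Arr Ten : Ty → Ty → Ty → Set) where

  data J {n} : Ctx n → Tm n → Ty → Set where
    var  : ∀ i {A} → J (only i A) (` i) A
    lam  : ∀ {Γ t A B C} → Arr C A B → J (just A ∷ Γ) t B → J Γ (ƛ t) C
    app  : ∀ {Γ Γ₁ Γ₂ t s A B C} → Arr C A B → Split Γ Γ₁ Γ₂ →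
           J Γ₁ t C → J Γ₂ s A → J Γ (t · s) B
    pair : ∀ {Γ Γ₁ Γ₂ s t A B C} → Ten C A B → Split Γ Γ₁ Γ₂ →
           J Γ₁ s A → J Γ₂ t B → J Γ ⟨ s , t ⟩ C
    lett : ∀ {Γ Γ₁ Γ₂ s t A B C D} → Ten D A B → Split Γ Γ₁ Γ₂ →
           J Γ₁ s D → J (just A ∷ just B ∷ Γ₂) t C → J Γ (letp s t) C

size : ∀ {n} → Tm n → ℕ
size (` i)      = 0
size (t · s)    = suc (size t + size s)
size (ƛ t)      = suc (size t)
size ⟨ s , t ⟩  = suc (size s + size t)
size (letp s t) = suc (size s + size t)

size-ren : ∀ {n m} (ρ : Fin n → Fin m) t → size (ren ρ t) ≡ size t
size-ren ρ (` i)      = refl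
size-ren ρ (t · s)    = cong₂ (λ a b → suc (a + b)) (size-ren ρ t) (size-ren ρ s)
size-ren ρ (ƛ t)      = cong suc (size-ren _ t)
size-ren ρ ⟨ s , t ⟩  = cong₂ (λ a b → suc (a + b)) (size-ren ρ s) (size-ren ρ t)
size-ren ρ (letp s t) = cong₂ (λ a b → suc (a + b)) (size-ren ρ s) (size-ren _ t)

+-interchange : ∀ a b c d → (a + b) + (c + d) ≡ (a + c) + (b + d)
+-interchange a b c d = begin
  (a + b) + (c + d) ≡⟨ +-assoc a b (c + d) ⟩
  a + (b + (c + d)) ≡⟨ cong (a +_) (Eq.sym (+-assoc b c d)) ⟩
  a + ((b + c) + d) ≡⟨ cong (λ x → a + (x + d)) (+-comm b c) ⟩
  a + ((c + b) + d) ≡⟨ cong (a +_) (+-assoc c b d) ⟩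
  a + (c + (b + d)) ≡⟨ Eq.sym (+-assoc a c (b + d)) ⟩
  (a + c) + (b + d) ∎
  where open ≡-Reasoning

module Substitution (Arr Ten : Ty → Ty → Ty → Set) where
  open Judgement Arr Ten public

  -- Linear substitutions: Δ is distributed over the images of the variables
  -- declared in Γ, and w is the total size of these images.
  data Sb {m} : ∀ {n} → Ctx n → (Fin n → Tm m) → Ctx m → ℕ → Set where
    []   : ∀ {σ} → Sb [] σ ∅ 0
    none : ∀ {n} {Γ : Ctx n} {σ Δ w} → Sb Γ (σ ∘ suc) Δ w → Sb (nothing ∷ Γ) σ Δ w
    just : ∀ {n} {Γ : Ctx n} {σ Δ Δ₁ Δ₂ w A} → Split Δ Δ₁ Δ₂ → J Δ₁ (σ zero) A →
           Sb Γ (σ ∘ suc) Δ₂ w → Sb (just A ∷ Γ) σ Δ (size (σ zero) + w)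

  Sb-∅ : ∀ {n m} (σ : Fin n → Tm m) → Sb ∅ σ ∅ 0
  Sb-∅ {zero}  σ = []
  Sb-∅ {suc n} σ = none (Sb-∅ (σ ∘ suc))

  Sb-∅⁻¹ : ∀ {n m} {σ : Fin n → Tm m} {Δ w} → Sb ∅ σ Δ w → Δ ≡ ∅ × w ≡ 0
  Sb-∅⁻¹ {zero}  []       = refl , refl
  Sb-∅⁻¹ {suc n} (none s) = Sb-∅⁻¹ s

  Sb-only⁻¹ : ∀ {n m} i {σ : Fin n → Tm m} {A Δ w} → Sb (only i A) σ Δ w →
    J Δ (σ i) A × size (σ i) ≡ w
  Sb-only⁻¹ zero (just s j r) with Sb-∅⁻¹ r
  ... | refl , refl with Split-∅ʳ⁻¹ s
  ... | refl = j , Eq.sym (+-identityʳ _)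
  Sb-only⁻¹ (suc i) (none r) = Sb-only⁻¹ i r

  Sb-only : ∀ {n m} i {σ : Fin n → Tm m} {A Δ} → J Δ (σ i) A → ∃ λ w → Sb (only i A) σ Δ w
  Sb-only zero    j = -, just (Split-∅ʳ _) j (Sb-∅ _)
  Sb-only (suc i) j = -, none (proj₂ (Sb-only i j))

  Sb-split : ∀ {n m} {Γ Γ₁ Γ₂ : Ctx n} {σ : Fin n → Tm m} {Δ w} → Split Γ Γ₁ Γ₂ → Sb Γ σ Δ w →
    ∃₂ λ Δ₁ Δ₂ → ∃₂ λ w₁ w₂ →
      Split Δ Δ₁ Δ₂ × Sb Γ₁ σ Δ₁ w₁ × Sb Γ₂ σ Δ₂ w₂ × w₁ + w₂ ≡ w
  Sb-split []       []       = -, -, -, -, Split-∅ˡ _ , [] , [] , refl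
  Sb-split (none s) (none r) with _ , _ , _ , _ , p , a , b , e ← Sb-split s r =
    -, -, -, -, p , none a , none b , e
  Sb-split (left s) (just q j r)
    with _ , _ , w₁ , w₂ , p , a , b , refl ← Sb-split s r
    with _ , x , y ← Split-assocˡ q p =
    -, -, -, -, x , just y j a , none b , +-assoc _ w₁ w₂
  Sb-split {σ = σ} (right s) (just q j r)
    with _ , _ , w₁ , w₂ , p , a , b , refl ← Sb-split s r
    with _ , x , y ← Split-exchange q p =
    -, -, -, -, x , none a , just y j b ,
    Eq.trans (Eq.sym (+-assoc w₁ _ w₂)) (Eq.trans (cong (_+ w₂) (+-comm w₁ (size (σ zero)))) (+-assoc _ w₁ w₂))

  Sb-merge : ∀ {n m} {Γ Γ₁ Γ₂ : Ctx n} {σ : Fin n → Tm m} {Δ Δ₁ Δ₂ w₁ w₂} →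
    Split Γ Γ₁ Γ₂ → Split Δ Δ₁ Δ₂ → Sb Γ₁ σ Δ₁ w₁ → Sb Γ₂ σ Δ₂ w₂ → ∃ λ w → Sb Γ σ Δ w
  Sb-merge [] d [] [] with Split-∅ˡ⁻¹ d
  ... | refl = -, []
  Sb-merge (none s) d (none a) (none b) = -, none (proj₂ (Sb-merge s d a b))
  Sb-merge (left s) d (just q j a) (none b) with _ , x , y ← Split-assocʳ d q =
    -, just x j (proj₂ (Sb-merge s y a b))
  Sb-merge (right s) d (none a) (just q j b) with _ , x , y ← Split-exchange d q =
    -, just x j (proj₂ (Sb-merge s y a b))

  Sb-map : ∀ {n m m'} {Γ : Ctx n} {σ : Fin n → Tm m} {σ' : Fin n → Tm m'} {Δ w} →
    (F : Ctx m → Ctx m') → F ∅ ≡ ∅ → (∀ {Δ Δ₁ Δ₂} → Split Δ Δ₁ Δ₂ → Split (F Δ) (F Δ₁) (F Δ₂)) →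
    (∀ i {Δ A} → J Δ (σ i) A → J (F Δ) (σ' i) A) → (∀ i → size (σ' i) ≡ size (σ i)) →
    Sb Γ σ Δ w → Sb Γ σ' (F Δ) w
  Sb-map F e f g z [] rewrite e = []
  Sb-map F e f g z (none r) = none (Sb-map F e f (g ∘ suc) (z ∘ suc) r)
  Sb-map F e f g z (just s j r) rewrite Eq.sym (z zero) =
    just (f s) (g zero j) (Sb-map F e f (g ∘ suc) (z ∘ suc) r)

  Sb-wk : ∀ {n m} {Γ : Ctx n} {σ : Fin n → Tm m} {σ' : Fin n → Tm (suc m)} {Δ w} →
    (∀ i {Δ A} → J Δ (σ i) A → J (nothing ∷ Δ) (σ' i) A) → (∀ i → size (σ' i) ≡ size (σ i)) →
    Sb Γ σ Δ w → Sb Γ σ' (nothing ∷ Δ) w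
  Sb-wk = Sb-map (nothing ∷_) refl none

  Sb-extʳ : ∀ {n m} {Γ : Ctx n} {ρ : Fin n → Fin m} {Δ w A} → Sb Γ (`_ ∘ ρ) Δ w →
    Sb (just A ∷ Γ) (`_ ∘ ext ρ) (just A ∷ Δ) w
  Sb-extʳ {ρ = ρ} r = just (left (Split-∅ˡ _)) (var zero) (Sb-wk (λ { i (var _) → var _ }) (λ _ → refl) r)

  J-ren : ∀ {n m} {Γ : Ctx n} {ρ : Fin n → Fin m} {Δ w t A} → J Γ t A → Sb Γ (`_ ∘ ρ) Δ w →
    J Δ (ren ρ t) A
  J-ren (var i) r = proj₁ (Sb-only⁻¹ i r)
  J-ren (lam e j) r = lam e (J-ren j (Sb-extʳ r))
  J-ren (app e s j k) r with _ , _ , _ , _ , p , a , b , _ ← Sb-split s r =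
    app e p (J-ren j a) (J-ren k b)
  J-ren (pair e s j k) r with _ , _ , _ , _ , p , a , b , _ ← Sb-split s r =
    pair e p (J-ren j a) (J-ren k b)
  J-ren (lett e s j k) r with _ , _ , _ , _ , p , a , b , _ ← Sb-split s r =
    lett e p (J-ren j a) (J-ren k (Sb-extʳ (Sb-extʳ b)))

  Sb-id : ∀ {n} (Γ : Ctx n) → Sb Γ `_ Γ 0
  Sb-id [] = []
  Sb-id (nothing ∷ Γ) = none (Sb-wk (λ { i (var _) → var _ }) (λ _ → refl) (Sb-id Γ))
  Sb-id (just A ∷ Γ)  =
    just (left (Split-∅ˡ _)) (var zero) (Sb-wk (λ { i (var _) → var _ }) (λ _ → refl) (Sb-id Γ))

  J-wk : ∀ {n} {Γ : Ctx n} {t A} → J Γ t A → J (nothing ∷ Γ) (wk₁ t) A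
  J-wk j = J-ren j (Sb-wk (λ { i (var _) → var _ }) (λ _ → refl) (Sb-id _))

  Sb-exts : ∀ {n m} {Γ : Ctx n} {σ : Fin n → Tm m} {Δ w A} → Sb Γ σ Δ w →
    Sb (just A ∷ Γ) (exts σ) (just A ∷ Δ) w
  Sb-exts {σ = σ} r =
    just (left (Split-∅ˡ _)) (var zero) (Sb-wk (λ i j → J-wk j) (λ i → size-ren suc (σ i)) r)

  -- Every substituted term is used exactly once, so sizes add up exactly. This equation is the
  -- reason why contracting a redex decreases the size in `head`.
  J-sub : ∀ {n m} {Γ : Ctx n} {σ : Fin n → Tm m} {Δ w t A} → J Γ t A → Sb Γ σ Δ w →
    J Δ (sub σ t) A × size (sub σ t) ≡ size t + w
  J-sub (var i) r = Sb-only⁻¹ i r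
  J-sub (lam e j) r with k , z ← J-sub j (Sb-exts r) = lam e k , cong suc z
  J-sub {t = t · u} (app e s j k) r
    with _ , _ , w₁ , w₂ , p , a , b , refl ← Sb-split s r
    with j' , y ← J-sub j a | k' , z ← J-sub k b =
    app e p j' k' , cong suc (Eq.trans (cong₂ _+_ y z) (+-interchange (size t) w₁ (size u) w₂))
  J-sub {t = ⟨ t , u ⟩} (pair e s j k) r
    with _ , _ , w₁ , w₂ , p , a , b , refl ← Sb-split s r
    with j' , y ← J-sub j a | k' , z ← J-sub k b =
    pair e p j' k' , cong suc (Eq.trans (cong₂ _+_ y z) (+-interchange (size t) w₁ (size u) w₂))
  J-sub {t = letp t u} (lett e s j k) r
    with _ , _ , w₁ , w₂ , p , a , b , refl ← Sb-split s r
    with j' , y ← J-sub j a | k' , z ← J-sub k (Sb-exts (Sb-exts b)) =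
    lett e p j' k' , cong suc (Eq.trans (cong₂ _+_ y z) (+-interchange (size t) w₁ (size u) w₂))

  Sb-σ₁ : ∀ {n} {Γ Γ₁ Γ₂ : Ctx n} {s A} → Split Γ Γ₁ Γ₂ → J Γ₂ s A →
    Sb (just A ∷ Γ₁) (σ₁ s) Γ (size s + 0)
  Sb-σ₁ p j = just (Split-comm p) j (Sb-id _)

  Sb-σ₂ : ∀ {n} {Γ Γ₁₂ Γ₁ Γ₂ Γ₃ : Ctx n} {s t A B} → Split Γ Γ₁₂ Γ₃ → Split Γ₁₂ Γ₁ Γ₂ →
    J Γ₁ s A → J Γ₂ t B → Sb (just A ∷ just B ∷ Γ₃) (σ₂ s t) Γ (size s + (size t + 0))
  Sb-σ₂ p q j k with _ , x , y ← Split-assocʳ p q = just x j (just y k (Sb-id _))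

module T = Substitution (λ C A B → C ≡ A ⊸ B) (λ C A B → C ≡ A ⊗ B)

U : Ty
U = tvar 0

module L = Substitution (λ C A B → C ≡ U × A ≡ U × B ≡ U) (λ C A B → C ≡ U × A ≡ U × B ≡ U)

toJ : ∀ {n} {Γ : Ctx n} {t A} → Γ ⊢ t ∶ A → T.J Γ t A
toJ (⊢var i)      = T.var i
toJ (⊢lam d)      = T.lam refl (toJ d)
toJ (⊢app s d e)  = T.app refl s (toJ d) (toJ e)
toJ (⊢pair s d e) = T.pair refl s (toJ d) (toJ e)
toJ (⊢let s d e)  = T.lett refl s (toJ d) (toJ e)

fromJ : ∀ {n} {Γ : Ctx n} {t A} → T.J Γ t A → Γ ⊢ t ∶ A
fromJ (T.var i)           = ⊢var i
fromJ (T.lam refl d)      = ⊢lam (fromJ d)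
fromJ (T.app refl s d e)  = ⊢app s (fromJ d) (fromJ e)
fromJ (T.pair refl s d e) = ⊢pair s (fromJ d) (fromJ e)
fromJ (T.lett refl s d e) = ⊢let s (fromJ d) (fromJ e)

⊢sub : ∀ {n m} {Γ : Ctx n} {σ : Fin n → Tm m} {Δ w t A} → Γ ⊢ t ∶ A → T.Sb Γ σ Δ w →
  Δ ⊢ sub σ t ∶ A
⊢sub d r = fromJ (proj₁ (T.J-sub (toJ d) r))

⊢wk : ∀ {n} {Γ : Ctx n} {t A} → Γ ⊢ t ∶ A → (nothing ∷ Γ) ⊢ wk₁ t ∶ A
⊢wk d = fromJ (T.J-wk (toJ d))

⊢wk₂ : ∀ {n} {Γ : Ctx n} {t A} → Γ ⊢ t ∶ A → (nothing ∷ nothing ∷ Γ) ⊢ wk₂ t ∶ A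
⊢wk₂ {t = t} d = subst (_ ⊢_∶ _) (ren-ren (λ _ → refl) t) (⊢wk (⊢wk d))

-- Type substitution and raw linearity

mapCtx : ∀ {n} → (Ty → Ty) → Ctx n → Ctx n
mapCtx h = Vec.map (Maybe.map h)

mapCtx-∅ : ∀ n (h : Ty → Ty) → mapCtx h (∅ {n}) ≡ ∅
mapCtx-∅ zero    h = refl
mapCtx-∅ (suc n) h = cong (nothing ∷_) (mapCtx-∅ n h)

mapCtx-only : ∀ {n} h (i : Fin n) A → mapCtx h (only i A) ≡ only i (h A)
mapCtx-only h zero A    = cong (_ ∷_) (mapCtx-∅ _ h)
mapCtx-only h (suc i) A = cong (_ ∷_) (mapCtx-only h i A)

mapCtx-split : ∀ {n} h {Γ Γ₁ Γ₂ : Ctx n} → Split Γ Γ₁ Γ₂ →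
  Split (mapCtx h Γ) (mapCtx h Γ₁) (mapCtx h Γ₂)
mapCtx-split h []        = []
mapCtx-split h (none s)  = none (mapCtx-split h s)
mapCtx-split h (left s)  = left (mapCtx-split h s)
mapCtx-split h (right s) = right (mapCtx-split h s)

⊢⟪⟫ : ∀ {n} {Γ : Ctx n} {t A} θ → Γ ⊢ t ∶ A → substCtx θ Γ ⊢ t ∶ A ⟪ θ ⟫
⊢⟪⟫ θ (⊢var i {A}) rewrite mapCtx-only (_⟪ θ ⟫) i A = ⊢var i
⊢⟪⟫ θ (⊢lam d)      = ⊢lam (⊢⟪⟫ θ d)
⊢⟪⟫ θ (⊢app s d e)  = ⊢app (mapCtx-split _ s) (⊢⟪⟫ θ d) (⊢⟪⟫ θ e)
⊢⟪⟫ θ (⊢pair s d e) = ⊢pair (mapCtx-split _ s) (⊢⟪⟫ θ d) (⊢⟪⟫ θ e)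
⊢⟪⟫ θ (⊢let s d e)  = ⊢let (mapCtx-split _ s) (⊢⟪⟫ θ d) (⊢⟪⟫ θ e)

≐⟪⟫ : ∀ {n} {Γ : Ctx n} {t s A} θ → Γ ⊢ t ≐ s ∶ A → substCtx θ Γ ⊢ t ≐ s ∶ A ⟪ θ ⟫
≐⟪⟫ θ (ax a d e)     = ax a (⊢⟪⟫ θ d) (⊢⟪⟫ θ e)
≐⟪⟫ θ (refl d)       = refl (⊢⟪⟫ θ d)
≐⟪⟫ θ (sym p)        = sym (≐⟪⟫ θ p)
≐⟪⟫ θ (trans p q)    = trans (≐⟪⟫ θ p) (≐⟪⟫ θ q)
≐⟪⟫ θ (c-lam p)      = c-lam (≐⟪⟫ θ p)
≐⟪⟫ θ (c-app s p q)  = c-app (mapCtx-split _ s) (≐⟪⟫ θ p) (≐⟪⟫ θ q)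
≐⟪⟫ θ (c-pair s p q) = c-pair (mapCtx-split _ s) (≐⟪⟫ θ p) (≐⟪⟫ θ q)
≐⟪⟫ θ (c-let s p q)  = c-let (mapCtx-split _ s) (≐⟪⟫ θ p) (≐⟪⟫ θ q)

⊢lin : ∀ {n} {Γ : Ctx n} {t A} → Γ ⊢ t ∶ A → L.J (mapCtx (const U) Γ) t U
⊢lin (⊢var i {A}) rewrite mapCtx-only (const U) i A = L.var i
⊢lin (⊢lam d)      = L.lam (refl , refl , refl) (⊢lin d)
⊢lin (⊢app s d e)  = L.app (refl , refl , refl) (mapCtx-split _ s) (⊢lin d) (⊢lin e)
⊢lin (⊢pair s d e) = L.pair (refl , refl , refl) (mapCtx-split _ s) (⊢lin d) (⊢lin e)
⊢lin (⊢let s d e)  = L.lett (refl , refl , refl) (mapCtx-split _ s) (⊢lin d) (⊢lin e)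

-- Reflecting typings along renamings and substitutions

lookup-only : ∀ {n} (i : Fin n) A → lookup (only i A) i ≡ just A
lookup-only zero A    = refl
lookup-only (suc i) A = lookup-only i A

lookup-only-≢ : ∀ {n} (i j : Fin n) A → j ≢ i → lookup (only i A) j ≡ nothing
lookup-only-≢ zero zero A ne       = contradiction refl ne
lookup-only-≢ zero (suc j) A ne    = lookup-replicate j nothing
lookup-only-≢ (suc i) zero A ne    = refl
lookup-only-≢ (suc i) (suc j) A ne = lookup-only-≢ i j A (ne ∘ cong suc)

split-lookup : ∀ {n} {Γ Γ₁ Γ₂ : Ctx n} → Split Γ Γ₁ Γ₂ → ∀ i →
  Split (lookup Γ i ∷ []) (lookup Γ₁ i ∷ []) (lookup Γ₂ i ∷ [])
split-lookup (none s) zero     = none []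
split-lookup (left s) zero     = left []
split-lookup (right s) zero    = right []
split-lookup (none s) (suc i)  = split-lookup s i
split-lookup (left s) (suc i)  = split-lookup s i
split-lookup (right s) (suc i) = split-lookup s i

split-cons : ∀ {n} {Γ Γ₁ Γ₂ : Ctx n} {x y z} → Split (x ∷ []) (y ∷ []) (z ∷ []) →
  Split Γ Γ₁ Γ₂ → Split (x ∷ Γ) (y ∷ Γ₁) (z ∷ Γ₂)
split-cons (none []) s  = none s
split-cons (left []) s  = left s
split-cons (right []) s = right s

split-tail : ∀ {n} {Γ Γ₁ Γ₂ : Ctx (suc n)} → Split Γ Γ₁ Γ₂ → Split (tail Γ) (tail Γ₁) (tail Γ₂)
split-tail (none s)  = s
split-tail (left s)  = s
split-tail (right s) = s

pull : ∀ {n m} → (Fin n → Fin m) → Ctx m → Ctx n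
pull ρ Γ = tabulate (lookup Γ ∘ ρ)

pull-split : ∀ {n m} (ρ : Fin n → Fin m) {Γ Γ₁ Γ₂} → Split Γ Γ₁ Γ₂ →
  Split (pull ρ Γ) (pull ρ Γ₁) (pull ρ Γ₂)
pull-split {zero}  ρ s = []
pull-split {suc n} ρ s = split-cons (split-lookup s (ρ zero)) (pull-split (ρ ∘ suc) s)

Inj : ∀ {n m} → (Fin n → Fin m) → Set
Inj ρ = ∀ {i j} → ρ i ≡ ρ j → i ≡ j

Inj-ext : ∀ {n m} {ρ : Fin n → Fin m} → Inj ρ → Inj (ext ρ)
Inj-ext inj {zero}  {zero}  e = refl
Inj-ext inj {suc i} {suc j} e = cong suc (inj (Finₚ.suc-injective e))

pull-only : ∀ {n m} {ρ : Fin n → Fin m} → Inj ρ → ∀ i A → pull ρ (only (ρ i) A) ≡ only i A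
pull-only {ρ = ρ} inj i A = Eq.trans (tabulate-cong eq) (tabulate∘lookup _)
  where
  eq : ∀ j → lookup (only (ρ i) A) (ρ j) ≡ lookup (only i A) j
  eq j with j Fin.≟ i
  ... | yes refl = Eq.trans (lookup-only (ρ i) A) (Eq.sym (lookup-only i A))
  ... | no ne    = Eq.trans (lookup-only-≢ (ρ i) (ρ j) A (ne ∘ inj)) (Eq.sym (lookup-only-≢ i j A ne))

-- Restricting contexts along the renaming respects splits in any case. Injectivity is needed at the
-- leaves, where the restriction of a singleton context has to be a singleton context again.
⊢ren⁻¹ : ∀ {n m} {ρ : Fin n → Fin m} → Inj ρ → ∀ {Γ} t {A} → Γ ⊢ ren ρ t ∶ A → pull ρ Γ ⊢ t ∶ A
⊢ren⁻¹ inj (` i) {A} (⊢var _) rewrite pull-only inj i A = ⊢var i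
⊢ren⁻¹ inj (t · s) (⊢app p d e)    = ⊢app (pull-split _ p) (⊢ren⁻¹ inj t d) (⊢ren⁻¹ inj s e)
⊢ren⁻¹ inj (ƛ t) (⊢lam d)          = ⊢lam (⊢ren⁻¹ (Inj-ext inj) t d)
⊢ren⁻¹ inj ⟨ s , t ⟩ (⊢pair p d e) = ⊢pair (pull-split _ p) (⊢ren⁻¹ inj s d) (⊢ren⁻¹ inj t e)
⊢ren⁻¹ inj (letp s t) (⊢let p d e) =
  ⊢let (pull-split _ p) (⊢ren⁻¹ inj s d) (⊢ren⁻¹ (Inj-ext (Inj-ext inj)) t e)

⊢wk⁻¹ : ∀ {n} {Γ : Ctx (suc n)} {t A} → Γ ⊢ wk₁ t ∶ A → tail Γ ⊢ t ∶ A
⊢wk⁻¹ {Γ = _ ∷ Γ} {t} d = subst (_⊢ t ∶ _) (tabulate∘lookup Γ) (⊢ren⁻¹ Finₚ.suc-injective t d)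

split-just : ∀ {n} {Γ Γ₁ Γ₂ : Ctx n} → Split Γ Γ₁ Γ₂ → ∀ i {A} →
  lookup Γ₁ i ≡ just A → lookup Γ i ≡ just A
split-just (left s) zero e     = e
split-just (none s) (suc i) e  = split-just s i e
split-just (left s) (suc i) e  = split-just s i e
split-just (right s) (suc i) e = split-just s i e

Covers : ∀ {n m} → (Fin n → Fin m) → Ctx m → Set
Covers ρ Γ = ∀ j {B} → lookup Γ j ≡ just B → ∃ λ i → ρ i ≡ j

Covers-ext : ∀ {n m} {ρ : Fin n → Fin m} {Γ x} → Covers ρ Γ → Covers (ext ρ) (x ∷ Γ)
Covers-ext c zero e = zero , refl
Covers-ext c (suc j) e with i , refl ← c j e = suc i , refl

Covers-split : ∀ {n m} {ρ : Fin n → Fin m} {Γ Γ₁ Γ₂} → Split Γ Γ₁ Γ₂ → Covers ρ Γ →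
  Covers ρ Γ₁ × Covers ρ Γ₂
Covers-split s c = (λ j e → c j (split-just s j e)) , (λ j e → c j (split-just (Split-comm s) j e))

unren : ∀ {n m} {ρ : Fin n → Fin m} {Γ t A} → Covers ρ Γ → Γ ⊢ t ∶ A → ∃ λ t' → ren ρ t' ≡ t
unren c (⊢var i {A}) with j , refl ← c i (lookup-only i A) = ` j , refl
unren c (⊢lam d) with _ , refl ← unren (Covers-ext c) d = -, refl
unren c (⊢app s d e) with c₁ , c₂ ← Covers-split s c
  with _ , refl ← unren c₁ d | _ , refl ← unren c₂ e = _ · _ , refl
unren c (⊢pair s d e) with c₁ , c₂ ← Covers-split s c
  with _ , refl ← unren c₁ d | _ , refl ← unren c₂ e = ⟨ _ , _ ⟩ , refl
unren c (⊢let s d e) with c₁ , c₂ ← Covers-split s c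
  with _ , refl ← unren c₁ d | _ , refl ← unren (Covers-ext (Covers-ext c₂)) e = letp _ _ , refl

strengthen : ∀ {n} {Γ : Ctx n} {t A} → (nothing ∷ Γ) ⊢ t ∶ A → ∃ λ t' → wk₁ t' ≡ t × Γ ⊢ t' ∶ A
strengthen d with t' , refl ← unren (λ { (suc j) e → j , refl }) d = t' , refl , ⊢wk⁻¹ d

strengthen₂ : ∀ {n} {Γ : Ctx n} {t A} → (nothing ∷ nothing ∷ Γ) ⊢ t ∶ A →
  ∃ λ t' → wk₂ t' ≡ t × Γ ⊢ t' ∶ A
strengthen₂ d with _ , refl , d' ← strengthen d with t , refl , d'' ← strengthen d' =
  t , Eq.sym (ren-ren (λ _ → refl) t) , d''

-- Agreement about which variables are declared, not about their types: raw linearity fixes the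
-- positions, and the types are only found by `sub⁻¹`.
data Shape : ∀ {n} → Ctx n → Ctx n → Set where
  []      : Shape [] []
  nothing : ∀ {n} {Γ Δ : Ctx n} → Shape Γ Δ → Shape (nothing ∷ Γ) (nothing ∷ Δ)
  just    : ∀ {n} {Γ Δ : Ctx n} {A B} → Shape Γ Δ → Shape (just A ∷ Γ) (just B ∷ Δ)

Shape-∅ : ∀ n → Shape (∅ {n}) ∅
Shape-∅ zero    = []
Shape-∅ (suc n) = nothing (Shape-∅ n)

Shape-only : ∀ {n} (i : Fin n) {A B} → Shape (only i A) (only i B)
Shape-only zero    = just (Shape-∅ _)
Shape-only (suc i) = nothing (Shape-only i)

Shape-split : ∀ {n} {Γ Γ₁ Γ₂ Δ₁ Δ₂ : Ctx n} → Split Γ Γ₁ Γ₂ → Shape Γ₁ Δ₁ → Shape Γ₂ Δ₂ →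
  ∃ λ Δ → Split Δ Δ₁ Δ₂ × Shape Γ Δ
Shape-split [] [] [] = -, [] , []
Shape-split (none s) (nothing a) (nothing b) with _ , p , q ← Shape-split s a b = -, none p , nothing q
Shape-split (left s) (just a) (nothing b) with _ , p , q ← Shape-split s a b = -, left p , just q
Shape-split (right s) (nothing a) (just b) with _ , p , q ← Shape-split s a b = -, right p , just q

Sb-exts⁻¹ : ∀ {n m} {Γ : Ctx n} {σ : Fin n → Tm m} {Δ A B w} →
  T.Sb (just A ∷ Γ) (exts σ) (just B ∷ Δ) w → A ≡ B × T.Sb Γ σ Δ w
Sb-exts⁻¹ {σ = σ} (T.just (left s) (T.var _) r) with Split-∅ˡ⁻¹ s
... | refl = refl ,
  T.Sb-map tail refl split-tail (λ i j → toJ (⊢wk⁻¹ (fromJ j))) (λ i → Eq.sym (size-ren suc (σ i))) r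

-- As `b` uses each declared variable once, the image of the variable occurs once in the typed term,
-- and the type that it has there can be declared for the variable. Several copies could have
-- different types, and a dropped term would have none.
sub⁻¹ : ∀ {n m} {Ω : Ctx n} {b C} {σ : Fin n → Tm m} {Δ A} → L.J Ω b C → Δ ⊢ sub σ b ∶ A →
  ∃₂ λ Γ w → Shape Ω Γ × Γ ⊢ b ∶ A × T.Sb Γ σ Δ w
sub⁻¹ (L.var i) d = -, -, Shape-only i , ⊢var i , proj₂ (T.Sb-only i (toJ d))
sub⁻¹ (L.lam _ j) (⊢lam d) with sub⁻¹ j d
... | _ , _ , just sh , d' , r with Sb-exts⁻¹ r
... | refl , r' = -, -, sh , ⊢lam d' , r'
sub⁻¹ (L.app _ s j k) (⊢app p d e) with sub⁻¹ j d | sub⁻¹ k e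
... | _ , _ , sh₁ , d' , r₁ | _ , _ , sh₂ , e' , r₂ with _ , q , sh ← Shape-split s sh₁ sh₂ =
  -, -, sh , ⊢app q d' e' , proj₂ (T.Sb-merge q p r₁ r₂)
sub⁻¹ (L.pair _ s j k) (⊢pair p d e) with sub⁻¹ j d | sub⁻¹ k e
... | _ , _ , sh₁ , d' , r₁ | _ , _ , sh₂ , e' , r₂ with _ , q , sh ← Shape-split s sh₁ sh₂ =
  -, -, sh , ⊢pair q d' e' , proj₂ (T.Sb-merge q p r₁ r₂)
sub⁻¹ (L.lett _ s j k) (⊢let p d e) with sub⁻¹ j d | sub⁻¹ k e
... | _ , _ , sh₁ , d' , r₁ | _ , _ , just (just sh₂) , e' , r₂
  with refl , r₃ ← Sb-exts⁻¹ r₂ with refl , r₄ ← Sb-exts⁻¹ r₃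
  with _ , q , sh ← Shape-split s sh₁ sh₂ =
  -, -, sh , ⊢let q d' e' , proj₂ (T.Sb-merge q p r₁ r₄)

-- Weak head reduction and subject expansion

infix 3 _⟶_ _⟶*_
data _⟶_ : Tm 0 → Tm 0 → Set where
  β    : ∀ {t s} → (ƛ t) · s ⟶ sub (σ₁ s) t
  βlet : ∀ {u v w} → letp ⟨ u , v ⟩ w ⟶ sub (σ₂ u v) w
  appˡ : ∀ {t t' s} → t ⟶ t' → t · s ⟶ t' · s
  letˡ : ∀ {t t' s} → t ⟶ t' → letp t s ⟶ letp t' s

Lin : Tm 0 → Set
Lin t = L.J [] t U

⟶-lin : ∀ {t t'} → Lin t → t ⟶ t' → Lin t'
⟶-lin (L.app (refl , refl , refl) [] (L.lam (_ , refl , refl) j) k) β =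
  proj₁ (L.J-sub j (L.Sb-σ₁ [] k))
⟶-lin (L.lett (refl , refl , refl) [] (L.pair (_ , refl , refl) [] j k) l) βlet =
  proj₁ (L.J-sub l (L.Sb-σ₂ [] [] j k))
⟶-lin (L.app e@(refl , refl , refl) [] j k) (appˡ r) = L.app e [] (⟶-lin j r) k
⟶-lin (L.lett e@(refl , refl , refl) [] j k) (letˡ r) = L.lett e [] (⟶-lin j r) k

-- Only raw linearity of the redex is assumed; its typing is rebuilt from that of the reduct. With
-- both ends typed, the step becomes an instance of the typed equality.
⟶-expand : ∀ {t t' A} → Lin t → t ⟶ t' → [] ⊢ t' ∶ A → [] ⊢ t ∶ A × [] ⊢ t ≐ t' ∶ A
⟶-expand (L.app (refl , refl , refl) [] (L.lam _ j) k) β d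
  with _ , _ , just [] , b , T.just {Δ₁ = []} {[]} [] a T.[] ← sub⁻¹ j d =
  let e = ⊢app [] (⊢lam b) (fromJ a) in e , ax (β _ _) e d
⟶-expand (L.lett (refl , refl , refl) [] _ l) βlet d
  with _ , _ , just (just []) , b , T.just {Δ₁ = []} {[]} [] u (T.just {Δ₁ = []} {[]} [] v T.[]) ← sub⁻¹ l d =
  let e = ⊢let [] (⊢pair [] (fromJ u) (fromJ v)) b in e , ax (βlet _ _ _) e d
⟶-expand (L.app (refl , refl , refl) [] j _) (appˡ r) (⊢app [] d e)
  with d' , p ← ⟶-expand j r d = ⊢app [] d' e , c-app [] p (refl e)
⟶-expand (L.lett (refl , refl , refl) [] j _) (letˡ r) (⊢let [] d e)
  with d' , p ← ⟶-expand j r d = ⊢let [] d' e , c-let [] p (refl e)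

data _⟶*_ : Tm 0 → Tm 0 → Set where
  ε   : ∀ {t} → t ⟶* t
  _◅_ : ∀ {t u v} → t ⟶ u → u ⟶* v → t ⟶* v
infixr 5 _◅_ _◅◅_
infixl 4 _▹_

_◅◅_ : ∀ {t u v} → t ⟶* u → u ⟶* v → t ⟶* v
ε ◅◅ q       = q
(r ◅ p) ◅◅ q = r ◅ (p ◅◅ q)

_▹_ : ∀ {t u v} → t ⟶* u → u ≡ v → t ⟶* v
p ▹ refl = p

appˡ* : ∀ {t t' s} → t ⟶* t' → t · s ⟶* t' · s
appˡ* ε       = ε
appˡ* (r ◅ p) = appˡ r ◅ appˡ* p

letˡ* : ∀ {t t' s} → t ⟶* t' → letp t s ⟶* letp t' s
letˡ* ε       = ε
letˡ* (r ◅ p) = letˡ r ◅ letˡ* p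

⟶*-expand : ∀ {t t' A} → Lin t → t ⟶* t' → [] ⊢ t' ∶ A → [] ⊢ t ∶ A × [] ⊢ t ≐ t' ∶ A
⟶*-expand l ε d = d , refl d
⟶*-expand l (r ◅ p) d with d' , q ← ⟶*-expand (⟶-lin l r) p d with d'' , q' ← ⟶-expand l r d' =
  d'' , trans q' q

-- Linearity of concrete terms by computation

merge : ∀ {n} (Γ₁ Γ₂ : Ctx n) → Maybe (∃ λ Γ → Split Γ Γ₁ Γ₂)
merge [] [] = just (-, [])
merge (nothing ∷ Γ₁) (nothing ∷ Γ₂) = Maybe.map (λ (_ , s) → -, none s) (merge Γ₁ Γ₂)
merge (just _ ∷ Γ₁) (nothing ∷ Γ₂)  = Maybe.map (λ (_ , s) → -, left s) (merge Γ₁ Γ₂)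
merge (nothing ∷ Γ₁) (just _ ∷ Γ₂)  = Maybe.map (λ (_ , s) → -, right s) (merge Γ₁ Γ₂)
merge (just _ ∷ Γ₁) (just _ ∷ Γ₂)   = nothing

infer : ∀ {n} (t : Tm n) → Maybe (∃ λ Γ → L.J Γ t U)
infer (` i) = just (-, L.var i)
infer (t · s) = do
  _ , j ← infer t
  _ , k ← infer s
  _ , p ← merge _ _
  just (-, L.app (refl , refl , refl) p j k)
infer (ƛ t) = infer t >>= λ where
  (just (tvar 0) ∷ _ , j) → just (-, L.lam (refl , refl , refl) j)
  _ → nothing
infer ⟨ s , t ⟩ = do
  _ , j ← infer s
  _ , k ← infer t
  _ , p ← merge _ _
  just (-, L.pair (refl , refl , refl) p j k)
infer (letp s t) = infer t >>= λ where
  (just (tvar 0) ∷ just (tvar 0) ∷ _ , k) → do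
    _ , j ← infer s
    _ , p ← merge _ _
    just (-, L.lett (refl , refl , refl) p j k)
  _ → nothing

-- The implicit argument has the unit type as soon as the inference succeeds, so for concrete
-- combinators evaluation supplies the proof.
lin! : (t : Tm 0) {_ : IsTrue (Maybe.is-just (infer t))} → Lin t
lin! t {p} with infer t | p
... | just ([] , j) | _ = j

-- Unification and principal types

⟪⟫-∘ : ∀ {θ θ' θ''} A → (∀ a → θ a ⟪ θ' ⟫ ≡ θ'' a) → A ⟪ θ ⟫ ⟪ θ' ⟫ ≡ A ⟪ θ'' ⟫
⟪⟫-∘ (tvar a) e = e a
⟪⟫-∘ (A ⊗ B) e  = cong₂ _⊗_ (⟪⟫-∘ A e) (⟪⟫-∘ B e)
⟪⟫-∘ (A ⊸ B) e  = cong₂ _⊸_ (⟪⟫-∘ A e) (⟪⟫-∘ B e)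

⟪⟫-id : ∀ {θ} A → θ ≗ tvar → A ⟪ θ ⟫ ≡ A
⟪⟫-id (tvar a) e = e a
⟪⟫-id (A ⊗ B) e  = cong₂ _⊗_ (⟪⟫-id A e) (⟪⟫-id B e)
⟪⟫-id (A ⊸ B) e  = cong₂ _⊸_ (⟪⟫-id A e) (⟪⟫-id B e)

substCtx-∘ : ∀ {n θ θ' θ''} (Γ : Ctx n) → (∀ a → θ a ⟪ θ' ⟫ ≡ θ'' a) →
  substCtx θ' (substCtx θ Γ) ≡ substCtx θ'' Γ
substCtx-∘ [] e            = refl
substCtx-∘ (nothing ∷ Γ) e = cong (nothing ∷_) (substCtx-∘ Γ e)
substCtx-∘ (just A ∷ Γ) e  = cong₂ (λ B Δ → just B ∷ Δ) (⟪⟫-∘ A e) (substCtx-∘ Γ e)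

substCtx-split⁻¹ : ∀ {n θ} {Γ Γ₁ Γ₂ Δ Δ₁ Δ₂ : Ctx n} → Split Γ Γ₁ Γ₂ → Split Δ Δ₁ Δ₂ →
  substCtx θ Γ₁ ≡ Δ₁ → substCtx θ Γ₂ ≡ Δ₂ → substCtx θ Γ ≡ Δ
substCtx-split⁻¹ [] [] refl refl = refl
substCtx-split⁻¹ (none s) (none r) refl e with refl , e' ← ∷-injective e =
  cong (nothing ∷_) (substCtx-split⁻¹ s r refl e')
substCtx-split⁻¹ (left s) (left r) refl e with refl , e' ← ∷-injective e =
  cong (just _ ∷_) (substCtx-split⁻¹ s r refl e')
substCtx-split⁻¹ (right s) (right r) e refl with refl , e' ← ∷-injective e =
  cong (just _ ∷_) (substCtx-split⁻¹ s r e' refl)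
substCtx-split⁻¹ (none s) (left r) () e
substCtx-split⁻¹ (none s) (right r) e ()
substCtx-split⁻¹ (left s) (none r) () e
substCtx-split⁻¹ (left s) (right r) () e
substCtx-split⁻¹ (right s) (none r) e ()
substCtx-split⁻¹ (right s) (left r) e ()

tsize : Ty → ℕ
tsize (tvar _) = 1
tsize (A ⊗ B)  = suc (tsize A + tsize B)
tsize (A ⊸ B)  = suc (tsize A + tsize B)

data _occursIn_ (x : ℕ) : Ty → Set where
  here : x occursIn tvar x
  ⊗ˡ   : ∀ {A B} → x occursIn A → x occursIn (A ⊗ B)
  ⊗ʳ   : ∀ {A B} → x occursIn B → x occursIn (A ⊗ B)
  ⊸ˡ   : ∀ {A B} → x occursIn A → x occursIn (A ⊸ B)
  ⊸ʳ   : ∀ {A B} → x occursIn B → x occursIn (A ⊸ B)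

_↦_ : ℕ → Ty → TySubst
(x ↦ B) a with a ≟ x
... | yes _ = B
... | no _  = tvar a

↦-self : ∀ x B → (x ↦ B) x ≡ B
↦-self x B with x ≟ x
... | yes _ = refl
... | no ne = contradiction refl ne

fresh-or-occurs : ∀ x B A → A ⟪ x ↦ B ⟫ ≡ A ⊎ x occursIn A
fresh-or-occurs x B (tvar a) with a ≟ x
... | yes refl = inj₂ here
... | no _     = inj₁ refl
fresh-or-occurs x B (A ⊗ C) with fresh-or-occurs x B A | fresh-or-occurs x B C
... | inj₁ p | inj₁ q = inj₁ (cong₂ _⊗_ p q)
... | inj₂ o | _      = inj₂ (⊗ˡ o)
... | inj₁ _ | inj₂ o = inj₂ (⊗ʳ o)
fresh-or-occurs x B (A ⊸ C) with fresh-or-occurs x B A | fresh-or-occurs x B C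
... | inj₁ p | inj₁ q = inj₁ (cong₂ _⊸_ p q)
... | inj₂ o | _      = inj₂ (⊸ˡ o)
... | inj₁ _ | inj₂ o = inj₂ (⊸ʳ o)

occurs-≤ : ∀ {x A} θ → x occursIn A → tsize (θ x) ≤ tsize (A ⟪ θ ⟫)
occurs-≤ θ here   = ≤-refl
occurs-≤ θ (⊗ˡ o) = ≤-trans (occurs-≤ θ o) (≤-trans (m≤m+n _ _) (n≤1+n _))
occurs-≤ θ (⊗ʳ o) = ≤-trans (occurs-≤ θ o) (≤-trans (m≤n+m _ _) (n≤1+n _))
occurs-≤ θ (⊸ˡ o) = ≤-trans (occurs-≤ θ o) (≤-trans (m≤m+n _ _) (n≤1+n _))
occurs-≤ θ (⊸ʳ o) = ≤-trans (occurs-≤ θ o) (≤-trans (m≤n+m _ _) (n≤1+n _))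

-- In a compound type around `x`, the instance would be strictly larger than `θ x`. As a unifier is
-- always at hand, the occurs check thus never leads to failure.
occurs-eq : ∀ {x A} θ → x occursIn A → θ x ≡ A ⟪ θ ⟫ → A ≡ tvar x
occurs-eq θ here e = refl
occurs-eq θ (⊗ˡ o) e = ⊥-elim (<-irrefl (cong tsize e) (s≤s (≤-trans (occurs-≤ θ o) (m≤m+n _ _))))
occurs-eq θ (⊗ʳ o) e = ⊥-elim (<-irrefl (cong tsize e) (s≤s (≤-trans (occurs-≤ θ o) (m≤n+m _ _))))
occurs-eq θ (⊸ˡ o) e = ⊥-elim (<-irrefl (cong tsize e) (s≤s (≤-trans (occurs-≤ θ o) (m≤m+n _ _))))
occurs-eq θ (⊸ʳ o) e = ⊥-elim (<-irrefl (cong tsize e) (s≤s (≤-trans (occurs-≤ θ o) (m≤n+m _ _))))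

record Mgu (A B : Ty) : Set where
  constructor mgu
  field
    σ       : TySubst
    unifies : A ⟪ σ ⟫ ≡ B ⟪ σ ⟫
    factor  : ∀ θ → A ⟪ θ ⟫ ≡ B ⟪ θ ⟫ → ∃ λ θ' → ∀ a → σ a ⟪ θ' ⟫ ≡ θ a

Mgu-sym : ∀ {A B} → Mgu A B → Mgu B A
Mgu-sym (mgu σ u f) = mgu σ (Eq.sym u) (λ θ e → f θ (Eq.sym e))

unify-var : ∀ x B θ → θ x ≡ B ⟪ θ ⟫ → Mgu (tvar x) B
unify-var x B θ e with fresh-or-occurs x B B
... | inj₂ o with occurs-eq θ o e
...   | refl = mgu tvar refl (λ θ _ → θ , λ _ → refl)
unify-var x B θ e | inj₁ p = mgu (x ↦ B) (Eq.trans (↦-self x B) (Eq.sym p)) (λ θ' e' → θ' , eq θ' e')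
  where
  eq : ∀ θ' → θ' x ≡ B ⟪ θ' ⟫ → ∀ a → (x ↦ B) a ⟪ θ' ⟫ ≡ θ' a
  eq θ' e' a with a ≟ x
  ... | yes refl = Eq.sym e'
  ... | no _     = refl

⊗-inj : ∀ {A B C D} → A ⊗ B ≡ C ⊗ D → A ≡ C × B ≡ D
⊗-inj refl = refl , refl

⊸-inj : ∀ {A B C D} → A ⊸ B ≡ C ⊸ D → A ≡ C × B ≡ D
⊸-inj refl = refl , refl

Mgu-⊗ : ∀ {A₁ A₂ B₁ B₂} (m : Mgu A₁ B₁) → Mgu (A₂ ⟪ Mgu.σ m ⟫) (B₂ ⟪ Mgu.σ m ⟫) →
  Mgu (A₁ ⊗ A₂) (B₁ ⊗ B₂)
Mgu-⊗ {A₁} {A₂} {B₁} {B₂} (mgu σ u f) (mgu τ v g) = mgu (λ a → σ a ⟪ τ ⟫)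
  (cong₂ _⊗_ (Eq.trans (Eq.sym (⟪⟫-∘ A₁ (λ _ → refl)))
                (Eq.trans (cong _⟪ τ ⟫ u) (⟪⟫-∘ B₁ (λ _ → refl))))
             (Eq.trans (Eq.sym (⟪⟫-∘ A₂ (λ _ → refl))) (Eq.trans v (⟪⟫-∘ B₂ (λ _ → refl)))))
  λ θ e → let θ' , p = f θ (proj₁ (⊗-inj e))
              θ'' , q = g θ' (Eq.trans (⟪⟫-∘ A₂ p) (Eq.trans (proj₂ (⊗-inj e)) (Eq.sym (⟪⟫-∘ B₂ p))))
          in θ'' , λ a → Eq.trans (⟪⟫-∘ (σ a) q) (p a)

Mgu-⊗⇒⊸ : ∀ {A₁ A₂ B₁ B₂} → Mgu (A₁ ⊗ A₂) (B₁ ⊗ B₂) → Mgu (A₁ ⊸ A₂) (B₁ ⊸ B₂)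
Mgu-⊗⇒⊸ (mgu σ u f) = mgu σ (cong₂ _⊸_ (proj₁ (⊗-inj u)) (proj₂ (⊗-inj u)))
  (λ θ e → f θ (cong₂ _⊗_ (proj₁ (⊸-inj e)) (proj₂ (⊸-inj e))))

-- Structural in the common instance C, which does not grow when a variable is eliminated.
unify : ∀ C A B θ → A ⟪ θ ⟫ ≡ C → B ⟪ θ ⟫ ≡ C → Mgu A B
unify C (tvar x) B θ p q = unify-var x B θ (Eq.trans p (Eq.sym q))
unify C A@(_ ⊗ _) (tvar x) θ p q = Mgu-sym (unify-var x A θ (Eq.trans q (Eq.sym p)))
unify C A@(_ ⊸ _) (tvar x) θ p q = Mgu-sym (unify-var x A θ (Eq.trans q (Eq.sym p)))
unify (C₁ ⊗ C₂) (A₁ ⊗ A₂) (B₁ ⊗ B₂) θ p q =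
  let p₁ , p₂ = ⊗-inj p
      q₁ , q₂ = ⊗-inj q
      m = unify C₁ A₁ B₁ θ p₁ q₁
      θ' , e = Mgu.factor m θ (Eq.trans p₁ (Eq.sym q₁))
  in Mgu-⊗ m (unify C₂ _ _ θ' (Eq.trans (⟪⟫-∘ A₂ e) p₂) (Eq.trans (⟪⟫-∘ B₂ e) q₂))
unify (C₁ ⊸ C₂) (A₁ ⊸ A₂) (B₁ ⊸ B₂) θ p q =
  let p₁ , p₂ = ⊸-inj p
      q₁ , q₂ = ⊸-inj q
      m = unify C₁ A₁ B₁ θ p₁ q₁
      θ' , e = Mgu.factor m θ (Eq.trans p₁ (Eq.sym q₁))
  in Mgu-⊗⇒⊸ (Mgu-⊗ m (unify C₂ _ _ θ' (Eq.trans (⟪⟫-∘ A₂ e) p₂) (Eq.trans (⟪⟫-∘ B₂ e) q₂)))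
unify _ (_ ⊗ _) (_ ⊸ _) θ refl ()
unify _ (_ ⊸ _) (_ ⊗ _) θ refl ()

-- Even and odd numbers keep the type variables of two typings apart.
evens odds : ℕ → ℕ
evens zero    = 0
evens (suc n) = suc (suc (evens n))
odds zero     = 1
odds (suc n)  = suc (suc (odds n))

copair : ∀ {X : Set} → (ℕ → X) → (ℕ → X) → ℕ → X
copair f g zero          = f 0
copair f g (suc zero)    = g 0
copair f g (suc (suc n)) = copair (f ∘ suc) (g ∘ suc) n

copair-evens : ∀ {X : Set} (f g : ℕ → X) n → copair f g (evens n) ≡ f n
copair-evens f g zero    = refl
copair-evens f g (suc n) = copair-evens (f ∘ suc) (g ∘ suc) n

copair-odds : ∀ {X : Set} (f g : ℕ → X) n → copair f g (odds n) ≡ g n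
copair-odds f g zero    = refl
copair-odds f g (suc n) = copair-odds (f ∘ suc) (g ∘ suc) n

↑ᵉ ↑ᵒ : TySubst
↑ᵉ = tvar ∘ evens
↑ᵒ = tvar ∘ odds

Shape-mapCtx : ∀ {n} h k (Γ : Ctx n) → Shape (mapCtx h Γ) (mapCtx k Γ)
Shape-mapCtx h k []            = []
Shape-mapCtx h k (nothing ∷ Γ) = nothing (Shape-mapCtx h k Γ)
Shape-mapCtx h k (just A ∷ Γ)  = just (Shape-mapCtx h k Γ)

split-instances : ∀ {n} {Γ Δ₁ Δ₂ : Ctx n} {Γ₁ Γ₂ θ₁ θ₂} → Split Γ Δ₁ Δ₂ →
  substCtx θ₁ Γ₁ ≡ Δ₁ → substCtx θ₂ Γ₂ ≡ Δ₂ → ∀ τ₁ τ₂ →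
  ∃ λ Γ' → Split Γ' (substCtx τ₁ Γ₁) (substCtx τ₂ Γ₂)
split-instances {Γ₁ = Γ₁} {Γ₂} s refl refl τ₁ τ₂ =
  let _ , q , _ = Shape-split s (Shape-mapCtx _ _ Γ₁) (Shape-mapCtx _ _ Γ₂) in -, q

PT : ∀ {n} → Tm n → Set
PT t = Σ Ty (IsPrincipalType t)

∷≡ : ∀ {n} {A B : Ty} {Γ Δ : Ctx n} → (just A ∷ Γ) ≡ (just B ∷ Δ) → A ≡ B × Γ ≡ Δ
∷≡ refl = refl , refl

principal : ∀ {n} {Γ : Ctx n} {t A} → Γ ⊢ t ∶ A → PT t
principal (⊢var i) = tvar 0 , -, ⊢var i ,
  λ { _ A (⊢var _) → const A , mapCtx-only _ i (tvar 0) , refl }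
principal (⊢lam d) with principal d
-- The given typing `d` declares the bound variable and is an instance of the principal one, so the
-- principal context declares it too.
... | P , Γ , p , univ with univ _ _ d
principal (⊢lam d) | P , just X ∷ Γ , p , univ | _ = X ⊸ P , Γ , ⊢lam p ,
  λ { _ _ (⊢lam d') → let θ , e , f = univ _ _ d' ; e₁ , e₂ = ∷≡ e in θ , e₂ , cong₂ _⊸_ e₁ f }
principal (⊢lam d) | P , nothing ∷ Γ , p , univ | _ , () , _
principal (⊢pair s d e)
  with P₁ , Γ₁ , p₁ , univ₁ ← principal d | P₂ , Γ₂ , p₂ , univ₂ ← principal e =
  let _ , s₁ , _ = univ₁ _ _ d
      _ , s₂ , _ = univ₂ _ _ e
      Γ , q = split-instances s s₁ s₂ ↑ᵉ ↑ᵒ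
  in P₁ ⟪ ↑ᵉ ⟫ ⊗ P₂ ⟪ ↑ᵒ ⟫ , Γ , ⊢pair q (⊢⟪⟫ ↑ᵉ p₁) (⊢⟪⟫ ↑ᵒ p₂) , λ where
    _ _ (⊢pair s' d' e') →
      let θ₁ , c₁ , f₁ = univ₁ _ _ d'
          θ₂ , c₂ , f₂ = univ₂ _ _ e'
          l = copair-evens θ₁ θ₂ ; r = copair-odds θ₁ θ₂
      in copair θ₁ θ₂ ,
         substCtx-split⁻¹ q s' (Eq.trans (substCtx-∘ Γ₁ l) c₁) (Eq.trans (substCtx-∘ Γ₂ r) c₂) ,
         cong₂ _⊗_ (Eq.trans (⟪⟫-∘ P₁ l) f₁) (Eq.trans (⟪⟫-∘ P₂ r) f₂)
principal (⊢app {A = A₀} {B₀} s d e)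
  with P₁ , Γ₁ , p₁ , univ₁ ← principal d | P₂ , Γ₂ , p₂ , univ₂ ← principal e =
  let θ₁ , s₁ , f₁ = univ₁ _ _ d
      θ₂ , s₂ , f₂ = univ₂ _ _ e
      Γ , q = split-instances s s₁ s₂ ↑ᵉ ↑ᵒᵉ
      m = unify (A₀ ⊸ B₀) (P₁ ⟪ ↑ᵉ ⟫) (P₂ ⟪ ↑ᵒᵉ ⟫ ⊸ α) (join θ₁ θ₂ B₀)
            (Eq.trans (⟪⟫-∘ P₁ (copair-evens _ _)) f₁)
            (cong₂ _⊸_ (Eq.trans (⟪⟫-∘ P₂ (join-oe θ₁ θ₂ B₀)) f₂) (join-α θ₁ θ₂ B₀))
      open Mgu m
  in α ⟪ σ ⟫ , substCtx σ Γ ,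
     ⊢app (mapCtx-split _ q)
       (subst (λ C → substCtx σ (substCtx ↑ᵉ Γ₁) ⊢ _ ∶ C) unifies (⊢⟪⟫ σ (⊢⟪⟫ ↑ᵉ p₁))) (⊢⟪⟫ σ (⊢⟪⟫ ↑ᵒᵉ p₂)) , λ where
    _ B (⊢app s' d' e') →
      let θ₁ , c₁ , f₁ = univ₁ _ _ d'
          θ₂ , c₂ , f₂ = univ₂ _ _ e'
          θ = join θ₁ θ₂ B
          l = copair-evens θ₁ _ ; r = join-oe θ₁ θ₂ B
          θ' , g = factor θ (Eq.trans (Eq.trans (⟪⟫-∘ P₁ l) f₁)
                     (Eq.sym (cong₂ _⊸_ (Eq.trans (⟪⟫-∘ P₂ r) f₂) (join-α θ₁ θ₂ B))))
      in θ' ,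
         Eq.trans (substCtx-∘ Γ g)
           (substCtx-split⁻¹ q s' (Eq.trans (substCtx-∘ Γ₁ l) c₁) (Eq.trans (substCtx-∘ Γ₂ r) c₂)) ,
         Eq.trans (g (odds (odds 0))) (join-α θ₁ θ₂ B)
  where
  -- Three disjoint supplies of names: evens for the function, odd images of evens for the argument,
  -- and one more odd name `α` for the result type.
  ↑ᵒᵉ : TySubst
  ↑ᵒᵉ = tvar ∘ odds ∘ evens
  α : Ty
  α = tvar (odds (odds 0))
  join : TySubst → TySubst → Ty → TySubst
  join θ₁ θ₂ B = copair θ₁ (copair θ₂ (const B))
  join-oe : ∀ θ₁ θ₂ B a → join θ₁ θ₂ B (odds (evens a)) ≡ θ₂ a
  join-oe θ₁ θ₂ B a = Eq.trans (copair-odds θ₁ _ (evens a)) (copair-evens θ₂ _ a)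
  join-α : ∀ θ₁ θ₂ B → α ⟪ join θ₁ θ₂ B ⟫ ≡ B
  join-α θ₁ θ₂ B = refl
principal (⊢let {A = A₀} {B₀} s d e) with principal d | principal e
... | P₁ , Γ₁ , p₁ , univ₁ | P₂ , Γ₂ , p₂ , univ₂ with univ₁ _ _ d | univ₂ _ _ e
principal (⊢let {A = A₀} {B₀} s d e)
  | P₁ , Γ₁ , p₁ , univ₁ | P₂ , just X ∷ just Y ∷ Γ₂ , p₂ , univ₂ | θ₁ , s₁ , f₁ | θ₂ , s₂ , f₂ =
  let x₁ , s₂′ = ∷≡ s₂
      y₁ , s₃ = ∷≡ s₂′
      Γ , q = split-instances s s₁ s₃ ↑ᵉ ↑ᵒ
      m = unify (A₀ ⊗ B₀) (P₁ ⟪ ↑ᵉ ⟫) (X ⟪ ↑ᵒ ⟫ ⊗ Y ⟪ ↑ᵒ ⟫) (copair θ₁ θ₂)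
            (Eq.trans (⟪⟫-∘ P₁ (copair-evens _ _)) f₁)
            (cong₂ _⊗_ (Eq.trans (⟪⟫-∘ X (copair-odds θ₁ θ₂)) x₁)
                       (Eq.trans (⟪⟫-∘ Y (copair-odds θ₁ θ₂)) y₁))
      open Mgu m
  in P₂ ⟪ ↑ᵒ ⟫ ⟪ σ ⟫ , substCtx σ Γ ,
     ⊢let (mapCtx-split _ q)
       (subst (λ C → substCtx σ (substCtx ↑ᵉ Γ₁) ⊢ _ ∶ C) unifies (⊢⟪⟫ σ (⊢⟪⟫ ↑ᵉ p₁))) (⊢⟪⟫ σ (⊢⟪⟫ ↑ᵒ p₂)) , λ where
    _ _ (⊢let s' d' e') →
      let θ₁ , c₁ , f₁ = univ₁ _ _ d'
          θ₂ , c₂ , f₂ = univ₂ _ _ e'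
          x₂ , c₂′ = ∷≡ c₂
          y₂ , c₃ = ∷≡ c₂′
          l = copair-evens θ₁ θ₂ ; r = copair-odds θ₁ θ₂
          θ' , g = factor (copair θ₁ θ₂) (Eq.trans (Eq.trans (⟪⟫-∘ P₁ l) f₁)
                     (Eq.sym (cong₂ _⊗_ (Eq.trans (⟪⟫-∘ X r) x₂) (Eq.trans (⟪⟫-∘ Y r) y₂))))
      in θ' ,
         Eq.trans (substCtx-∘ Γ g)
           (substCtx-split⁻¹ q s' (Eq.trans (substCtx-∘ Γ₁ l) c₁) (Eq.trans (substCtx-∘ Γ₂ r) c₃)) ,
         Eq.trans (⟪⟫-∘ (P₂ ⟪ ↑ᵒ ⟫) g) (Eq.trans (⟪⟫-∘ P₂ r) f₂)
principal (⊢let s d e) | _ | P₂ , nothing ∷ _ , p₂ , univ₂ | _ | _ , () , _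
principal (⊢let s d e) | _ | P₂ , just _ ∷ nothing ∷ _ , p₂ , univ₂ | _ | _ , () , _

-- The argument type found by inverting the application may differ from `A`. It is a common instance
-- of the domain of the principal type of `t` and of the principal type of `s`, which is what
-- poly-typability demands.
polyTypable : ∀ {t s A B} → [] ⊢ t · s ∶ B → [] ⊢ s ∶ A → PolyTypable t s A B
polyTypable (⊢app [] d e) s∶A with principal d | principal e
... | Pt , pt@([] , _ , univt) | Ps , ps@([] , _ , univs)
  with θ₁ , _ , e₁ ← univt _ _ d | θ₂ , _ , e₂ ← univs _ _ e =
  (-, -, d) , s∶A , Pt , Ps , pt , ps , -, θ₁ , θ₂ , e₁ , e₂

-- Realizability by closed raw terms

βγ : ∀ {n} (γ : Fin n → Tm 0) b a → sub γ (ƛ b) · a ⟶* sub (a ∙ γ) b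
βγ γ b a = β ◅ ε ▹ sub-σ₁ γ a b

βletγ : ∀ {n} (γ : Fin n → Tm 0) w u v → letp ⟨ u , v ⟩ (sub (exts (exts γ)) w) ⟶* sub (u ∙ v ∙ γ) w
βletγ γ w u v = βlet ◅ ε ▹ sub-σ₂ γ u v w

module Realizability (P : ℕ → ℕ → Tm 0 → Set)
  (P-expand : ∀ {a m t t'} → t ⟶* t' → P a m t' → P a m t) where

  -- A pair divides its resource between the components, and a function adds the resource of its
  -- argument to its own. The reading of atoms is a parameter because erasure, separation and
  -- connectedness each need their own.
  ⟦_⟧ : Ty → ℕ → Tm 0 → Set
  ⟦ tvar a ⟧ m t = P a m t
  ⟦ A ⊗ B ⟧  m t = ∃₂ λ m₁ m₂ → ∃₂ λ u v → m₁ + m₂ ≡ m × t ⟶* ⟨ u , v ⟩ × ⟦ A ⟧ m₁ u × ⟦ B ⟧ m₂ v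
  ⟦ A ⊸ B ⟧  m t = ∀ {m' u} → ⟦ A ⟧ m' u → ⟦ B ⟧ (m + m') (t · u)

  expand : ∀ A {m t t'} → t ⟶* t' → ⟦ A ⟧ m t' → ⟦ A ⟧ m t
  expand (tvar a) r p = P-expand r p
  expand (A ⊗ B) r (_ , _ , _ , _ , e , r' , p , q) = -, -, -, -, e , r ◅◅ r' , p , q
  expand (A ⊸ B) r f p = expand B (appˡ* r) (f p)

  data Env : ∀ {n} → Ctx n → (Fin n → Tm 0) → ℕ → Set where
    []   : ∀ {γ} → Env [] γ 0
    none : ∀ {n} {Γ : Ctx n} {γ m} → Env Γ (γ ∘ suc) m → Env (nothing ∷ Γ) γ m
    just : ∀ {n} {Γ : Ctx n} {γ m m' A} → ⟦ A ⟧ m (γ zero) → Env Γ (γ ∘ suc) m' →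
           Env (just A ∷ Γ) γ (m + m')

  Env-∅ : ∀ {n} {γ : Fin n → Tm 0} {m} → Env ∅ γ m → m ≡ 0
  Env-∅ {zero} []        = refl
  Env-∅ {suc n} (none ρ) = Env-∅ ρ

  Env-only : ∀ {n} i {γ : Fin n → Tm 0} {m A} → Env (only i A) γ m → ⟦ A ⟧ m (γ i)
  Env-only zero (just {m = m} p ρ) with Env-∅ ρ
  ... | refl rewrite +-identityʳ m = p
  Env-only (suc i) (none ρ) = Env-only i ρ

  Env-split : ∀ {n} {Γ Γ₁ Γ₂ : Ctx n} {γ m} → Split Γ Γ₁ Γ₂ → Env Γ γ m →
    ∃₂ λ m₁ m₂ → m₁ + m₂ ≡ m × Env Γ₁ γ m₁ × Env Γ₂ γ m₂
  Env-split [] [] = -, -, refl , [] , []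
  Env-split (none s) (none ρ) with _ , _ , e , ρ₁ , ρ₂ ← Env-split s ρ = -, -, e , none ρ₁ , none ρ₂
  Env-split (left s) (just {m = m} p ρ) with m₁ , m₂ , refl , ρ₁ , ρ₂ ← Env-split s ρ =
    -, -, +-assoc m m₁ m₂ , just p ρ₁ , none ρ₂
  Env-split (right s) (just {m = m} p ρ) with m₁ , m₂ , refl , ρ₁ , ρ₂ ← Env-split s ρ =
    -, -, Eq.trans (Eq.sym (+-assoc m₁ m m₂)) (Eq.trans (cong (_+ m₂) (+-comm m₁ m)) (+-assoc m m₁ m₂)) ,
    none ρ₁ , just p ρ₂

  fundamental : ∀ {n} {Γ : Ctx n} {t A γ m} → Γ ⊢ t ∶ A → Env Γ γ m → ⟦ A ⟧ m (sub γ t)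
  fundamental (⊢var i) ρ = Env-only i ρ
  fundamental {γ = γ} {m} (⊢lam {t = t} {B = B} d) ρ {m'} {u} p =
    expand B (βγ γ t u)
      (subst (λ k → ⟦ B ⟧ k (sub (u ∙ γ) t)) (+-comm m' m) (fundamental d (just p ρ)))
  fundamental (⊢app s d e) ρ with _ , _ , refl , ρ₁ , ρ₂ ← Env-split s ρ =
    fundamental d ρ₁ (fundamental e ρ₂)
  fundamental (⊢pair s d e) ρ with _ , _ , q , ρ₁ , ρ₂ ← Env-split s ρ =
    -, -, -, -, q , ε , fundamental d ρ₁ , fundamental e ρ₂
  fundamental {γ = γ} (⊢let {t = t} {C = C} s d e) ρ
    with _ , m₂ , refl , ρ₁ , ρ₂ ← Env-split s ρ
    with m , m' , u , v , refl , r , p , q ← fundamental d ρ₁ =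
    expand C (letˡ* r ◅◅ βletγ γ t u v)
      (subst (λ k → ⟦ C ⟧ k (sub (u ∙ v ∙ γ) t)) (Eq.sym (+-assoc m m' m₂)) (fundamental e (just p (just q ρ₂))))

  fundamental₀ : ∀ {t A} → [] ⊢ t ∶ A → ⟦ A ⟧ 0 t
  fundamental₀ {t} {A} d = subst (⟦ A ⟧ 0) (sub-id (λ ()) t) (fundamental {γ = `_} d [])

lams : ∀ k → Tm k → Tm 0
lams zero b    = b
lams (suc k) b = lams k (ƛ b)

apps : ∀ k → Tm 0 → (Fin k → Tm 0) → Tm 0
apps zero t γ    = t
apps (suc k) t γ = apps k t (γ ∘ suc) · γ zero

β* : ∀ k b (γ : Fin k → Tm 0) → apps k (lams k b) γ ⟶* sub γ b
β* zero b γ    = ε ▹ Eq.sym (sub-id (λ ()) b)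
β* (suc k) b γ = appˡ* (β* k (ƛ b) (γ ∘ suc)) ◅◅ βγ (γ ∘ suc) b (γ zero)
  ▹ sub-cong (λ { zero → refl ; (suc i) → refl }) b

γ₀ : Fin 0 → Tm 0
γ₀ ()

pattern v0 = ` zero
pattern v1 = ` suc zero
pattern v2 = ` suc (suc zero)
pattern v3 = ` suc (suc (suc zero))
pattern v4 = ` suc (suc (suc (suc zero)))
pattern v5 = ` suc (suc (suc (suc (suc zero))))
pattern v6 = ` suc (suc (suc (suc (suc (suc zero)))))
pattern v7 = ` suc (suc (suc (suc (suc (suc (suc zero))))))

I : ∀ {n} → Tm n
I = ƛ v0

I-step : ∀ {t} → I · t ⟶* t
I-step = β ◅ ε

lin-· : ∀ {t s} → Lin t → Lin s → Lin (t · s)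
lin-· = L.app (refl , refl , refl) []

-- Polarity (true is positive) and name of an atom occurrence.
Lit : Set
Lit = Bool × ℕ

occ : Bool → Ty → List Lit
occ b (tvar x) = (b , x) ∷ []
occ b (A ⊗ B)  = occ b A ++ occ b B
occ b (A ⊸ B)  = occ (not b) A ++ occ b B

-- consumer A turns a realizer of A into a value of a fixed datatype, handing
-- each value found at a positive atom x to con x; supplier A turns such a value
-- into a realizer of A, where sup x produces the values at negative atoms.
-- Values v and w are combined to ƛ k → v (w k), with unit I.
module Builder (sup con : ℕ → Tm 0) where

  con⊗ con⊸ sup⊗ sup⊸ : Tm 0
  con⊗ = ƛ ƛ ƛ letp v0 (ƛ ((v5 · v1) · ((v4 · v2) · v0)))
  con⊸ = ƛ ƛ ƛ (v2 · (v0 · (v1 · I)))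
  sup⊗ = ƛ ƛ ƛ ⟨ v2 · v0 , v1 · I ⟩
  sup⊸ = ƛ ƛ ƛ ƛ (v2 · (ƛ (v2 · ((v4 · v1) · v0))))

  consumer supplier : Ty → Tm 0
  consumer (tvar x) = con x
  consumer (A ⊗ B)  = con⊗ · consumer A · consumer B
  consumer (A ⊸ B)  = con⊸ · consumer B · supplier A
  supplier (tvar x) = sup x
  supplier (A ⊗ B)  = sup⊗ · supplier A · supplier B
  supplier (A ⊸ B)  = sup⊸ · consumer A · supplier B

  module _ (lin-sup : ∀ x → Lin (sup x)) (lin-con : ∀ x → Lin (con x)) where
    lin-consumer : ∀ A → Lin (consumer A)
    lin-supplier : ∀ A → Lin (supplier A)
    lin-consumer (tvar x) = lin-con x
    lin-consumer (A ⊗ B)  = lin-· (lin-· (lin! con⊗) (lin-consumer A)) (lin-consumer B)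
    lin-consumer (A ⊸ B)  = lin-· (lin-· (lin! con⊸) (lin-consumer B)) (lin-supplier A)
    lin-supplier (tvar x) = lin-sup x
    lin-supplier (A ⊗ B)  = lin-· (lin-· (lin! sup⊗) (lin-supplier A)) (lin-supplier B)
    lin-supplier (A ⊸ B)  = lin-· (lin-· (lin! sup⊸) (lin-consumer A)) (lin-supplier B)

  module Sound (ρ : ℕ → ℕ) (P : ℕ → ℕ → Tm 0 → Set)
    (P-expand : ∀ {a m t t'} → t ⟶* t' → P a m t' → P a m t)
    (D : ℕ → Tm 0 → Set)
    (D-expand : ∀ {m t t'} → t ⟶* t' → D m t' → D m t)
    (D-I : D 0 I)
    (D-∘ : ∀ {m m' v v' w} → (∀ {k} → w · k ⟶* v · (v' · k)) → D m v → D m' v' → D (m + m') w)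
    (tokens : List Lit → ℕ)
    (tokens-++ : ∀ xs ys → tokens (xs ++ ys) ≡ tokens xs + tokens ys) where
    open Realizability P P-expand

    Good : Lit → Set
    Good (true , x)  = ∀ {m t} → P (ρ x) m t → D (m + tokens ((true , x) ∷ [])) (con x · t)
    Good (false , x) = ∀ {m w} → D m w → P (ρ x) (m + tokens ((false , x) ∷ [])) (sup x · w)

    shuffle : ∀ a b c d → (a + (b + c)) + d ≡ (a + (c + d)) + b
    shuffle a b c d = begin
      (a + (b + c)) + d ≡⟨ +-assoc a (b + c) d ⟩
      a + ((b + c) + d) ≡⟨ cong (a +_) (+-assoc b c d) ⟩
      a + (b + (c + d)) ≡⟨ cong (a +_) (+-comm b (c + d)) ⟩
      a + ((c + d) + b) ≡⟨ Eq.sym (+-assoc a (c + d) b) ⟩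
      (a + (c + d)) + b ∎
      where open Eq.≡-Reasoning

    D-cast : ∀ {m m' t} → m ≡ m' → D m t → D m' t
    D-cast refl d = d

    -- The two statements call each other at implications, where the polarity flips. Tokens enter
    -- only through suppliers at negative atoms, so the resource of the outcome is that of the
    -- realizer plus the tokens counted in the type.
    consumer-sound : ∀ A → All Good (occ true A) → ∀ {m t} → ⟦ A ⟪ tvar ∘ ρ ⟫ ⟧ m t →
      D (m + tokens (occ true A)) (consumer A · t)
    supplier-sound : ∀ A → All Good (occ false A) → ∀ {m w} → D m w →
      ⟦ A ⟪ tvar ∘ ρ ⟫ ⟧ (m + tokens (occ false A)) (supplier A · w)
    consumer-sound (tvar x) (g ∷ []) p = g p
    consumer-sound (A ⊗ B) g {t = t} (m₁ , m₂ , u , v , refl , r , p , q) =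
      D-expand (β* 3 _ γ ◅◅ letˡ* r ◅◅ βletγ γ w u v)
        (D-cast eq (D-∘ (λ {k} → βγ (u ∙ v ∙ γ) ((v5 · v1) · ((v4 · v2) · v0)) k)
          (consumer-sound A (++⁻ˡ (occ true A) g) p) (consumer-sound B (++⁻ʳ (occ true A) g) q)))
      where
      γ = t ∙ consumer B ∙ consumer A ∙ γ₀
      w = ƛ ((v5 · v1) · ((v4 · v2) · v0))
      eq : (m₁ + tokens (occ true A)) + (m₂ + tokens (occ true B)) ≡ (m₁ + m₂) + tokens (occ true (A ⊗ B))
      eq rewrite tokens-++ (occ true A) (occ true B) = +-interchange m₁ _ m₂ _
    consumer-sound (A ⊸ B) g {m} {t} f =
      D-expand (β* 3 _ (t ∙ supplier A ∙ consumer B ∙ γ₀))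
        (D-cast eq (consumer-sound B (++⁻ʳ (occ false A) g) (f (supplier-sound A (++⁻ˡ (occ false A) g) D-I))))
      where
      eq : (m + tokens (occ false A)) + tokens (occ true B) ≡ m + tokens (occ true (A ⊸ B))
      eq rewrite tokens-++ (occ false A) (occ true B) = +-assoc m _ _
    supplier-sound (tvar x) (g ∷ []) d = g d
    supplier-sound (A ⊗ B) g {m} {w} d =
      -, -, -, -, eq , β* 3 _ (w ∙ supplier B ∙ supplier A ∙ γ₀) ,
      -- The incoming value cannot be shared: it goes to the left component as a whole, and the
      -- right one starts with the unit.
      supplier-sound A (++⁻ˡ (occ false A) g) d , supplier-sound B (++⁻ʳ (occ false A) g) D-I
      where
      eq : (m + tokens (occ false A)) + tokens (occ false B) ≡ m + tokens (occ false (A ⊗ B))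
      eq rewrite tokens-++ (occ false A) (occ false B) = +-assoc m _ _
    supplier-sound (A ⊸ B) g {m} {w} d {m'} {u} p =
      expand (B ⟪ tvar ∘ ρ ⟫) (β* 4 (v2 · b) γ)
        (subst (λ k → ⟦ B ⟪ tvar ∘ ρ ⟫ ⟧ k (supplier B · sub γ b)) eq
          (supplier-sound B (++⁻ʳ (occ true A) g)
            (D-∘ (λ {k} → βγ γ (v2 · ((v4 · v1) · v0)) k) d (consumer-sound A (++⁻ˡ (occ true A) g) p))))
      where
      γ = u ∙ w ∙ supplier B ∙ consumer A ∙ γ₀
      b = ƛ (v2 · ((v4 · v1) · v0))
      eq : (m + (m' + tokens (occ true A))) + tokens (occ false B) ≡ (m + tokens (occ false (A ⊸ B))) + m'
      eq rewrite tokens-++ (occ true A) (occ false B) = shuffle m m' (tokens (occ true A)) (tokens (occ false B))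

-- Counting literals

_≟ˡ_ : (l l' : Lit) → Dec (l ≡ l')
_≟ˡ_ = ≡-dec Bool._≟_ _≟_

δ : Lit → Lit → ℕ
δ l l' with l ≟ˡ l'
... | yes _ = 1
... | no _  = 0

# : Lit → List Lit → ℕ
# l []       = 0
# l (x ∷ xs) = δ l x + # l xs

#-++ : ∀ l xs ys → # l (xs ++ ys) ≡ # l xs + # l ys
#-++ l [] ys       = refl
#-++ l (x ∷ xs) ys = Eq.trans (cong (δ l x +_) (#-++ l xs ys)) (Eq.sym (+-assoc (δ l x) _ _))

δ-refl : ∀ l → δ l l ≡ 1
δ-refl l with l ≟ˡ l
... | yes _ = refl
... | no ne = contradiction refl ne

δ-≢ : ∀ {l l'} → l ≢ l' → δ l l' ≡ 0
δ-≢ {l} {l'} ne with l ≟ˡ l'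
... | yes e = contradiction e ne
... | no _  = refl

-- The environment that separates two linkings

_erases_ : Tm 0 → Tm 0 → Set
E erases x = ∀ {y} → (E · x) · y ⟶* y

-- The four values of the datatype: a value rearranges four arguments, bringing
-- the one it selects to the front.
pattern neutral = zero
pattern fresh   = suc zero
pattern first   = suc (suc zero)
pattern second  = suc (suc (suc zero))

arrange : ∀ {n} → Fin 4 → Tm n → Tm n → Tm n → Tm n → Tm n → Tm n
arrange neutral k a b c d = k · a · b · c · d
arrange fresh   k a b c d = k · b · a · c · d
arrange first   k a b c d = k · c · b · a · d
arrange second  k a b c d = k · d · b · c · a

select : ∀ {X : Set} → Fin 4 → X → X → X → X → X
select neutral a b c d = a
select fresh   a b c d = b
select first   a b c d = c
select second  a b c d = d

_represents_ : Tm 0 → Fin 4 → Set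
v represents i = ∀ {k a b c d} → v · k · a · b · c · d ⟶* arrange i k a b c d

represents-expand : ∀ {v v' i} → v ⟶* v' → v' represents i → v represents i
represents-expand r p = appˡ* (appˡ* (appˡ* (appˡ* (appˡ* r)))) ◅◅ p

value : Fin 4 → Tm 0
value i = lams 5 (arrange i v4 v3 v2 v1 v0)

value-represents : ∀ i → value i represents i
value-represents i {k} {a} {b} {c} {d} = β* 5 _ (d ∙ c ∙ b ∙ a ∙ k ∙ γ₀) ▹ eq i
  where
  eq : ∀ i → sub (d ∙ c ∙ b ∙ a ∙ k ∙ γ₀) (arrange i v4 v3 v2 v1 v0) ≡ arrange i k a b c d
  eq neutral = refl
  eq fresh   = refl
  eq first   = refl
  eq second  = refl

I-represents : I represents neutral
I-represents = appˡ* (appˡ* (appˡ* (appˡ* I-step)))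

∘-represents : ∀ {v v' w i} → (∀ {k} → w · k ⟶* v · (v' · k)) →
  v represents i → v' represents neutral → w represents i
∘-represents {v' = v'} {i = i} r p q = appˡ* (appˡ* (appˡ* (appˡ* r))) ◅◅ p ◅◅ go i
  where
  go : ∀ i {k a b c d} → arrange i (v' · k) a b c d ⟶* arrange i k a b c d
  go neutral = q
  go fresh   = q
  go first   = q
  go second  = q

∘-representsʳ : ∀ {v v' w i} → (∀ {k} → w · k ⟶* v · (v' · k)) →
  v represents neutral → v' represents i → w represents i
∘-representsʳ r p q = appˡ* (appˡ* (appˡ* (appˡ* r))) ◅◅ p ◅◅ q

-- When all four arguments are `I`, their order is irrelevant. So every value can be erased without
-- knowing which one it is, and what remains is a chain of identities.
compose4 discard : Tm 0
compose4 = ƛ ƛ ƛ ƛ ƛ (v4 · (v3 · (v2 · (v1 · v0))))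
discard = ƛ (v0 · (ƛ ƛ ƛ ƛ ƛ (v4 · (v3 · (v2 · (v1 · v0))))) · I · I · I · I)

discard-erases : ∀ {v i} → v represents i → discard erases v
discard-erases {v} {i} p {y} =
  appˡ* (β* 1 _ (v ∙ γ₀) ◅◅ p ▹ eq i) ◅◅ β* 5 _ (y ∙ I ∙ I ∙ I ∙ I ∙ γ₀)
    ◅◅ I-step ◅◅ I-step ◅◅ I-step ◅◅ I-step
  where
  eq : ∀ i → arrange i compose4 I I I I ≡ compose4 · I · I · I · I
  eq neutral = refl
  eq fresh   = refl
  eq first   = refl
  eq second  = refl

-- The erasers are wrapped around the surviving argument. Three copies of the eraser are passed in
-- because a linear term cannot duplicate one.
keep-first : ∀ {n} → Tm n
keep-first = ƛ ƛ ƛ ƛ ƛ ƛ ƛ ((v6 · v2) · ((v5 · v1) · ((v4 · v0) · v3)))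

keep-first-step : ∀ {E x₀ x₁ x₂ x₃} → E erases x₁ → E erases x₂ → E erases x₃ →
  keep-first · E · E · E · x₀ · x₁ · x₂ · x₃ ⟶* x₀
keep-first-step {E} {x₀} {x₁} {x₂} {x₃} e₁ e₂ e₃ =
  β* 7 _ (x₃ ∙ x₂ ∙ x₁ ∙ x₀ ∙ E ∙ E ∙ E ∙ γ₀) ◅◅ e₁ ◅◅ e₂ ◅◅ e₃

look-up : Tm 0
look-up = ƛ ƛ ƛ ƛ ƛ ƛ ƛ ƛ (v0 · (keep-first · v7 · v6 · v5) · v4 · v3 · v2 · v1)

case : Tm 0 → Tm 0 → Tm 0 → Tm 0 → Tm 0 → Tm 0
case E a b c d = look-up · E · E · E · a · b · c · d

case-step : ∀ {E a b c d v i} → E erases a → E erases b → E erases c → E erases d →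
  v represents i → case E a b c d · v ⟶* select i a b c d
case-step {E} {a} {b} {c} {d} {v} {i} ea eb ec ed p =
  β* 8 _ (v ∙ d ∙ c ∙ b ∙ a ∙ E ∙ E ∙ E ∙ γ₀) ◅◅ p ◅◅ go i
  where
  go : ∀ i → arrange i (keep-first · E · E · E) a b c d ⟶* select i a b c d
  go neutral = keep-first-step eb ec ed
  go fresh   = keep-first-step ea ec ed
  go first   = keep-first-step eb ea ed
  go second  = keep-first-step eb ec ea

-- A function on the four values given by its table. The branches are themselves values, so
-- `discard` can erase those not selected.
map4 : (i j k l : Fin 4) → Tm 0
map4 i j k l = case discard (value i) (value j) (value k) (value l)

map4-represents : ∀ i j k l {m v} → v represents m → (map4 i j k l · v) represents select m i j k l
map4-represents i j k l {m} p = represents-expand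
  (case-step (er i) (er j) (er k) (er l) p) (go m)
  where
  er : ∀ i → discard erases value i
  er i = discard-erases {i = i} (value-represents i)
  go : ∀ m → select m (value i) (value j) (value k) (value l) represents select m i j k l
  go neutral = value-represents i
  go fresh   = value-represents j
  go first   = value-represents k
  go second  = value-represents l

compose compose-fresh : Tm 0
compose = ƛ ƛ ƛ (v2 · (v1 · v0))
compose-fresh = ƛ ƛ ƛ (v1 · (v2 · v0))

emit : Tm 0
emit = compose-fresh · value fresh

emit-represents : ∀ {w} → w represents neutral → (emit · w) represents fresh
emit-represents {w} p =
  ∘-representsʳ {i = fresh} (λ {k} → β* 3 _ (k ∙ w ∙ value fresh ∙ γ₀)) p (value-represents fresh)

lin-case : ∀ {E a b c d} → Lin E → Lin a → Lin b → Lin c → Lin d → Lin (case E a b c d)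
lin-case e a b c d =
  lin-· (lin-· (lin-· (lin-· (lin-· (lin-· (lin-· (lin! look-up) e) e) e) a) b) c) d

lin-value : ∀ i → Lin (value i)
lin-value neutral = lin! (value neutral)
lin-value fresh   = lin! (value fresh)
lin-value first   = lin! (value first)
lin-value second  = lin! (value second)

lin-map4 : ∀ i j k l → Lin (map4 i j k l)
lin-map4 i j k l = lin-case (lin! discard) (lin-value i) (lin-value j) (lin-value k) (lin-value l)

module Erase where
  open Builder (const I) (const I) public using ()
    renaming (consumer to eraser; lin-consumer to lin-consumer′)

  Identity : Tm 0 → Set
  Identity v = ∀ {y} → v · y ⟶* y

  -- Atoms are read as the terms that act as the identity, and `I` serves as supplier and as
  -- consumer. The consumed term then acts as a composition of identities.
  eraser-erases : ∀ {A t} → [] ⊢ t ∶ A → eraser A erases t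
  eraser-erases {A} d = consumer-sound A (good (occ true A))
    (subst (λ B → Realizability.⟦_⟧ (λ _ _ → Identity) (λ r p → appˡ* r ◅◅ p) B 0 _) (Eq.sym (⟪⟫-id A λ _ → refl))
      (Realizability.fundamental₀ (λ _ _ → Identity) (λ r p → appˡ* r ◅◅ p) d))
    where
    open Builder.Sound (const I) (const I) id (λ _ _ → Identity) (λ r p → appˡ* r ◅◅ p)
      (const Identity) (λ r p → appˡ* r ◅◅ p) I-step (λ r p q → r ◅◅ p ◅◅ q) (const 0) (λ _ _ → refl)
    good : ∀ xs → All Good xs
    good []                 = []
    good ((true , _) ∷ xs)  = (λ p → appˡ* I-step ◅◅ p) ∷ good xs
    good ((false , _) ∷ xs) = (λ p → appˡ* I-step ◅◅ p) ∷ good xs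

  lin-eraser : ∀ A → Lin (eraser A)
  lin-eraser = lin-consumer′ (const (lin! I)) (const (lin! I))

open Erase using (eraser; eraser-erases; lin-eraser)

-- Resource m counts the tokens that have flowed into a value; only the atom n
-- emits one, and R is what a value becomes once it contains the token.
Carries : Fin 4 → ℕ → Tm 0 → Set
Carries R zero          v = v represents neutral
Carries R (suc zero)    v = v represents R
Carries R (suc (suc _)) v = ⊤

Carries-expand : ∀ {R} m {t t'} → t ⟶* t' → Carries R m t' → Carries R m t
Carries-expand zero          r p = represents-expand {i = neutral} r p
Carries-expand {R} (suc zero) r p = represents-expand {i = R} r p
Carries-expand (suc (suc _)) r p = tt

Carries-∘ : ∀ {R} m m' {v v' w} → (∀ {k} → w · k ⟶* v · (v' · k)) →
  Carries R m v → Carries R m' v' → Carries R (m + m') w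
Carries-∘ zero zero r p q                 = ∘-represents {i = neutral} r p q
Carries-∘ {R} zero (suc zero) r p q       = ∘-representsʳ {i = R} r p q
Carries-∘ zero (suc (suc _)) r p q        = tt
Carries-∘ {R} (suc zero) zero r p q       = ∘-represents {i = R} r p q
Carries-∘ (suc zero) (suc _) r p q        = tt
Carries-∘ (suc (suc _)) m' r p q          = tt

-- The reading of the type variable shared by `n` and its positive partner. In a linear type only
-- `n` supplies it, so a value without a token is impossible, and a single token is still unmarked.
-- Nothing is claimed about several tokens, since a run has just one.
Special : ℕ → Tm 0 → Set
Special zero          v = ⊥
Special (suc zero)    v = v represents fresh
Special (suc (suc _)) v = ⊤

Special-expand : ∀ m {t t'} → t ⟶* t' → Special m t' → Special m t
Special-expand (suc zero) r p    = represents-expand {i = fresh} r p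
Special-expand (suc (suc _)) r p = tt

map4-Carries : ∀ i j k l {R} → select neutral i j k l ≡ neutral → select R i j k l ≡ R →
  ∀ m {v} → Carries R m v → Carries R m (map4 i j k l · v)
map4-Carries i j k l e e' zero {v} p =
  subst (λ z → (map4 i j k l · v) represents z) e (map4-represents i j k l {m = neutral} p)
map4-Carries i j k l {R} e e' (suc zero) {v} p =
  subst (λ z → (map4 i j k l · v) represents z) e' (map4-represents i j k l {m = R} p)
map4-Carries i j k l e e' (suc (suc _)) p = tt

map4-Special : ∀ i j k l {R} → select fresh i j k l ≡ R →
  ∀ m {v} → Special m v → Carries R m (map4 i j k l · v)
map4-Special i j k l e (suc zero) {v} p =
  subst (λ z → (map4 i j k l · v) represents z) e (map4-represents i j k l {m = fresh} p)
map4-Special i j k l e (suc (suc _)) p = tt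

module Separation (n p : ℕ) where

  sup con : ℕ → Tm 0
  sup x with x ≟ n
  ... | yes _ = emit
  ... | no _  = I
  -- Both tables fix `neutral`, `first` and `second`; they differ at `fresh`. So the first positive
  -- atom decides the mark, and later ones leave it alone.
  con x with x ≟ p
  ... | yes _ = map4 neutral first first second
  ... | no _  = map4 neutral second first second

  open Builder sup con

  lin-sup : ∀ x → Lin (sup x)
  lin-sup x with x ≟ n
  ... | yes _ = lin-· (lin! compose-fresh) (lin-value fresh)
  ... | no _  = lin! I

  lin-con : ∀ x → Lin (con x)
  lin-con x with x ≟ p
  ... | yes _ = lin-map4 neutral first first second
  ... | no _  = lin-map4 neutral second first second

  Link : Fin 4 → ℕ → ℕ → ℕ → Tm 0 → Set
  Link R α a m t with a ≟ α
  ... | yes _ = Special m t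
  ... | no _  = Carries R m t

  Link-expand : ∀ {R α a m t t'} → t ⟶* t' → Link R α a m t' → Link R α a m t
  Link-expand {α = α} {a} {m} r q with a ≟ α
  ... | yes _ = Special-expand m r q
  ... | no _  = Carries-expand m r q

  module Run (R : Fin 4) (ρ : ℕ → ℕ) where
    open Sound ρ (Link R (ρ n)) (λ {a} {m} → Link-expand {a = a} {m}) (Carries R)
      (λ {m} → Carries-expand m) I-represents (λ {m} {m'} → Carries-∘ m m') (# (false , n)) (#-++ (false , n)) public

    good-sup : ∀ x → (ρ x ≡ ρ n → x ≡ n) → Good (false , x)
    good-sup x inj {m} {w} q with ρ x ≟ ρ n | x ≟ n
    ... | yes _ | yes refl rewrite δ-refl (false , n) | +-comm m 1 with m
    ...   | zero  = emit-represents q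
    ...   | suc _ = tt
    good-sup x inj {m} {w} q | yes e | no ne = contradiction (inj e) ne
    good-sup x inj {m} {w} q | no ne | yes refl = contradiction refl ne
    good-sup x inj {m} {w} q | no _ | no ne
      rewrite δ-≢ {false , n} {false , x} (λ { refl → ne refl }) | +-identityʳ m =
      Carries-expand m I-step q

    good-con : ∀ x → (∀ {m t} → Link R (ρ n) (ρ x) m t → Carries R m (con x · t)) → Good (true , x)
    good-con x f {m} q rewrite δ-≢ {false , n} {true , x} (λ ()) | +-identityʳ m = f q

  module Run₁ (ρ : ℕ → ℕ) (linked : ρ p ≡ ρ n) where
    open Run first ρ
    open Realizability (Link first (ρ n)) (λ {a} {m} → Link-expand {a = a} {m})

    -- By injectivity on positive atoms, `p` is the only one with the name of `n`, so the fresh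
    -- token meets the table of `p`. As `n` occurs once, the total resource is 1, where `Carries`
    -- means the mark `first`.
    result : ∀ {t} A → # (false , n) (occ true A) ≡ 1 →
      (∀ {b x y} → (b , x) ∈ occ true A → (b , y) ∈ occ true A → ρ x ≡ ρ y → x ≡ y) →
      (false , n) ∈ occ true A → (true , p) ∈ occ true A →
      [] ⊢ t ∶ A ⟪ tvar ∘ ρ ⟫ → (consumer A · t) represents first
    result {t} A one inj n∈ p∈ d =
      subst (λ k → Carries first k (consumer A · t)) one
        (consumer-sound A (All.tabulate good) (fundamental₀ d))
      where
      good : ∀ {l} → l ∈ occ true A → Good l
      good {false , x} x∈ = good-sup x (λ e → inj x∈ n∈ e)
      good {true , x} x∈ = good-con x go
        where
        go : ∀ {m t} → Link first (ρ n) (ρ x) m t → Carries first m (con x · t)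
        go {m} q with ρ x ≟ ρ n | x ≟ p
        ... | yes _ | yes _ = map4-Special neutral first first second refl m q
        ... | yes e | no ne = contradiction (inj x∈ p∈ (Eq.trans e (Eq.sym linked))) ne
        ... | no ne | yes refl = contradiction linked ne
        ... | no _  | no _ = map4-Carries neutral second first second refl refl m q

  module Run₂ (ρ : ℕ → ℕ) (unlinked : ρ p ≢ ρ n) where
    open Run second ρ
    open Realizability (Link second (ρ n)) (λ {a} {m} → Link-expand {a = a} {m})

    -- The positive atom that receives the fresh token cannot be `p`, so the mark is `second`. The
    -- table of `p` meets only neutral or already marked values.
    result : ∀ {t} A → # (false , n) (occ true A) ≡ 1 →
      (∀ {b x y} → (b , x) ∈ occ true A → (b , y) ∈ occ true A → ρ x ≡ ρ y → x ≡ y) →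
      (false , n) ∈ occ true A →
      [] ⊢ t ∶ A ⟪ tvar ∘ ρ ⟫ → (consumer A · t) represents second
    result {t} A one inj n∈ d =
      subst (λ k → Carries second k (consumer A · t)) one
        (consumer-sound A (All.tabulate good) (fundamental₀ d))
      where
      good : ∀ {l} → l ∈ occ true A → Good l
      good {false , x} x∈ = good-sup x (λ e → inj x∈ n∈ e)
      good {true , x} x∈ = good-con x go
        where
        go : ∀ {m t} → Link second (ρ n) (ρ x) m t → Carries second m (con x · t)
        go {m} q with ρ x ≟ ρ n | x ≟ p
        ... | yes e | yes refl = contradiction e unlinked
        ... | yes _ | no _ = map4-Special neutral second first second refl m q
        ... | no _  | yes _ = map4-Carries neutral first first second refl refl m q
        ... | no _  | no _ = map4-Carries neutral second first second refl refl m q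

-- The value of a whole term will be `first` or `second`. The other two branches still have to be
-- filled with something that `eraser B` erases, and `u₁` is at hand.
separator : Ty → Ty → ℕ → ℕ → Tm 0 → Tm 0 → Tm 0
separator A B n p u₁ u₂ = compose · case (eraser B) u₁ u₁ u₁ u₂ · Builder.consumer (Separation.sup n p) (Separation.con n p) A

separator-step : ∀ {A B n p u₁ u₂ i s} → [] ⊢ u₁ ∶ B → [] ⊢ u₂ ∶ B →
  (Builder.consumer (Separation.sup n p) (Separation.con n p) A · s) represents i →
  separator A B n p u₁ u₂ · s ⟶* select i u₁ u₁ u₁ u₂
separator-step {B = B} {i = i} {s} d₁ d₂ q = β* 3 _ (s ∙ _ ∙ _ ∙ γ₀) ◅◅ case-step {i = i} e₁ e₁ e₁ e₂ q
  where e₁ = eraser-erases d₁ ; e₂ = eraser-erases d₂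

lin-separator : ∀ {A B n p u₁ u₂} → Lin u₁ → Lin u₂ → Lin (separator A B n p u₁ u₂)
lin-separator {A} {B} {n} {p} l₁ l₂ = lin-·
  (lin-· (lin! compose) (lin-case (lin-eraser B) l₁ l₁ l₁ l₂))
  (Builder.lin-consumer _ _ (Separation.lin-sup n p) (Separation.lin-con n p) A)

-- Literals under renaming

renL : (ℕ → ℕ) → List Lit → List Lit
renL σ = map (map₂ σ)

occ-ren : ∀ b A σ → occ b (A ⟪ tvar ∘ σ ⟫) ≡ renL σ (occ b A)
occ-ren b (tvar x) σ = refl
occ-ren b (A ⊗ B) σ =
  Eq.trans (cong₂ _++_ (occ-ren b A σ) (occ-ren b B σ)) (Eq.sym (map-++ _ (occ b A) _))
occ-ren b (A ⊸ B) σ =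
  Eq.trans (cong₂ _++_ (occ-ren (not b) A σ) (occ-ren b B σ)) (Eq.sym (map-++ _ (occ (not b) A) _))

occC : ∀ {n} → Ctx n → List Lit
occC []            = []
occC (nothing ∷ Γ) = occC Γ
occC (just A ∷ Γ)  = occ false A ++ occC Γ

occC-ren : ∀ {n} (Γ : Ctx n) σ → occC (substCtx (tvar ∘ σ) Γ) ≡ renL σ (occC Γ)
occC-ren [] σ            = refl
occC-ren (nothing ∷ Γ) σ = occC-ren Γ σ
occC-ren (just A ∷ Γ) σ  =
  Eq.trans (cong₂ _++_ (occ-ren false A σ) (occC-ren Γ σ)) (Eq.sym (map-++ _ (occ false A) _))

-- Linear types

infix 4 _≈_
record _≈_ (xs ys : List Lit) : Set where
  constructor ≈-intro
  field counts : ∀ l → # l xs ≡ # l ys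
open _≈_

≈-++ : ∀ {xs xs' ys ys'} → xs ≈ xs' → ys ≈ ys' → xs ++ ys ≈ xs' ++ ys'
≈-++ {xs} {xs'} {ys} {ys'} p q .counts l =
  Eq.trans (#-++ l xs ys) (Eq.trans (cong₂ _+_ (counts p l) (counts q l)) (Eq.sym (#-++ l xs' ys')))

≈-refl : ∀ {xs} → xs ≈ xs
≈-refl .counts l = refl

≈-reflexive : ∀ {xs ys} → xs ≡ ys → xs ≈ ys
≈-reflexive refl = ≈-refl

≈-sym : ∀ {xs ys} → xs ≈ ys → ys ≈ xs
≈-sym p .counts l = Eq.sym (counts p l)

≈-trans : ∀ {xs ys zs} → xs ≈ ys → ys ≈ zs → xs ≈ zs
≈-trans p q .counts l = Eq.trans (counts p l) (counts q l)

#-++₃ : ∀ l xs ys zs → # l (xs ++ ys ++ zs) ≡ # l xs + (# l ys + # l zs)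
#-++₃ l xs ys zs = Eq.trans (#-++ l xs _) (cong (# l xs +_) (#-++ l ys zs))

occC-∅ : ∀ n → occC (∅ {n}) ≡ []
occC-∅ zero    = refl
occC-∅ (suc n) = occC-∅ n

occC-only : ∀ {n} (i : Fin n) A → occC (only i A) ≈ occ false A
occC-only {suc n} zero A .counts l rewrite occC-∅ n = Eq.trans (#-++ l (occ false A) []) (+-identityʳ _)
occC-only (suc i) A = occC-only i A

occC-split : ∀ {n} {Γ Γ₁ Γ₂ : Ctx n} → Split Γ Γ₁ Γ₂ → occC Γ ≈ occC Γ₁ ++ occC Γ₂
occC-split [] = ≈-refl
occC-split (none s) = occC-split s
occC-split {Γ₁ = just A ∷ Γ₁} {_ ∷ Γ₂} (left s) .counts l
  rewrite #-++ l (occ false A ++ occC Γ₁) (occC Γ₂) | #-++ l (occ false A) (occC Γ₁)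
  = Eq.trans (#-++ l (occ false A) _)
      (Eq.trans (cong (# l (occ false A) +_) (Eq.trans (counts (occC-split s) l) (#-++ l (occC Γ₁) _)))
        (Eq.sym (+-assoc (# l (occ false A)) _ _)))
occC-split {Γ = _ ∷ Γ} {_ ∷ Γ₁} {just A ∷ Γ₂} (right s) .counts l =
  Eq.trans (#-++ l (occ false A) (occC Γ))
    (Eq.trans (cong (# l (occ false A) +_) (Eq.trans (counts (occC-split s) l) (#-++ l (occC Γ₁) _)))
    (Eq.trans (solve 3 (λ a b c → a :+ (b :+ c) := b :+ (a :+ c)) refl (# l (occ false A)) (# l (occC Γ₁)) (# l (occC Γ₂)))
      (Eq.sym (#-++₃ l (occC Γ₁) (occ false A) _))))
  where open +-*-Solver

Lin1 : List Lit → Set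
Lin1 xs = ∀ l → # l xs ≤ 1

Lin1-≈ : ∀ {xs ys} → xs ≈ ys → Lin1 xs → Lin1 ys
Lin1-≈ p f l = subst (_≤ 1) (counts p l) (f l)

Lin1-++ʳ : ∀ xs ys → Lin1 (xs ++ ys) → Lin1 ys
Lin1-++ʳ xs ys f l = ≤-trans (m≤n+m _ (# l xs)) (subst (_≤ 1) (#-++ l xs ys) (f l))

δ-inj : ∀ {f : ℕ → ℕ} → (∀ {x y} → f x ≡ f y → x ≡ y) → ∀ c c' a z → δ (c , f a) (c' , f z) ≡ δ (c , a) (c' , z)
δ-inj {f} inj c c' a z with (c , a) ≟ˡ (c' , z)
... | yes refl = δ-refl _
... | no ne    = δ-≢ λ e → ne (cong₂ _,_ (cong proj₁ e) (inj (cong proj₂ e)))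

#-inj : ∀ {f : ℕ → ℕ} → (∀ {x y} → f x ≡ f y → x ≡ y) → ∀ c a xs → # (c , f a) (renL f xs) ≡ # (c , a) xs
#-inj inj c a []       = refl
#-inj inj c a ((c' , z) ∷ xs) = cong₂ _+_ (δ-inj inj c c' a z) (#-inj inj c a xs)

#-out : ∀ {f : ℕ → ℕ} c a → (∀ x → a ≢ f x) → ∀ xs → # (c , a) (renL f xs) ≡ 0
#-out c a out []       = refl
#-out c a out ((c' , z) ∷ xs) = cong₂ _+_ (δ-≢ (out z ∘ cong proj₂)) (#-out c a out xs)

evens-inj : ∀ {x y} → evens x ≡ evens y → x ≡ y
evens-inj {zero} {zero} e   = refl
evens-inj {suc x} {suc y} e = cong suc (evens-inj (suc-injective (suc-injective e)))

odds-inj : ∀ {x y} → odds x ≡ odds y → x ≡ y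
odds-inj {zero} {zero} e   = refl
odds-inj {suc x} {suc y} e = cong suc (odds-inj (suc-injective (suc-injective e)))

evens≢odds : ∀ x y → evens x ≢ odds y
evens≢odds zero zero ()
evens≢odds (suc x) zero ()
evens≢odds (suc x) (suc y) e = evens≢odds x y (suc-injective (suc-injective e))

data Parity : ℕ → Set where
  even : ∀ k → Parity (evens k)
  odd  : ∀ k → Parity (odds k)

parity : ∀ n → Parity n
parity zero       = even 0
parity (suc zero) = odd 0
parity (suc (suc n)) with parity n
... | even k = even (suc k)
... | odd k  = odd (suc k)

apart : ∀ xs ys → Lin1 xs → Lin1 ys → Lin1 (renL evens xs ++ renL odds ys)
apart xs ys f g (c , a) rewrite #-++ (c , a) (renL evens xs) (renL odds ys) with parity a
... | even k rewrite #-inj evens-inj c k xs | #-out {odds} c (evens k) (λ x → evens≢odds k x) ys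
                   | +-identityʳ (# (c , k) xs) = f (c , k)
... | odd k rewrite #-inj odds-inj c k ys | #-out {evens} c (odds k) (λ x e → evens≢odds x k (Eq.sym e)) xs = g (c , k)

-- Identifying the two types of a cut

_≔_ : ℕ → ℕ → ℕ → ℕ
(x ≔ y) z with z ≟ x
... | yes _ = y
... | no _  = z

δ-≔-≢ : ∀ x y c a c' z → a ≢ y → δ (c , a) (c' , (x ≔ y) z) ≤ δ (c , a) (c' , z)
δ-≔-≢ x y c a c' z ne with z ≟ x
... | yes _ rewrite δ-≢ {c , a} {c' , y} (ne ∘ cong proj₂) = z≤n
... | no _  = ≤-refl

δ-≔-≡ : ∀ x y c c' z → δ (c , y) (c' , (x ≔ y) z) ≤ δ (c , x) (c' , z) + δ (c , y) (c' , z)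
δ-≔-≡ x y c c' z with z ≟ x
... | no _ = m≤n+m _ _
... | yes refl with (c , y) ≟ˡ (c' , y)
...   | yes refl rewrite δ-refl (c , z) = s≤s z≤n
...   | no _ = z≤n

#-≔-≢ : ∀ x y c a → a ≢ y → ∀ xs → # (c , a) (renL (x ≔ y) xs) ≤ # (c , a) xs
#-≔-≢ x y c a ne []              = z≤n
#-≔-≢ x y c a ne ((c' , z) ∷ xs) = +-mono-≤ (δ-≔-≢ x y c a c' z ne) (#-≔-≢ x y c a ne xs)

#-≔-≡ : ∀ x y c xs → # (c , y) (renL (x ≔ y) xs) ≤ # (c , x) xs + # (c , y) xs
#-≔-≡ x y c []              = z≤n
#-≔-≡ x y c ((c' , z) ∷ xs) = ≤-trans (+-mono-≤ (δ-≔-≡ x y c c' z) (#-≔-≡ x y c xs))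
  (≤-reflexive (+-interchange (δ (c , x) (c' , z)) _ (# (c , x) xs) _))

-- Two links that meet at a cut are fused into one. The names `x` and `y` do not collide: with
-- polarity `b` no further `x` is left in `xs`, and with the opposite polarity no further `y`.
identify : ∀ b x y xs → Lin1 ((b , x) ∷ (not b , y) ∷ xs) → Lin1 (renL (x ≔ y) xs)
identify b x y xs f (c , a) with a ≟ y
... | no ne = ≤-trans (#-≔-≢ x y c a ne xs) (Lin1-++ʳ ((b , x) ∷ (not b , y) ∷ []) xs f (c , a))
... | yes refl = ≤-trans (#-≔-≡ x y c xs) (go b c f)
  where
  rest : ∀ b → Lin1 ((b , x) ∷ (not b , y) ∷ xs) → Lin1 xs
  rest b = Lin1-++ʳ ((b , x) ∷ (not b , y) ∷ []) xs
  same : ∀ b → Lin1 ((b , x) ∷ (not b , y) ∷ xs) → # (b , x) xs ≤ 0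
  same b f with q ← f (b , x) rewrite δ-refl (b , x) = ≤-trans (m≤n+m _ _) (s≤s⁻¹ q)
  opp : ∀ b → Lin1 ((b , x) ∷ (not b , y) ∷ xs) → # (not b , y) xs ≤ 0
  opp b f with q ← f (not b , y) rewrite δ-refl (not b , y) =
    s≤s⁻¹ (≤-trans (m≤n+m _ (δ (not b , y) (b , x))) q)
  go : ∀ b c → Lin1 ((b , x) ∷ (not b , y) ∷ xs) → # (c , x) xs + # (c , y) xs ≤ 1
  go true true f = +-mono-≤ (same true f) (rest true f (true , y))
  go false false f = +-mono-≤ (same false f) (rest false f (false , y))
  go true false f = ≤-trans (+-mono-≤ (rest true f (false , x)) (opp true f)) (≤-reflexive (+-identityʳ 1))
  go false true f = ≤-trans (+-mono-≤ (rest false f (true , x)) (opp false f)) (≤-reflexive (+-identityʳ 1))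

_⟪_⟫ᵛ : Ty → (ℕ → ℕ) → Ty
A ⟪ ρ ⟫ᵛ = A ⟪ tvar ∘ ρ ⟫

-- By `absorb`, only names that `ρ` already identifies are merged, so `ρ` still leads back to the
-- original typing.
record Identified (ρ : ℕ → ℕ) (X X' : Ty) (xs : List Lit) : Set where
  constructor identified
  field
    σ      : ℕ → ℕ
    absorb : ρ ∘ σ ≗ ρ
    equal  : X ⟪ σ ⟫ᵛ ≡ X' ⟪ σ ⟫ᵛ
    linear : Lin1 (renL σ xs)

≔-absorb : ∀ (ρ : ℕ → ℕ) x y → ρ x ≡ ρ y → ∀ z → ρ ((x ≔ y) z) ≡ ρ z
≔-absorb ρ x y e z with z ≟ x
... | yes refl = Eq.sym e
... | no _     = refl

≔-equal : ∀ x y → (x ≔ y) x ≡ (x ≔ y) y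
≔-equal x y with x ≟ x | y ≟ x
... | yes _ | yes _ = refl
... | yes _ | no _  = refl
... | no ne | _     = contradiction refl ne

tvar-inj : ∀ {x y} → tvar x ≡ tvar y → x ≡ y
tvar-inj refl = refl

pair-perm : ∀ b b' X₁ X₂ X₁' X₂' xs →
  (occ b X₁ ++ occ b' X₂) ++ (occ (not b) X₁' ++ occ (not b') X₂') ++ xs ≈
  occ b X₁ ++ occ (not b) X₁' ++ occ b' X₂ ++ occ (not b') X₂' ++ xs
pair-perm b b' X₁ X₂ X₁' X₂' xs .counts l
  rewrite #-++₃ l (occ b X₁ ++ occ b' X₂) (occ (not b) X₁' ++ occ (not b') X₂') xs
        | #-++ l (occ b X₁) (occ b' X₂) | #-++ l (occ (not b) X₁') (occ (not b') X₂')
        | #-++₃ l (occ b X₁) (occ (not b) X₁') (occ b' X₂ ++ occ (not b') X₂' ++ xs)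
        | #-++₃ l (occ b' X₂) (occ (not b') X₂') xs
  = solve 5 (λ p q r s t → (p :+ q) :+ ((r :+ s) :+ t) := p :+ (r :+ (q :+ (s :+ t)))) refl
      (# l (occ b X₁)) (# l (occ b' X₂)) (# l (occ (not b) X₁')) (# l (occ (not b') X₂')) (# l xs)
  where open +-*-Solver

renL-occ₃ : ∀ σ b b' X X' xs → renL σ (occ b X ++ occ b' X' ++ xs) ≡
  occ b (X ⟪ σ ⟫ᵛ) ++ occ b' (X' ⟪ σ ⟫ᵛ) ++ renL σ xs
renL-occ₃ σ b b' X X' xs
  rewrite occ-ren b X σ | occ-ren b' X' σ | map-++ (map₂ σ) (occ b X) (occ b' X' ++ xs)
        | map-++ (map₂ σ) (occ b' X') xs = refl

-- Shared by tensor and implication, which differ only in the polarity of the left component. While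
-- the left components are identified, the right ones travel along in the remaining literals, and so
-- stay linear.
identify-pair : ∀ b b' ρ X₁ X₂ X₁' X₂' xs →
  Lin1 ((occ b X₁ ++ occ b' X₂) ++ (occ (not b) X₁' ++ occ (not b') X₂') ++ xs) →
  (∀ xs → Lin1 (occ b X₁ ++ occ (not b) X₁' ++ xs) → Identified ρ X₁ X₁' xs) →
  (∀ σ xs → ρ ∘ σ ≗ ρ → Lin1 (occ b' (X₂ ⟪ σ ⟫ᵛ) ++ occ (not b') (X₂' ⟪ σ ⟫ᵛ) ++ xs) →
    Identified ρ (X₂ ⟪ σ ⟫ᵛ) (X₂' ⟪ σ ⟫ᵛ) xs) →
  ∃ λ σ → ρ ∘ σ ≗ ρ × X₁ ⟪ σ ⟫ᵛ ≡ X₁' ⟪ σ ⟫ᵛ × X₂ ⟪ σ ⟫ᵛ ≡ X₂' ⟪ σ ⟫ᵛ × Lin1 (renL σ xs)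
identify-pair b b' ρ X₁ X₂ X₁' X₂' xs f ih₁ ih₂
  with identified σ a e g ← ih₁ _ (Lin1-≈ (pair-perm b b' X₁ X₂ X₁' X₂' xs) f)
  with identified τ a' e' g' ← ih₂ σ (renL σ xs) a (subst Lin1 (renL-occ₃ σ b' (not b') X₂ X₂' xs) g) =
  τ ∘ σ , (λ z → Eq.trans (a' (σ z)) (a z)) ,
  Eq.trans (Eq.sym (fuse σ τ X₁)) (Eq.trans (cong _⟪ τ ⟫ᵛ e) (fuse σ τ X₁')) ,
  Eq.trans (Eq.sym (fuse σ τ X₂)) (Eq.trans e' (fuse σ τ X₂')) ,
  subst Lin1 {x = renL τ (renL σ xs)} {renL (τ ∘ σ) xs} (Eq.sym (map-∘ xs)) g'
  where
  fuse : ∀ σ τ A → A ⟪ σ ⟫ᵛ ⟪ τ ⟫ᵛ ≡ A ⟪ τ ∘ σ ⟫ᵛ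
  fuse σ τ A = ⟪⟫-∘ A (λ _ → refl)

-- A common renaming instance `C` forces equal shapes, so unification reduces to identifying
-- corresponding atoms. Each such pair has opposite polarities, as `identify` requires.
identify-types : ∀ C b ρ X X' xs → X ⟪ ρ ⟫ᵛ ≡ C → X' ⟪ ρ ⟫ᵛ ≡ C →
  Lin1 (occ b X ++ occ (not b) X' ++ xs) → Identified ρ X X' xs
identify-types C b ρ (tvar x) (tvar y) xs p q f =
  identified (x ≔ y) (≔-absorb ρ x y (tvar-inj (Eq.trans p (Eq.sym q)))) (cong tvar (≔-equal x y)) (identify b x y xs f)
identify-types (C₁ ⊗ C₂) b ρ (X₁ ⊗ X₂) (X₁' ⊗ X₂') xs p q f
  with σ , a , e₁ , e₂ , g ← identify-pair b b ρ X₁ X₂ X₁' X₂' xs f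
    (λ ys → identify-types C₁ b ρ X₁ X₁' ys (proj₁ (⊗-inj p)) (proj₁ (⊗-inj q)))
    (λ σ ys a → identify-types C₂ b ρ _ _ ys
      (Eq.trans (⟪⟫-∘ X₂ (cong tvar ∘ a)) (proj₂ (⊗-inj p)))
      (Eq.trans (⟪⟫-∘ X₂' (cong tvar ∘ a)) (proj₂ (⊗-inj q)))) =
  identified σ a (cong₂ _⊗_ e₁ e₂) g
identify-types (C₁ ⊸ C₂) b ρ (X₁ ⊸ X₂) (X₁' ⊸ X₂') xs p q f
  with σ , a , e₁ , e₂ , g ← identify-pair (not b) b ρ X₁ X₂ X₁' X₂' xs f
    (λ ys → identify-types C₁ (not b) ρ X₁ X₁' ys (proj₁ (⊸-inj p)) (proj₁ (⊸-inj q)))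
    (λ σ ys a → identify-types C₂ b ρ _ _ ys
      (Eq.trans (⟪⟫-∘ X₂ (cong tvar ∘ a)) (proj₂ (⊸-inj p)))
      (Eq.trans (⟪⟫-∘ X₂' (cong tvar ∘ a)) (proj₂ (⊸-inj q)))) =
  identified σ a (cong₂ _⊸_ e₁ e₂) g
identify-types (_ ⊗ _) b ρ (tvar x) (_ ⊗ _) xs () q f
identify-types (_ ⊗ _) b ρ (_ ⊗ _) (tvar x) xs p () f
identify-types (_ ⊗ _) b ρ (_ ⊸ _) _ xs () q f
identify-types (_ ⊗ _) b ρ (_ ⊗ _) (_ ⊸ _) xs p () f
identify-types (_ ⊸ _) b ρ (tvar x) _ xs () q f
identify-types (_ ⊸ _) b ρ (_ ⊗ _) _ xs () q f
identify-types (_ ⊸ _) b ρ (_ ⊸ _) (tvar x) xs p () f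
identify-types (_ ⊸ _) b ρ (_ ⊸ _) (_ ⊗ _) xs p () f
identify-types (tvar _) b ρ (tvar x) (_ ⊗ _) xs p () f
identify-types (tvar _) b ρ (tvar x) (_ ⊸ _) xs p () f

seq : ∀ {n} → Ctx n → Ty → List Lit
seq Γ A = occC Γ ++ occ true A

≈-comm : ∀ xs ys → xs ++ ys ≈ ys ++ xs
≈-comm xs ys ._≈_.counts l = Eq.trans (#-++ l xs ys) (Eq.trans (+-comm (# l xs) _) (Eq.sym (#-++ l ys xs)))

lits : CommutativeMonoid 0ℓ 0ℓ
lits = record
  { Carrier = List Lit ; _≈_ = _≈_ ; _∙_ = _++_ ; ε = []
  ; isCommutativeMonoid = record
    { isMonoid = record
      { isSemigroup = record
        { isMagma = record
          { isEquivalence = record { refl = ≈-refl ; sym = ≈-sym ; trans = ≈-trans }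
          ; ∙-cong = ≈-++ }
        ; assoc = λ xs ys zs → ≈-reflexive (++-assoc xs ys zs) }
      ; identity = (λ _ → ≈-refl) , (λ xs → ≈-reflexive (++-identityʳ xs)) }
    ; comm = ≈-comm } }

open Algebra.Solver.CommutativeMonoid lits using (_⊜_; _⊕_) renaming (solve to permute)

-- Skeletons and linearization

skeleton : Ty → Ty
skeleton (tvar _) = tvar 0
skeleton (A ⊗ B)  = skeleton A ⟪ evens ⟫ᵛ ⊗ skeleton B ⟪ odds ⟫ᵛ
skeleton (A ⊸ B)  = skeleton A ⟪ evens ⟫ᵛ ⊸ skeleton B ⟪ odds ⟫ᵛ

copair-apart : ∀ D E (f g : ℕ → ℕ) → D ⟪ evens ⟫ᵛ ⟪ copair f g ⟫ᵛ ≡ D ⟪ f ⟫ᵛ × E ⟪ odds ⟫ᵛ ⟪ copair f g ⟫ᵛ ≡ E ⟪ g ⟫ᵛ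
copair-apart D E f g = ⟪⟫-∘ D (cong tvar ∘ copair-evens f g) , ⟪⟫-∘ E (cong tvar ∘ copair-odds f g)

-- A skeleton depends on the shape of the type alone and has pairwise distinct atoms, so a type of
-- the same shape is a renaming of it. Linearized types of two inhabitants of `A` thus become two
-- renamings of a single type.
skeleton-universal : ∀ {A} A' θ → A' ⟪ θ ⟫ᵛ ≡ A → ∃ λ ρ → skeleton A ⟪ ρ ⟫ᵛ ≡ A'
skeleton-universal (tvar x) θ refl = const x , refl
skeleton-universal (A ⊗ B) θ refl
  with f , d ← skeleton-universal A θ refl | g , e ← skeleton-universal B θ refl =
  let p , q = copair-apart (skeleton (A ⟪ θ ⟫ᵛ)) (skeleton (B ⟪ θ ⟫ᵛ)) f g
  in copair f g , cong₂ _⊗_ (Eq.trans p d) (Eq.trans q e)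
skeleton-universal (A ⊸ B) θ refl
  with f , d ← skeleton-universal A θ refl | g , e ← skeleton-universal B θ refl =
  let p , q = copair-apart (skeleton (A ⟪ θ ⟫ᵛ)) (skeleton (B ⟪ θ ⟫ᵛ)) f g
  in copair f g , cong₂ _⊸_ (Eq.trans p d) (Eq.trans q e)

renL-++ : ∀ σ xs ys → renL σ (xs ++ ys) ≡ renL σ xs ++ renL σ ys
renL-++ σ = map-++ (map₂ σ)

ren-occ : ∀ b A σ → renL σ (occ b A) ≈ occ b (A ⟪ σ ⟫ᵛ)
ren-occ b A σ = ≈-reflexive (Eq.sym (occ-ren b A σ))

renL-occ₂ : ∀ σ b A b' B → renL σ (occ b A ++ occ b' B) ≈ occ b (A ⟪ σ ⟫ᵛ) ++ occ b' (B ⟪ σ ⟫ᵛ)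
renL-occ₂ σ b A b' B = ≈-trans (≈-reflexive (renL-++ σ (occ b A) _)) (≈-++ (ren-occ b A σ) (ren-occ b' B σ))

both : Ty → List Lit
both A = occ false (skeleton A) ++ occ true (skeleton A)

skeleton-linear : ∀ A → Lin1 (both A)
skeleton-linear (tvar x) (false , a) rewrite δ-≢ {false , a} {true , 0} (λ ()) = one a
  where
  one : ∀ a → δ (false , a) (false , 0) + 0 ≤ 1
  one a with (false , a) ≟ˡ (false , 0)
  ... | yes _ = s≤s z≤n
  ... | no _  = z≤n
skeleton-linear (tvar x) (true , a) rewrite δ-≢ {true , a} {false , 0} (λ ()) = one a
  where
  one : ∀ a → δ (true , a) (true , 0) + 0 ≤ 1
  one a with (true , a) ≟ˡ (true , 0)
  ... | yes _ = s≤s z≤n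
  ... | no _  = z≤n
skeleton-linear (A ⊗ B) = Lin1-≈
  (≈-trans (≈-++ (renL-occ₂ evens false (skeleton A) true (skeleton A))
                 (renL-occ₂ odds false (skeleton B) true (skeleton B)))
    (permute 4 (λ a b c d → (a ⊕ b) ⊕ (c ⊕ d) ⊜ (a ⊕ c) ⊕ (b ⊕ d)) ≈-refl (occ false Aᵉ) (occ true Aᵉ) (occ false Bᵒ) (occ true Bᵒ)))
  (apart (both A) (both B) (skeleton-linear A) (skeleton-linear B))
  where Aᵉ = skeleton A ⟪ evens ⟫ᵛ ; Bᵒ = skeleton B ⟪ odds ⟫ᵛ
skeleton-linear (A ⊸ B) = Lin1-≈
  (≈-trans (≈-++ (renL-occ₂ evens false (skeleton A) true (skeleton A))
                 (renL-occ₂ odds false (skeleton B) true (skeleton B)))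
    (permute 4 (λ a b c d → (a ⊕ b) ⊕ (c ⊕ d) ⊜ (b ⊕ c) ⊕ (a ⊕ d)) ≈-refl (occ false Aᵉ) (occ true Aᵉ) (occ false Bᵒ) (occ true Bᵒ)))
  (apart (both A) (both B) (skeleton-linear A) (skeleton-linear B))
  where Aᵉ = skeleton A ⟪ evens ⟫ᵛ ; Bᵒ = skeleton B ⟪ odds ⟫ᵛ

_⟪_⟫ᶜ : ∀ {n} → Ctx n → (ℕ → ℕ) → Ctx n
Γ ⟪ ρ ⟫ᶜ = substCtx (tvar ∘ ρ) Γ

renC-occ : ∀ {n} (Γ : Ctx n) σ → renL σ (occC Γ) ≈ occC (Γ ⟪ σ ⟫ᶜ)
renC-occ Γ σ = ≈-reflexive (Eq.sym (occC-ren Γ σ))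

renL-seq : ∀ {n} σ (Γ : Ctx n) A → renL σ (seq Γ A) ≈ seq (Γ ⟪ σ ⟫ᶜ) (A ⟪ σ ⟫ᵛ)
renL-seq σ Γ A = ≈-trans (≈-reflexive (renL-++ σ (occC Γ) _)) (≈-++ (renC-occ Γ σ) (ren-occ true A σ))

Linear : ∀ {n} → Ctx n → Ty → Set
Linear Γ A = Lin1 (seq Γ A)

record Linearization {n} (Γ : Ctx n) (t : Tm n) (A : Ty) : Set where
  constructor linearization
  field
    Γ°     : Ctx n
    A°     : Ty
    ρ      : ℕ → ℕ
    typing : Γ° ⊢ t ∶ A°
    linear : Linear Γ° A°
    ctx≡   : Γ° ⟪ ρ ⟫ᶜ ≡ Γ
    type≡  : A° ⟪ ρ ⟫ᵛ ≡ A

substCtx-absorb : ∀ {n} (Γ : Ctx n) ρ σ → (∀ a → ρ (σ a) ≡ ρ a) → Γ ⟪ σ ⟫ᶜ ⟪ ρ ⟫ᶜ ≡ Γ ⟪ ρ ⟫ᶜ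
substCtx-absorb Γ ρ σ a = substCtx-∘ Γ (cong tvar ∘ a)

copairC-evens : ∀ {n} (Γ : Ctx n) f g → Γ ⟪ evens ⟫ᶜ ⟪ copair f g ⟫ᶜ ≡ Γ ⟪ f ⟫ᶜ
copairC-evens Γ f g = substCtx-∘ Γ (cong tvar ∘ copair-evens f g)

copairC-odds : ∀ {n} (Γ : Ctx n) f g → Γ ⟪ odds ⟫ᶜ ⟪ copair f g ⟫ᶜ ≡ Γ ⟪ g ⟫ᶜ
copairC-odds Γ f g = substCtx-∘ Γ (cong tvar ∘ copair-odds f g)

apart-seq : ∀ {n m} {Γ : Ctx n} {A} {Δ : Ctx m} {B} → Linear Γ A → Linear Δ B →
  Lin1 (seq (Γ ⟪ evens ⟫ᶜ) (A ⟪ evens ⟫ᵛ) ++ seq (Δ ⟪ odds ⟫ᶜ) (B ⟪ odds ⟫ᵛ))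
apart-seq {Γ = Γ} {A} {Δ} {B} f g =
  Lin1-≈ (≈-++ (renL-seq evens Γ A) (renL-seq odds Δ B)) (apart (seq Γ A) (seq Δ B) f g)

-- An axiom is retyped with a skeleton. Rules with two premises take these apart by evens and odds;
-- the type that an application or a let shares between its premises is then identified atom by
-- atom, which fuses links and preserves linearity.
linearize : ∀ {n} {Γ : Ctx n} {t A} → Γ ⊢ t ∶ A → Linearization Γ t A
linearize (⊢var i {A}) with skeleton-universal A id (⟪⟫-id A λ _ → refl)
... | ρ , e = linearization _ _ ρ (⊢var i)
  (Lin1-≈ (≈-++ (≈-sym (occC-only i (skeleton A))) ≈-refl) (skeleton-linear A))
  (Eq.trans (mapCtx-only _ i (skeleton A)) (cong (only i) e)) e
linearize (⊢lam {Γ} {t} {A} {B} d) with linearize d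
... | linearization (just A' ∷ Γ') B' ρ d' l c e = linearization Γ' (A' ⊸ B') ρ (⊢lam d')
  (Lin1-≈ (permute 3 (λ a g b → (a ⊕ g) ⊕ b ⊜ g ⊕ (a ⊕ b)) ≈-refl (occ false A') (occC Γ') (occ true B')) l)
  (proj₂ (∷≡ c)) (cong₂ _⊸_ (proj₁ (∷≡ c)) e)
linearize (⊢pair s d e)
  with linearization Γ₁ A f d' l₁ c₁ e₁ ← linearize d | linearization Γ₂ B g d'' l₂ c₂ e₂ ← linearize e
  with Γ , q ← split-instances s c₁ c₂ ↑ᵉ ↑ᵒ =
  let p , r = copair-apart A B f g in
  linearization Γ (A ⟪ evens ⟫ᵛ ⊗ B ⟪ odds ⟫ᵛ) (copair f g) (⊢pair q (⊢⟪⟫ ↑ᵉ d') (⊢⟪⟫ ↑ᵒ d''))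
    (Lin1-≈ (≈-trans
      (permute 4 (λ a b c d → (a ⊕ b) ⊕ (c ⊕ d) ⊜ (a ⊕ c) ⊕ (b ⊕ d)) ≈-refl
        (occC (Γ₁ ⟪ evens ⟫ᶜ)) (occ true (A ⟪ evens ⟫ᵛ)) (occC (Γ₂ ⟪ odds ⟫ᶜ)) (occ true (B ⟪ odds ⟫ᵛ)))
      (≈-++ (≈-sym (occC-split q)) ≈-refl))
      (apart-seq {Γ = Γ₁} {A} {Γ₂} {B} l₁ l₂))
    (substCtx-split⁻¹ q s (Eq.trans (copairC-evens Γ₁ f g) c₁) (Eq.trans (copairC-odds Γ₂ f g) c₂))
    (cong₂ _⊗_ (Eq.trans p e₁) (Eq.trans r e₂))
linearize (⊢app {A = X} s d e)
  with linearization Γ₁ (X' ⊸ B) f d' l₁ c₁ e₁ ← linearize d | linearization Γ₂ X'' g d'' l₂ c₂ e₂ ← linearize e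
  with Γ , q ← split-instances s c₁ c₂ ↑ᵉ ↑ᵒ
  with identified σ a eq l ← identify-types X false (copair f g) (X' ⟪ evens ⟫ᵛ) (X'' ⟪ odds ⟫ᵛ)
         (seq Γ (B ⟪ evens ⟫ᵛ))
         (Eq.trans (proj₁ (copair-apart X' X'' f g)) (proj₁ (⊸-inj e₁)))
         (Eq.trans (proj₂ (copair-apart X' X'' f g)) e₂)
         (Lin1-≈ (≈-trans
            (permute 5 (λ g x b g' x' → (g ⊕ (x ⊕ b)) ⊕ (g' ⊕ x') ⊜ x ⊕ (x' ⊕ ((g ⊕ g') ⊕ b))) ≈-refl
              (occC (Γ₁ ⟪ evens ⟫ᶜ)) (occ false (X' ⟪ evens ⟫ᵛ)) (occ true (B ⟪ evens ⟫ᵛ))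
              (occC (Γ₂ ⟪ odds ⟫ᶜ)) (occ true (X'' ⟪ odds ⟫ᵛ)))
            (≈-++ {occ false (X' ⟪ evens ⟫ᵛ)} ≈-refl (≈-++ {occ true (X'' ⟪ odds ⟫ᵛ)} ≈-refl
              (≈-++ (≈-sym (occC-split q)) ≈-refl))))
            (apart-seq {Γ = Γ₁} {X' ⊸ B} {Γ₂} {X''} l₁ l₂)) =
  let d₁ = ⊢⟪⟫ (tvar ∘ σ) (⊢⟪⟫ ↑ᵉ d') ; d₂ = ⊢⟪⟫ (tvar ∘ σ) (⊢⟪⟫ ↑ᵒ d'') in
  linearization (Γ ⟪ σ ⟫ᶜ) (B ⟪ evens ⟫ᵛ ⟪ σ ⟫ᵛ) (copair f g)
    (⊢app (mapCtx-split _ q) d₁ (subst (λ Z → _ ⊢ _ ∶ Z) (Eq.sym eq) d₂))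
    (Lin1-≈ (renL-seq σ Γ (B ⟪ evens ⟫ᵛ)) l)
    (Eq.trans (substCtx-absorb Γ (copair f g) σ a)
      (substCtx-split⁻¹ q s (Eq.trans (copairC-evens Γ₁ f g) c₁) (Eq.trans (copairC-odds Γ₂ f g) c₂)))
    (Eq.trans (⟪⟫-∘ (B ⟪ evens ⟫ᵛ) (cong tvar ∘ a))
      (Eq.trans (⟪⟫-∘ B (cong tvar ∘ copair-evens f g)) (proj₂ (⊸-inj e₁))))
linearize (⊢let {A = X} {Y} s d e)
  with linearization Γ₁ P f d' l₁ c₁ e₁ ← linearize d
     | linearization (just X' ∷ just Y' ∷ Γ₂) C g d'' l₂ c₂ e₂ ← linearize e
  with Γ , q ← split-instances s c₁ (proj₂ (∷≡ (proj₂ (∷≡ c₂)))) ↑ᵉ ↑ᵒ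
  with identified σ a eq l ← identify-types (X ⊗ Y) true (copair f g) (P ⟪ evens ⟫ᵛ) ((X' ⊗ Y') ⟪ odds ⟫ᵛ)
         (seq Γ (C ⟪ odds ⟫ᵛ))
         (Eq.trans (proj₁ (copair-apart P (X' ⊗ Y') f g)) e₁)
         (Eq.trans (proj₂ (copair-apart P (X' ⊗ Y') f g)) (cong₂ _⊗_ (proj₁ (∷≡ c₂)) (proj₁ (∷≡ (proj₂ (∷≡ c₂))))))
         (Lin1-≈ (≈-trans
            (permute 6 (λ g p x y g' c → (g ⊕ p) ⊕ ((x ⊕ (y ⊕ g')) ⊕ c) ⊜ p ⊕ ((x ⊕ y) ⊕ ((g ⊕ g') ⊕ c))) ≈-refl
              (occC (Γ₁ ⟪ evens ⟫ᶜ)) (occ true (P ⟪ evens ⟫ᵛ)) (occ false (X' ⟪ odds ⟫ᵛ)) (occ false (Y' ⟪ odds ⟫ᵛ))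
              (occC (Γ₂ ⟪ odds ⟫ᶜ)) (occ true (C ⟪ odds ⟫ᵛ)))
            (≈-++ {occ true (P ⟪ evens ⟫ᵛ)} ≈-refl (≈-++ {occ false ((X' ⊗ Y') ⟪ odds ⟫ᵛ)} ≈-refl
              (≈-++ (≈-sym (occC-split q)) ≈-refl))))
            (apart-seq {Γ = Γ₁} {P} {just X' ∷ just Y' ∷ Γ₂} {C} l₁ l₂)) =
  let d₁ = ⊢⟪⟫ (tvar ∘ σ) (⊢⟪⟫ ↑ᵉ d') ; d₂ = ⊢⟪⟫ (tvar ∘ σ) (⊢⟪⟫ ↑ᵒ d'') in
  linearization (Γ ⟪ σ ⟫ᶜ) (C ⟪ odds ⟫ᵛ ⟪ σ ⟫ᵛ) (copair f g)
    (⊢let (mapCtx-split _ q) (subst (λ Z → _ ⊢ _ ∶ Z) eq d₁) d₂)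
    (Lin1-≈ (renL-seq σ Γ (C ⟪ odds ⟫ᵛ)) l)
    (Eq.trans (substCtx-absorb Γ (copair f g) σ a)
      (substCtx-split⁻¹ q s (Eq.trans (copairC-evens Γ₁ f g) c₁)
        (Eq.trans (copairC-odds Γ₂ f g) (proj₂ (∷≡ (proj₂ (∷≡ c₂)))))))
    (Eq.trans (⟪⟫-∘ (C ⟪ odds ⟫ᵛ) (cong tvar ∘ a))
      (Eq.trans (⟪⟫-∘ C (cong tvar ∘ copair-odds f g)) e₂))

-- Connectedness and balance

Mono : (ℕ → Bool) → Bool → Ty → Set
Mono c b (tvar a) = c a ≡ b
Mono c b (A ⊗ B)  = Mono c b A × Mono c b B
Mono c b (A ⊸ B)  = Mono c b A × Mono c b B

Mono-unique : ∀ {c b b'} A → Mono c b A → Mono c b' A → b ≡ b'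
Mono-unique (tvar a) p q              = Eq.trans (Eq.sym p) q
Mono-unique (A ⊗ _) (p , _) (q , _) = Mono-unique A p q
Mono-unique (A ⊸ _) (p , _) (q , _) = Mono-unique A p q

data MonoC (c : ℕ → Bool) (b : Bool) : ∀ {n} → Ctx n → Set where
  []      : MonoC c b []
  nothing : ∀ {n} {Γ : Ctx n} → MonoC c b Γ → MonoC c b (nothing ∷ Γ)
  just    : ∀ {n} {Γ : Ctx n} {A} → Mono c b A → MonoC c b Γ → MonoC c b (just A ∷ Γ)

data Each (c : ℕ → Bool) : ∀ {n} → Ctx n → Set where
  []      : Each c []
  nothing : ∀ {n} {Γ : Ctx n} → Each c Γ → Each c (nothing ∷ Γ)
  just    : ∀ {n} {Γ : Ctx n} {A} b → Mono c b A → Each c Γ → Each c (just A ∷ Γ)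

module _ (c : ℕ → Bool) (b : Bool) where
  -- The monoid resource counts assumptions of the wrong colour.
  open Realizability (λ a m t → c a ≡ b → m ≡ 0) (λ r p → p)

  -- The reading of atoms looks at the resource only, so any term that reduces to the right shape
  -- will do; it may even drop its arguments.
  dummy : Ty → Tm 0
  dummy (tvar a) = I
  dummy (A ⊗ B)  = ⟨ dummy A , dummy B ⟩
  dummy (A ⊸ B)  = ƛ (wk₁ (dummy B))

  dummy-step : ∀ {A B u} → dummy (A ⊸ B) · u ⟶* dummy B
  dummy-step {B = B} = β ◅ ε ▹ sub-ren-id (λ ()) (dummy B)

  other : ∀ A → Mono c (not b) A → ∀ m → ⟦ A ⟧ m (dummy A)
  other (tvar a) p m e       = contradiction (Eq.trans (Eq.sym e) p) (not-¬ refl)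
  other (A ⊗ B) (p , q) m    = -, -, -, -, +-identityʳ m , ε , other A p m , other B q 0
  other (A ⊸ B) (p , q) m {m'} _ = expand B (dummy-step {A} {B}) (other B q (m + m'))

  same : ∀ A → Mono c b A → ⟦ A ⟧ 0 (dummy A) × (∀ {m t} → ⟦ A ⟧ m t → m ≡ 0)
  same (tvar a) p = (λ _ → refl) , (λ f → f p)
  same (A ⊗ B) (p , q) with a , f ← same A p | b , g ← same B q =
    (-, -, -, -, refl , ε , a , b) ,
    (λ (_ , _ , _ , _ , e , _ , x , y) → Eq.trans (Eq.sym e) (cong₂ _+_ (f x) (g y)))
  same (A ⊸ B) (p , q) with a , f ← same A p | b , g ← same B q =
    (λ x → expand B (dummy-step {A} {B}) (subst (λ k → ⟦ B ⟧ k (dummy B)) (Eq.sym (f x)) b)) ,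
    (λ {m} h → Eq.trans (Eq.sym (+-identityʳ m)) (g (h a)))

  environment : ∀ {n} {Γ : Ctx n} → Each c Γ → ∃₂ λ m γ → Env Γ γ m × (m ≡ 0 → MonoC c b Γ)
  environment [] = -, γ₀ , [] , λ _ → []
  environment (nothing ms) with _ , γ , ρ , f ← environment ms = -, I ∙ γ , none ρ , nothing ∘ f
  environment (just {A = A} b' p ms) with _ , γ , ρ , f ← environment ms with b' Bool.≟ b
  ... | yes refl = -, dummy A ∙ γ , just (proj₁ (same A p)) ρ , just p ∘ f
  -- Resource 1 makes the total nonzero, so that a total of 0 excludes this case.
  ... | no ne rewrite ¬-not ne = -, dummy A ∙ γ , just (other A p 1) ρ , λ ()

  -- An assumption of the wrong colour brings in resource, which a linear term cannot lose; but
  -- realizers of a type of colour `b` have resource 0.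
  connected : ∀ {n} {Γ : Ctx n} {t A} → Each c Γ → Mono c b A → Γ ⊢ t ∶ A → MonoC c b Γ
  connected {A = A} ms p d with _ , _ , ρ , f ← environment ms =
    f (proj₂ (same A p) (fundamental d ρ))

Balanced : List Lit → Set
Balanced xs = ∀ a → # (true , a) xs ≡ # (false , a) xs

Balanced-≈ : ∀ {xs ys} → xs ≈ ys → Balanced xs → Balanced ys
Balanced-≈ p e a = Eq.trans (Eq.sym (_≈_.counts p _)) (Eq.trans (e a) (_≈_.counts p _))

δ-flip : ∀ c b a x → δ (not c , a) (not b , x) ≡ δ (c , a) (b , x)
δ-flip c b a x with (c , a) ≟ˡ (b , x)
... | yes refl = δ-refl _
... | no ne    = δ-≢ λ e → ne (cong₂ _,_ (not-inj (cong proj₁ e)) (cong proj₂ e))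
  where
  not-inj : ∀ {x y} → not x ≡ not y → x ≡ y
  not-inj {x} {y} e = Eq.trans (Eq.sym (not-involutive x)) (Eq.trans (cong not e) (not-involutive y))

#-flip : ∀ c b a A → # (not c , a) (occ (not b) A) ≡ # (c , a) (occ b A)
#-flip c b a (tvar x) = cong (_+ 0) (δ-flip c b a x)
#-flip c b a (A ⊗ B) = Eq.trans (#-++ _ (occ (not b) A) _)
  (Eq.trans (cong₂ _+_ (#-flip c b a A) (#-flip c b a B)) (Eq.sym (#-++ _ (occ b A) _)))
#-flip c b a (A ⊸ B) = Eq.trans (#-++ _ (occ (not (not b)) A) _)
  (Eq.trans (cong₂ _+_ (#-flip c (not b) a A) (#-flip c b a B)) (Eq.sym (#-++ _ (occ (not b) A) _)))

Balanced-++ : ∀ xs ys → Balanced xs → Balanced ys → Balanced (xs ++ ys)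
Balanced-++ xs ys p q a = Eq.trans (#-++ _ xs ys) (Eq.trans (cong₂ _+_ (p a) (q a)) (Eq.sym (#-++ _ xs ys)))

Balanced-cancel : ∀ xs ys → Balanced (xs ++ ys) → Balanced xs → Balanced ys
Balanced-cancel xs ys p q a = +-cancelˡ-≡ (# (true , a) xs) _ _
  (Eq.trans (Eq.sym (#-++ _ xs ys)) (Eq.trans (p a)
    (Eq.trans (#-++ _ xs ys) (cong (_+ # (false , a) ys) (Eq.sym (q a))))))

Balanced-axiom : ∀ A → Balanced (occ false A ++ occ true A)
Balanced-axiom A a = Eq.trans (#-++ _ (occ false A) _)
  (Eq.trans (cong₂ _+_ (#-flip false true a A) (#-flip false false a A))
  (Eq.trans (+-comm (# (false , a) (occ true A)) _) (Eq.sym (#-++ _ (occ false A) _))))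

-- Axioms are balanced by symmetry. The type shared by the premises of an application or a let
-- contributes a balanced part of its own, which can be cancelled.
balanced : ∀ {n} {Γ : Ctx n} {t A} → Γ ⊢ t ∶ A → Balanced (seq Γ A)
balanced (⊢var i {A}) = Balanced-≈ (≈-++ (≈-sym (occC-only i A)) ≈-refl) (Balanced-axiom A)
balanced (⊢lam {Γ} {A = A} {B} d) =
  Balanced-≈ (permute 3 (λ a g b → (a ⊕ g) ⊕ b ⊜ g ⊕ (a ⊕ b)) ≈-refl (occ false A) (occC Γ) (occ true B)) (balanced d)
balanced (⊢pair {Γ₁ = Γ₁} {Γ₂} {A = A} {B} s d e) =
  Balanced-≈ (≈-trans (permute 4 (λ a b c d → (a ⊕ b) ⊕ (c ⊕ d) ⊜ (a ⊕ c) ⊕ (b ⊕ d)) ≈-refl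
      (occC Γ₁) (occ true A) (occC Γ₂) (occ true B))
    (≈-++ (≈-sym (occC-split s)) ≈-refl))
    (Balanced-++ (seq Γ₁ A) (seq Γ₂ B) (balanced d) (balanced e))
balanced (⊢app {Γ₁ = Γ₁} {Γ₂} {A = A} {B} s d e) =
  Balanced-cancel (occ false A ++ occ true A) _
    (Balanced-≈ (≈-trans (permute 5 (λ g x b g' y → (g ⊕ (x ⊕ b)) ⊕ (g' ⊕ y) ⊜ (x ⊕ y) ⊕ ((g ⊕ g') ⊕ b)) ≈-refl
        (occC Γ₁) (occ false A) (occ true B) (occC Γ₂) (occ true A))
      (≈-++ {occ false A ++ occ true A} ≈-refl (≈-++ (≈-sym (occC-split s)) ≈-refl)))
      (Balanced-++ (seq Γ₁ (A ⊸ B)) (seq Γ₂ A) (balanced d) (balanced e)))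
    (Balanced-axiom A)
balanced (⊢let {Γ₁ = Γ₁} {Γ₂} {A = A} {B} {C} s d e) =
  Balanced-cancel (occ false (A ⊗ B) ++ occ true (A ⊗ B)) _
    (Balanced-≈ (≈-trans (permute 6 (λ g p x y g' c → (g ⊕ p) ⊕ ((x ⊕ (y ⊕ g')) ⊕ c) ⊜ ((x ⊕ y) ⊕ p) ⊕ ((g ⊕ g') ⊕ c)) ≈-refl
        (occC Γ₁) (occ true (A ⊗ B)) (occ false A) (occ false B) (occC Γ₂) (occ true C))
      (≈-++ {occ false (A ⊗ B) ++ occ true (A ⊗ B)} ≈-refl (≈-++ (≈-sym (occC-split s)) ≈-refl)))
      (Balanced-++ (seq Γ₁ (A ⊗ B)) (seq (just A ∷ just B ∷ Γ₂) C) (balanced d) (balanced e)))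
    (Balanced-axiom (A ⊗ B))

-- Head normal forms

≐-typed : ∀ {n} {Γ : Ctx n} {t s A} → Γ ⊢ t ≐ s ∶ A → Γ ⊢ t ∶ A × Γ ⊢ s ∶ A
≐-typed (ax _ d e)     = d , e
≐-typed (refl d)       = d , d
≐-typed (sym p)        = let d , e = ≐-typed p in e , d
≐-typed (trans p q)    = proj₁ (≐-typed p) , proj₂ (≐-typed q)
≐-typed (c-lam p)      = let d , e = ≐-typed p in ⊢lam d , ⊢lam e
≐-typed (c-app s p q)  = let d , e = ≐-typed p ; d' , e' = ≐-typed q in ⊢app s d d' , ⊢app s e e'
≐-typed (c-pair s p q) = let d , e = ≐-typed p ; d' , e' = ≐-typed q in ⊢pair s d d' , ⊢pair s e e'
≐-typed (c-let s p q)  = let d , e = ≐-typed p ; d' , e' = ≐-typed q in ⊢let s d d' , ⊢let s e e'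

≐-type₂ : ∀ {n} {Γ : Ctx n} {t s A} → Γ ⊢ t ≐ s ∶ A → Γ ⊢ s ∶ A
≐-type₂ = proj₂ ∘ ≐-typed

⊢ren : ∀ {n m} {Γ : Ctx n} {ρ : Fin n → Fin m} {Δ w t A} → Γ ⊢ t ∶ A → T.Sb Γ (`_ ∘ ρ) Δ w →
  Δ ⊢ ren ρ t ∶ A
⊢ren d r = fromJ (T.J-ren (toJ d) r)

Sb-suc : ∀ {n} (Γ : Ctx n) → T.Sb Γ (`_ ∘ suc) (nothing ∷ Γ) 0
Sb-suc Γ = T.Sb-wk (λ { i (T.var _) → T.var _ }) (λ _ → refl) (T.Sb-id Γ)

⊢β : ∀ {n} {Γ Γ₁ Γ₂ : Ctx n} {t s A B} → Split Γ Γ₁ Γ₂ → (just A ∷ Γ₁) ⊢ t ∶ B → Γ₂ ⊢ s ∶ A →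
  Γ ⊢ (ƛ t) · s ≐ sub (σ₁ s) t ∶ B
⊢β p d e = ax (β _ _) (⊢app p (⊢lam d) e) (⊢sub d (T.Sb-σ₁ p (toJ e)))

β-to : ∀ {n} {Γ Γ₁ Γ₂ : Ctx n} {t s A B t'} → Split Γ Γ₁ Γ₂ → (just A ∷ Γ₁) ⊢ t ∶ B → Γ₂ ⊢ s ∶ A →
  sub (σ₁ s) t ≡ t' → Γ ⊢ (ƛ t) · s ≐ t' ∶ B
β-to p d e refl = ⊢β p d e

sub-wk-id : ∀ {n} (s t : Tm n) → sub (σ₁ s) (wk₁ t) ≡ t
sub-wk-id s = sub-ren-id (λ _ → refl)

NoTensor : ∀ {n} → Ctx n → Set
NoTensor Γ = ∀ {x A B Γ'} → ¬ Split Γ (only x (A ⊗ B)) Γ'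

NoTensor-split : ∀ {n} {Γ Γ₁ Γ₂ : Ctx n} → Split Γ Γ₁ Γ₂ → NoTensor Γ → NoTensor Γ₁ × NoTensor Γ₂
NoTensor-split s f =
  (λ q → f (proj₁ (proj₂ (Split-assocʳ s q)))) ,
  (λ q → f (proj₁ (proj₂ (Split-assocʳ (Split-comm s) q))))

tensor? : ∀ {n} (Γ : Ctx n) → (∃₂ λ x A → ∃₂ λ B Γ' → Split Γ (only x (A ⊗ B)) Γ') ⊎ NoTensor Γ
tensor? [] = inj₂ λ { {()} }
tensor? (x ∷ Γ) with tensor? Γ
tensor? (nothing ∷ Γ) | inj₁ (_ , _ , _ , _ , s) = inj₁ (suc _ , -, -, -, none s)
tensor? (just _ ∷ Γ)  | inj₁ (_ , _ , _ , _ , s) = inj₁ (suc _ , -, -, -, right s)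
tensor? (nothing ∷ Γ) | inj₂ f = inj₂ λ { {suc _} (none s) → f s }
tensor? (just (A ⊗ B) ∷ Γ) | inj₂ f = inj₁ (zero , -, -, -, left (Split-∅ˡ Γ))
tensor? (just (tvar _) ∷ Γ) | inj₂ f = inj₂ λ { {suc _} (right s) → f s }
tensor? (just (_ ⊸ _) ∷ Γ) | inj₂ f = inj₂ λ { {suc _} (right s) → f s }

-- The term around the application of `f` is kept as a linear function `k`. Enlarging the
-- surrounding term then only changes `k`, which is the purpose of the frame lemmas.
record Factor {n} (Γ : Ctx n) (s : Tm n) (A : Ty) : Set where
  constructor factor
  field
    {f}        : Fin n
    {X Y}      : Ty
    {Γ' Γ₁ Γ₂} : Ctx n
    {r k}      : Tm n
    split-f    : Split Γ (only f (X ⊸ Y)) Γ'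
    split-r    : Split Γ' Γ₁ Γ₂
    ⊢r         : Γ₁ ⊢ r ∶ X
    ⊢k         : Γ₂ ⊢ k ∶ Y ⊸ A
    eq         : Γ ⊢ s ≐ k · ((` f) · r) ∶ A

frame-app : ∀ {n} {Γ Γ₂₃ Γ₂ Γ₃ Δ : Ctx n} {k u w Y C A} → Split Γ Γ₂₃ Δ → Split Γ₂₃ Γ₂ Γ₃ →
  Γ₂ ⊢ k ∶ Y ⊸ (C ⊸ A) → Γ₃ ⊢ u ∶ C → Δ ⊢ w ∶ Y →
  Γ₂₃ ⊢ ƛ ((wk₁ k · ` zero) · wk₁ u) ∶ Y ⊸ A ×
  Γ ⊢ (ƛ ((wk₁ k · ` zero) · wk₁ u)) · w ≐ (k · w) · u ∶ A
frame-app {k = k} {u} {w} p q dk du dw = ⊢lam d , β-to p d dw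
  (cong₂ (λ a b → (a · w) · b) (sub-wk-id w k) (sub-wk-id w u))
  where d = ⊢app (left q) (⊢app (right (Split-∅ʳ _)) (⊢wk dk) (⊢var zero)) (⊢wk du)

frame-let : ∀ {n} {Γ Γ₂₃ Γ₂ Γ₃ Δ : Ctx n} {k u w Y C D A} → Split Γ Γ₂₃ Δ → Split Γ₂₃ Γ₂ Γ₃ →
  Γ₂ ⊢ k ∶ Y ⊸ (C ⊗ D) → (just C ∷ just D ∷ Γ₃) ⊢ u ∶ A → Δ ⊢ w ∶ Y →
  Γ₂₃ ⊢ ƛ (letp (wk₁ k · ` zero) (ren (ext (ext suc)) u)) ∶ Y ⊸ A ×
  Γ ⊢ (ƛ (letp (wk₁ k · ` zero) (ren (ext (ext suc)) u))) · w ≐ letp (k · w) u ∶ A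
frame-let {k = k} {u} {w} p q dk du dw = ⊢lam d , β-to p d dw
  (cong₂ (λ a b → letp (a · w) b) (sub-wk-id w k)
    (sub-ren-id (λ { zero → refl ; (suc zero) → refl ; (suc (suc i)) → refl }) u))
  where
  d = ⊢let (left q) (⊢app (right (Split-∅ʳ _)) (⊢wk dk) (⊢var zero))
        (⊢ren du (T.Sb-extʳ (T.Sb-extʳ (Sb-suc _))))

-- The size bounds are attached to abstractions and pairs because these can form a redex with the
-- next application or let.
data Head {n} (Γ : Ctx n) (s : Tm n) : Ty → Set where
  var   : ∀ {A} x → Γ ≡ only x A → Γ ⊢ s ≐ ` x ∶ A → Head Γ s A
  lam   : ∀ {A B t} → Γ ⊢ s ≐ ƛ t ∶ A ⊸ B → size (ƛ t) ≤ size s → Head Γ s (A ⊸ B)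
  pair  : ∀ {A B a b} → Γ ⊢ s ≐ ⟨ a , b ⟩ ∶ A ⊗ B → size ⟨ a , b ⟩ ≤ size s → Head Γ s (A ⊗ B)
  spine : ∀ {A} → Factor Γ s A → Head Γ s A

Head-≐ : ∀ {n} {Γ : Ctx n} {s s' A} → Γ ⊢ s ≐ s' ∶ A → size s' ≤ size s → Head Γ s' A → Head Γ s A
Head-≐ p z (var x e q) = var x e (trans p q)
Head-≐ p z (lam q y)   = lam (trans p q) (≤-trans y z)
Head-≐ p z (pair q y)  = pair (trans p q) (≤-trans y z)
Head-≐ p z (spine (factor a b d e q)) = spine (factor a b d e (trans p q))

Factor-frame : ∀ {n} {Γ Γ₁ Γ₂ : Ctx n} {t s A B} → Split Γ Γ₁ Γ₂ → (F : Factor Γ₁ t B) →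
  (∀ {Γ₂₃ Δ w} → Split Γ Γ₂₃ Δ → Split Γ₂₃ (Factor.Γ₂ F) Γ₂ → Δ ⊢ w ∶ Factor.Y F →
    Γ₁ ⊢ t ≐ Factor.k F · w ∶ B →
    ∃ λ k → Γ₂₃ ⊢ k ∶ Factor.Y F ⊸ A × Γ ⊢ s ≐ k · w ∶ A) → Factor Γ s A
Factor-frame s (factor pf pr dr dk q) frame
  with _ , a , b ← Split-assocʳ s pf
  with _ , c , d ← Split-assocʳ b pr
  with _ , x , y ← Split-assocˡ a c
  with k , dk' , q' ← frame (Split-comm x) d (⊢app y (⊢var _) dr) q =
  factor a c dr dk' q'

-- Contraction makes linear terms smaller, so the fuel `N` suffices. A let whose scrutinee is a
-- variable would be stuck, but needs a tensor assumption; all other scrutinees are pairs or factor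
-- through a function variable.
head : ∀ N {n} {Γ : Ctx n} {s A} → size s < N → NoTensor Γ → Γ ⊢ s ∶ A → Head Γ s A
head N z nt (⊢var i) = var i refl (refl (⊢var i))
head N z nt (⊢lam d) = lam (refl (⊢lam d)) ≤-refl
head N z nt (⊢pair s d e) = pair (refl (⊢pair s d e)) ≤-refl
head (suc N) {s = t · u} z nt (⊢app s d e)
  with head N (≤-trans (s≤s (m≤m+n _ _)) (s≤s⁻¹ z)) (proj₁ (NoTensor-split s nt)) d
-- Nothing surrounds the application yet, so `k` is the identity.
... | var x refl q = spine (factor s (Split-∅ʳ _) e (⊢lam (⊢var zero))
        (trans (c-app s q (refl e)) (sym (⊢β (Split-∅ˡ _) (⊢var zero) (⊢app s (⊢var x) e)))))
... | spine F = spine (Factor-frame s F λ p r dw q →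
        let dk , q' = frame-app p r (Factor.⊢k F) e dw in -, dk , trans (c-app s q (refl e)) (sym q'))
... | lam {t = t'} q y with ⊢lam d' ← ≐-type₂ q =
  Head-≐ (trans (c-app s q (refl e)) (⊢β s d' e)) (<⇒≤ smaller)
    (head N (≤-trans smaller (s≤s⁻¹ z)) nt (⊢sub d' r))
  where
  r = T.Sb-σ₁ s (toJ e)
  smaller : size (sub (σ₁ u) t') < size (t · u)
  smaller = s≤s (≤-trans
    (≤-reflexive (Eq.trans (proj₂ (T.J-sub (toJ d') r)) (cong (size t' +_) (+-identityʳ (size u)))))
    (+-monoˡ-≤ (size u) (≤-trans (n≤1+n _) y)))
head (suc N) {s = letp t u} z nt (⊢let s d e)
  with head N (≤-trans (s≤s (m≤m+n _ _)) (s≤s⁻¹ z)) (proj₁ (NoTensor-split s nt)) d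
... | var x refl q = ⊥-elim (nt s)
... | spine F = spine (Factor-frame s F λ p r dw q →
        let dk , q' = frame-let p r (Factor.⊢k F) e dw in -, dk , trans (c-let s q (refl e)) (sym q'))
... | pair {a = a} {b} q y with ⊢pair s' da db ← ≐-type₂ q =
  Head-≐ (trans (c-let s q (refl e)) (ax (βlet a b u) (⊢let s (⊢pair s' da db) e) (⊢sub e r))) (<⇒≤ smaller)
    (head N (≤-trans smaller (s≤s⁻¹ z)) nt (⊢sub e r))
  where
  r = T.Sb-σ₂ s s' (toJ da) (toJ db)
  smaller : size (sub (σ₂ a b) u) < size (letp t u)
  smaller = s≤s (≤-trans
    (≤-reflexive (Eq.trans (proj₂ (T.J-sub (toJ e) r))
      (Eq.trans (cong (λ k → size u + (size a + k)) (+-identityʳ (size b))) (+-comm (size u) _))))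
    (+-monoˡ-≤ (size u) (≤-trans (n≤1+n _) y)))

-- Extraction of an application

csize : ∀ {n} → Ctx n → ℕ
csize []            = 0
csize (nothing ∷ Γ) = csize Γ
csize (just A ∷ Γ)  = tsize A + csize Γ

csize-split : ∀ {n} {Γ Γ₁ Γ₂ : Ctx n} → Split Γ Γ₁ Γ₂ → csize Γ ≡ csize Γ₁ + csize Γ₂
csize-split []       = refl
csize-split (none s) = csize-split s
csize-split (left {Γ₁ = Γ₁} {A = A} s) =
  Eq.trans (cong (tsize A +_) (csize-split s)) (Eq.sym (+-assoc (tsize A) (csize Γ₁) _))
csize-split (right {Γ₁ = Γ₁} {Γ₂} {A} s) = Eq.trans (cong (tsize A +_) (csize-split s))
  (solve 3 (λ a b c → a :+ (b :+ c) := b :+ (a :+ c)) refl (tsize A) (csize Γ₁) (csize Γ₂))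
  where open +-*-Solver

csize-∅ : ∀ n → csize (∅ {n}) ≡ 0
csize-∅ zero    = refl
csize-∅ (suc n) = csize-∅ n

csize-only : ∀ {n} (i : Fin n) A → csize (only i A) ≡ tsize A
csize-only {suc n} zero A = Eq.trans (cong (tsize A +_) (csize-∅ n)) (+-identityʳ _)
csize-only (suc i) A = csize-only i A

tsize-suc : ∀ A → ∃ λ k → tsize A ≡ suc k
tsize-suc (tvar _) = -, refl
tsize-suc (_ ⊗ _)  = -, refl
tsize-suc (_ ⊸ _)  = -, refl

<-via : ∀ {a b} r → b ≡ suc (a + r) → a < b
<-via r refl = s≤s (m≤m+n _ r)

-- Extraction and coherence recurse on the sequent instead of the term, so η-expansions and
-- commuting conversions may enlarge terms freely.
measure : ∀ {n} → Ctx n → Ty → ℕ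
measure Γ A = csize Γ + tsize A

module _ where
  open +-*-Solver

  <-lam : ∀ {n} (Γ : Ctx n) A B → measure (just A ∷ Γ) B < measure Γ (A ⊸ B)
  <-lam Γ A B = <-via 0 (solve 3 (λ g a b → g :+ (con 1 :+ (a :+ b)) := con 1 :+ (((a :+ g) :+ b) :+ con 0)) refl
    (csize Γ) (tsize A) (tsize B))

  <-let : ∀ {n} {Γ Γ' : Ctx n} {x A B} C → Split Γ (only x (A ⊗ B)) Γ' →
    measure (just A ∷ just B ∷ Γ') C < measure Γ C
  <-let {Γ' = Γ'} {x} {A} {B} C s rewrite csize-split s | csize-only x (A ⊗ B) =
    <-via 0 (solve 4 (λ g a b c → (con 1 :+ (a :+ b) :+ g) :+ c := con 1 :+ (((a :+ (b :+ g)) :+ c) :+ con 0)) refl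
      (csize Γ') (tsize A) (tsize B) (tsize C))

  <-pairˡ : ∀ {n} {Γ Γ₁ Γ₂ : Ctx n} A B → Split Γ Γ₁ Γ₂ → measure Γ₁ A < measure Γ (A ⊗ B)
  <-pairˡ {Γ₁ = Γ₁} {Γ₂} A B s rewrite csize-split s =
    <-via (csize Γ₂ + tsize B) (solve 4 (λ g h a b → (g :+ h) :+ (con 1 :+ (a :+ b)) := con 1 :+ ((g :+ a) :+ (h :+ b))) refl
      (csize Γ₁) (csize Γ₂) (tsize A) (tsize B))

  <-pairʳ : ∀ {n} {Γ Γ₁ Γ₂ : Ctx n} A B → Split Γ Γ₁ Γ₂ → measure Γ₂ B < measure Γ (A ⊗ B)
  <-pairʳ {Γ₁ = Γ₁} {Γ₂} A B s rewrite csize-split s =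
    <-via (csize Γ₁ + tsize A) (solve 4 (λ g h a b → (g :+ h) :+ (con 1 :+ (a :+ b)) := con 1 :+ ((h :+ b) :+ (g :+ a))) refl
      (csize Γ₁) (csize Γ₂) (tsize A) (tsize B))

  module _ {n} {Γ Γg Δ₁ Δ₂ : Ctx n} {g X Y} (A : Ty)
    (s : Split Γ Δ₂ Γg) (s' : Split Γg (only g (X ⊸ Y)) Δ₁) where

    -- The goal grows by `Y` and one connective, both of which the removed `X ⊸ Y` pays for.
    -- Strictness is due to the positive size of `X`.
    <-head : measure Δ₂ (Y ⊸ A) < measure Γ A
    <-head rewrite csize-split s | csize-split s' | csize-only g (X ⊸ Y) with tsize-suc X
    ... | x , e rewrite e =
      <-via (x + csize Δ₁) (solve 5 (λ g h x y a → (h :+ ((con 1 :+ ((con 1 :+ x) :+ y)) :+ g)) :+ a :=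
          con 1 :+ ((h :+ (con 1 :+ (y :+ a))) :+ (x :+ g))) refl
        (csize Δ₁) (csize Δ₂) x (tsize Y) (tsize A))

    <-body : measure (just Y ∷ Δ₂) A < measure Γ A
    <-body rewrite csize-split s | csize-split s' | csize-only g (X ⊸ Y) =
      <-via (tsize X + csize Δ₁) (solve 5 (λ g h x y a → (h :+ ((con 1 :+ (x :+ y)) :+ g)) :+ a :=
          con 1 :+ (((y :+ h) :+ a) :+ (x :+ g))) refl
        (csize Δ₁) (csize Δ₂) (tsize X) (tsize Y) (tsize A))

    <-arg : measure Δ₁ X < measure Γ A
    <-arg rewrite csize-split s | csize-split s' | csize-only g (X ⊸ Y) =
      <-via (csize Δ₂ + tsize Y + tsize A) (solve 5 (λ g h x y a → (h :+ ((con 1 :+ (x :+ y)) :+ g)) :+ a :=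
          con 1 :+ ((g :+ x) :+ (h :+ y :+ a))) refl
        (csize Δ₁) (csize Δ₂) (tsize X) (tsize Y) (tsize A))

split-only : ∀ {n} {f g : Fin n} {A B Γ} → Split (only g A) (only f B) Γ → g ≡ f × A ≡ B × Γ ≡ ∅
split-only {f = zero} {zero} (left s) with Split-∅⁻¹ s
... | refl , refl = refl , refl , refl
split-only {f = suc f} {suc g} (none s) with refl , refl , refl ← split-only s = refl , refl , refl
split-only {f = suc f} {zero} (right s) with Split-∅⁻¹ s
... | e , _ = contradiction (Eq.trans (Eq.sym (lookup-only f _)) (Eq.trans (cong (λ Γ → lookup Γ f) e) (lookup-replicate f nothing))) λ ()

split-find : ∀ {n} {f : Fin n} {T Γ Γ' Γ₁ Γ₂} → Split Γ (only f T) Γ' → Split Γ Γ₁ Γ₂ →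
  (∃ λ Γ₁' → Split Γ₁ (only f T) Γ₁' × Split Γ' Γ₁' Γ₂) ⊎
  (∃ λ Γ₂' → Split Γ₂ (only f T) Γ₂' × Split Γ' Γ₁ Γ₂')
split-find {f = zero} (left s) r with Split-∅ˡ⁻¹ s
split-find {f = zero} (left s) (left r)  | refl = inj₁ (-, left (Split-∅ˡ _) , none r)
split-find {f = zero} (left s) (right r) | refl = inj₂ (-, left (Split-∅ˡ _) , none r)
split-find {f = suc f} (none s) (none r) with split-find s r
... | inj₁ (_ , a , b) = inj₁ (-, none a , none b)
... | inj₂ (_ , a , b) = inj₂ (-, none a , none b)
split-find {f = suc f} (right s) (left r) with split-find s r
... | inj₁ (_ , a , b) = inj₁ (-, right a , left b)
... | inj₂ (_ , a , b) = inj₂ (-, none a , left b)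
split-find {f = suc f} (right s) (right r) with split-find s r
... | inj₁ (_ , a , b) = inj₁ (-, none a , right b)
... | inj₂ (_ , a , b) = inj₂ (-, right a , right b)

Each-split : ∀ {c n} {Γ Γ₁ Γ₂ : Ctx n} → Split Γ Γ₁ Γ₂ → Each c Γ → Each c Γ₁ × Each c Γ₂
Each-split [] [] = [] , []
Each-split (none s) (nothing m) with a , b ← Each-split s m = nothing a , nothing b
Each-split (left s) (just _ p m) with a , b ← Each-split s m = just _ p a , nothing b
Each-split (right s) (just _ p m) with a , b ← Each-split s m = nothing a , just _ p b

Each-only : ∀ {c n} (i : Fin n) {A} → Each c (only i A) → ∃ λ b → Mono c b A
Each-only zero (just b p _)  = b , p
Each-only (suc i) (nothing m) = Each-only i m

MonoC-merge : ∀ {c b n} {Γ Γ₁ Γ₂ : Ctx n} → Split Γ Γ₁ Γ₂ → MonoC c b Γ₁ → MonoC c b Γ₂ → MonoC c b Γ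
MonoC-merge [] [] [] = []
MonoC-merge (none s) (nothing p) (nothing q) = nothing (MonoC-merge s p q)
MonoC-merge (left s) (just x p) (nothing q)  = just x (MonoC-merge s p q)
MonoC-merge (right s) (nothing p) (just x q) = just x (MonoC-merge s p q)

MonoC-∅ : ∀ {c b} n → MonoC c b (∅ {n})
MonoC-∅ zero    = []
MonoC-∅ (suc n) = nothing (MonoC-∅ n)

MonoC-only : ∀ {c b n} (i : Fin n) {A} → Mono c b A → MonoC c b (only i A)
MonoC-only zero p    = just p (MonoC-∅ _)
MonoC-only (suc i) p = nothing (MonoC-only i p)

true≢false : ∀ {c A} → Mono c true A → ¬ Mono c false A
true≢false {A = A} p q with () ← Mono-unique A p q

⊢η : ∀ {n} {Γ : Ctx n} {s A B} → Γ ⊢ s ∶ A ⊸ B →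
  (just A ∷ Γ) ⊢ wk₁ s · ` zero ∶ B × Γ ⊢ s ≐ ƛ (wk₁ s · ` zero) ∶ A ⊸ B
⊢η d = e , sym (ax (η _) (⊢lam e) d)
  where e = ⊢app (right (Split-∅ʳ _)) (⊢wk d) (⊢var zero)

Sb-cong : ∀ {n m} {Γ : Ctx n} {σ σ' : Fin n → Tm m} {Δ w} →
  (∀ i {A} → lookup Γ i ≡ just A → σ i ≡ σ' i) → T.Sb Γ σ Δ w → ∃ λ w → T.Sb Γ σ' Δ w
Sb-cong e T.[]           = -, T.[]
Sb-cong e (T.none r)     = -, T.none (proj₂ (Sb-cong (e ∘ suc) r))
Sb-cong e (T.just s j r) =
  -, T.just s (subst (λ t → T.J _ t _) (e zero refl) j) (proj₂ (Sb-cong (e ∘ suc) r))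

split-only-≢ : ∀ {n} {x : Fin n} {A Γ Γ'} → Split Γ (only x A) Γ' → ∀ i {B} → lookup Γ' i ≡ just B → i ≢ x
split-only-≢ {x = zero} (left s) zero () refl
split-only-≢ {x = suc x} s zero e ()
split-only-≢ {x = suc x} (none s) (suc i) e refl  = split-only-≢ s i e refl
split-only-≢ {x = suc x} (right s) (suc i) e refl = split-only-≢ s i e refl

to-front : ∀ {n} → Fin n → Fin n → Fin (suc n)
to-front x i with i Fin.≟ x
... | yes _ = zero
... | no _  = suc i

⊢to-front : ∀ {n} {x : Fin n} {A Γ Γ' s C} → Split Γ (only x A) Γ' → Γ ⊢ s ∶ C →
  (just A ∷ Γ') ⊢ ren (to-front x) s ∶ C
⊢to-front {x = x} {A} {Γ' = Γ'} p d = ⊢ren d (proj₂ (T.Sb-merge p (left (Split-∅ˡ _))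
  (proj₂ (T.Sb-only x (subst (λ i → T.J _ (` i) A) (Eq.sym at-x) (T.var zero))))
  (proj₂ (Sb-cong (λ i e → cong `_ (Eq.sym (off-x i (split-only-≢ p i e)))) (Sb-suc Γ')))))
  where
  at-x : to-front x x ≡ zero
  at-x with x Fin.≟ x
  ... | yes _ = refl
  ... | no ne = contradiction refl ne
  off-x : ∀ i → i ≢ x → to-front x i ≡ suc i
  off-x i ne with i Fin.≟ x
  ... | yes e = contradiction e ne
  ... | no _  = refl

to-front-σ₁ : ∀ {n} (x : Fin n) s → sub (σ₁ (` x)) (ren (to-front x) s) ≡ s
to-front-σ₁ x = sub-ren-id eq
  where
  eq : ∀ i → σ₁ (` x) (to-front x i) ≡ ` i
  eq i with i Fin.≟ x
  ... | yes refl = refl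
  ... | no _     = refl

-- The commuting conversion that floats a let out of an argument position,
-- applied to s = (fn z => s[z/x]) (let val (y,z) = x in (y,z) end).
⊢ηlet : ∀ {n} {x : Fin n} {A B Γ Γ' s C} → Split Γ (only x (A ⊗ B)) Γ' → Γ ⊢ s ∶ C →
  ∃ λ s' → (just A ∷ just B ∷ Γ') ⊢ s' ∶ C × Γ ⊢ s ≐ letp (` x) s' ∶ C
⊢ηlet {x = x} {A} {B} {s = s} p d = _ , ds' ,
  trans (sym (β-to (Split-comm p) df (⊢var x) (to-front-σ₁ x s)))
  (trans (c-app (Split-comm p) (refl (⊢lam df)) (sym (ax (ηlet _) dl (⊢var x))))
         (ax (c-appR _ _ _) (⊢app (Split-comm p) (⊢lam df) dl) (⊢let p (⊢var x) ds')))
  where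
  df = ⊢to-front p d
  dxy : (just A ∷ just B ∷ ∅) ⊢ ⟨ ` zero , ` suc zero ⟩ ∶ A ⊗ B
  dxy = ⊢pair (left (right (Split-∅ˡ _))) (⊢var zero) (⊢var (suc zero))
  dl = ⊢let (Split-∅ʳ _) (⊢var x) dxy
  ds' = ⊢app (right (right (Split-∅ʳ _))) (⊢wk₂ (⊢lam df)) dxy

-- Unlike in `Factor`, the variable `f` is prescribed, and the colours dictate how the other
-- assumptions are divided. This makes the decompositions of two terms comparable.
record Extraction (c : ℕ → Bool) {n} (Γ : Ctx n) (f : Fin n) (X Y : Ty) (Γ' : Ctx n) (s : Tm n) (A : Ty) : Set where
  constructor extraction
  field
    {Γ₁ Γ₂} : Ctx n
    {r k}   : Tm n
    split   : Split Γ' Γ₁ Γ₂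
    mono₁   : MonoC c true Γ₁
    mono₂   : MonoC c false Γ₂
    ⊢r      : Γ₁ ⊢ r ∶ X
    ⊢k      : Γ₂ ⊢ k ∶ Y ⊸ A
    eq      : Γ ⊢ s ≐ k · ((` f) · r) ∶ A

frame-arg : ∀ {n} {Γ Γ₂₃ Γ₂ Γ₃ Δ : Ctx n} {k u w Y C A} → Split Γ Γ₂₃ Δ → Split Γ₂₃ Γ₂ Γ₃ →
  Γ₂ ⊢ k ∶ Y ⊸ C → Γ₃ ⊢ u ∶ C ⊸ A → Δ ⊢ w ∶ Y →
  Γ₂₃ ⊢ ƛ (wk₁ u · (wk₁ k · ` zero)) ∶ Y ⊸ A ×
  Γ ⊢ (ƛ (wk₁ u · (wk₁ k · ` zero))) · w ≐ u · (k · w) ∶ A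
frame-arg {k = k} {u} {w} p q dk du dw = ⊢lam d , β-to p d dw
  (cong₂ (λ a b → b · (a · w)) (sub-wk-id w k) (sub-wk-id w u))
  where d = ⊢app (right (Split-comm q)) (⊢wk du) (⊢app (right (Split-∅ʳ _)) (⊢wk dk) (⊢var zero))

frame-pairˡ : ∀ {n} {Γ Γ₂₃ Γ₂ Γ₃ Δ : Ctx n} {k u w Y C A} → Split Γ Γ₂₃ Δ → Split Γ₂₃ Γ₂ Γ₃ →
  Γ₂ ⊢ k ∶ Y ⊸ C → Γ₃ ⊢ u ∶ A → Δ ⊢ w ∶ Y →
  Γ₂₃ ⊢ ƛ ⟨ wk₁ k · ` zero , wk₁ u ⟩ ∶ Y ⊸ (C ⊗ A) ×
  Γ ⊢ (ƛ ⟨ wk₁ k · ` zero , wk₁ u ⟩) · w ≐ ⟨ k · w , u ⟩ ∶ C ⊗ A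
frame-pairˡ {k = k} {u} {w} p q dk du dw = ⊢lam d , β-to p d dw
  (cong₂ (λ a b → ⟨ a · w , b ⟩) (sub-wk-id w k) (sub-wk-id w u))
  where d = ⊢pair (left q) (⊢app (right (Split-∅ʳ _)) (⊢wk dk) (⊢var zero)) (⊢wk du)

frame-pairʳ : ∀ {n} {Γ Γ₂₃ Γ₂ Γ₃ Δ : Ctx n} {k u w Y C A} → Split Γ Γ₂₃ Δ → Split Γ₂₃ Γ₂ Γ₃ →
  Γ₂ ⊢ k ∶ Y ⊸ C → Γ₃ ⊢ u ∶ A → Δ ⊢ w ∶ Y →
  Γ₂₃ ⊢ ƛ ⟨ wk₁ u , wk₁ k · ` zero ⟩ ∶ Y ⊸ (A ⊗ C) ×
  Γ ⊢ (ƛ ⟨ wk₁ u , wk₁ k · ` zero ⟩) · w ≐ ⟨ u , k · w ⟩ ∶ A ⊗ C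
frame-pairʳ {k = k} {u} {w} p q dk du dw = ⊢lam d , β-to p d dw
  (cong₂ (λ a b → ⟨ b , a · w ⟩) (sub-wk-id w k) (sub-wk-id w u))
  where d = ⊢pair (right (Split-comm q)) (⊢wk du) (⊢app (right (Split-∅ʳ _)) (⊢wk dk) (⊢var zero))

extraction-frame : ∀ {c n} {Γ Γ' Γa Γa' Γr : Ctx n} {f X Y t s A B} →
  Split Γ (only f (X ⊸ Y)) Γ' → Split Γ' Γa' Γr → MonoC c false Γr →
  (E : Extraction c Γa f X Y Γa' t B) →
  (∀ {Γ₂₃ Δ w} → Split Γ Γ₂₃ Δ → Split Γ₂₃ (Extraction.Γ₂ E) Γr → Δ ⊢ w ∶ Y →
    Γa ⊢ t ≐ Extraction.k E · w ∶ B → ∃ λ k → Γ₂₃ ⊢ k ∶ Y ⊸ A × Γ ⊢ s ≐ k · w ∶ A) →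
  Extraction c Γ f X Y Γ' s A
extraction-frame pf p m (extraction sp m₁ m₂ dr dk q) frame
  with _ , a , b ← Split-assocʳ p sp
  with _ , x , y ← Split-assocˡ pf a
  with _ , dk' , q' ← frame (Split-comm x) b (⊢app y (⊢var _) dr) q =
  extraction a m₁ (MonoC-merge b m₂ m) dr dk' q'

Extraction-≐ : ∀ {c n} {Γ Γ' : Ctx n} {f X Y s s' A} → Γ ⊢ s ≐ s' ∶ A →
  Extraction c Γ f X Y Γ' s' A → Extraction c Γ f X Y Γ' s A
Extraction-≐ p (extraction a b c d e q) = extraction a b c d e (trans p q)

-- The bound variable has colour `false`, so it belongs to the continuation. The argument `r` does
-- not depend on it and can leave the abstraction.
extraction-lam : ∀ {c n} {Γ Γ' : Ctx n} {f X Y s A B} → Split Γ (only f (X ⊸ Y)) Γ' → Mono c false A →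
  Extraction c (just A ∷ Γ) (suc f) X Y (just A ∷ Γ') s B →
  Extraction c Γ f X Y Γ' (ƛ s) (A ⊸ B)
extraction-lam {A = A} pf ma (extraction (left sp) (just p _) m₂ dr dk q) = ⊥-elim (true≢false {A = A} p ma)
extraction-lam {f = f} pf ma (extraction {k = k} (right sp) (nothing m₁) (just _ m₂) dr dk q)
  with r , refl , dr' ← strengthen dr
  with _ , x , y ← Split-assocˡ pf sp =
  extraction sp m₁ m₂ dr' (⊢lam (⊢lam db))
    (trans (c-lam q) (sym (β-to (Split-comm x) (⊢lam db) (⊢app y (⊢var f) dr')
      (cong (λ t → ƛ (t · (` suc f · wk₁ r))) (sub-ren-id (λ { zero → refl ; (suc i) → refl }) k)))))
  where
  db = ⊢app (left (right (Split-∅ʳ _))) (⊢ren dk (T.Sb-extʳ (Sb-suc _))) (⊢var (suc zero))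

-- Both components inherit the colour of the tensor and land on one side. The let follows them by
-- commuting conversions: into `r` for `true`, into `k` for `false`.
extraction-let : ∀ {c b n} {Γ Γ' Γx Γx' : Ctx n} {f x A B X Y s C} →
  Split Γ (only x (A ⊗ B)) Γx → Split Γ (only f (X ⊸ Y)) Γ' →
  Split Γx (only f (X ⊸ Y)) Γx' → Split Γ' (only x (A ⊗ B)) Γx' →
  Mono c b (A ⊗ B) →
  Extraction c (just A ∷ just B ∷ Γx) (suc (suc f)) X Y (just A ∷ just B ∷ Γx') s C →
  Extraction c Γ f X Y Γ' (letp (` x) s) C
extraction-let {f = f} {x} {A} px pf pf' px' m
  (extraction (left (left sp)) (just pA (just _ m₁)) (nothing (nothing m₂)) dr dk q)
  with refl ← Mono-unique A (proj₁ m) pA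
  with k , refl , dk' ← strengthen₂ dk
  with _ , a , b ← Split-assocˡ px' sp
  with _ , a₁ , b₁ ← Split-assocˡ pf a
  with _ , a₂ , b₂ ← Split-exchange b₁ b =
  extraction a (MonoC-merge b (MonoC-only x m) m₁) m₂ (⊢let b (⊢var x) dr) dk'
    (trans (c-let px (refl (⊢var x)) q)
    (trans (sym (ax (c-appR _ _ _) (⊢app (Split-comm a₁) dk' dl) (⊢let px (⊢var x) (≐-type₂ q))))
           (c-app (Split-comm a₁) (refl dk')
             (sym (ax (c-appR _ _ _) (⊢app b₁ (⊢var f) (⊢let b (⊢var x) dr)) dl)))))
  where
  dl = ⊢let a₂ (⊢var x) (⊢app (right (right b₂)) (⊢var (suc (suc f))) dr)
extraction-let {f = f} {x} {A} px pf pf' px' m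
  (extraction (right (right sp)) (nothing (nothing m₁)) (just pA (just _ m₂)) dr dk q)
  with refl ← Mono-unique A (proj₁ m) pA
  with r , refl , dr' ← strengthen₂ dr
  with _ , a , b ← Split-exchange px' sp
  with _ , a₁ , b₁ ← Split-assocˡ pf a =
  extraction a m₁ (MonoC-merge b (MonoC-only x m) m₂) dr' dk'
    (trans (c-let px (refl (⊢var x)) q)
           (sym (ax (c-appL _ _ _) (⊢app (Split-comm a₁) dk' (⊢app b₁ (⊢var f) dr')) (⊢let px (⊢var x) (≐-type₂ q)))))
  where
  dk' = ⊢let b (⊢var x) dk
extraction-let {A = A} {B} _ _ _ _ (m , m') (extraction (left (right _)) (just p _) (nothing (just p' _)) _ _ _)
  with () ← Eq.trans (Mono-unique A p m) (Mono-unique B m' p')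
extraction-let {A = A} {B} _ _ _ _ (m , m') (extraction (right (left _)) (nothing (just p' _)) (just p _) _ _ _)
  with () ← Eq.trans (Mono-unique A p m) (Mono-unique B m' p')

-- The block `w` of colour `true` is replaced by a variable for the recursive extraction. By its
-- colour the variable ends up in `r`, where `w` is substituted back.
extraction-body : ∀ {c n} {Γ Γ' Γg Δ₂ Δ₂' : Ctx n} {f X Y h w Z A} → Split Γ (only f (X ⊸ Y)) Γ' →
  Split Γ Δ₂ Γg → Split Γ' Δ₂' Γg → MonoC c true Γg → Mono c true Z →
  Δ₂ ⊢ h ∶ Z ⊸ A → Γg ⊢ w ∶ Z →
  Extraction c (just Z ∷ Δ₂) (suc f) X Y (just Z ∷ Δ₂') (wk₁ h · ` zero) A →
  Extraction c Γ f X Y Γ' (h · w) A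
extraction-body {Z = Z} pf p p' mg mz dh dw (extraction (right sp) (nothing _) (just q _) _ _ _) =
  ⊥-elim (true≢false {A = Z} mz q)
extraction-body {f = f} {w = w} pf p p' mg mz dh dw (extraction {r = r} (left sp) (just _ m₁) (nothing m₂) dr dk q)
  with k , refl , dk' ← strengthen dk
  with _ , a , b ← Split-assocˡ (Split-comm p') sp
  with _ , a₁ , b₁ ← Split-assocˡ pf a
  with _ , h≐ ← ⊢η dh =
  extraction a (MonoC-merge b mg m₁) m₂ (⊢sub dr (T.Sb-σ₁ (Split-comm b) (toJ dw))) dk'
    (trans (c-app p (trans h≐ (c-lam q)) (refl dw))
      (β-to p (≐-type₂ q) dw (cong (λ z → z · (` f · sub (σ₁ w) r)) (sub-wk-id w k))))

-- Apart from `f`, no assumption mixes colours, so `f` is the only passage from the `true` part to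
-- the `false` goal. At each head, `connected` shows that the pieces without `f` have a single
-- colour and can be assigned to one side.
extract : ∀ N {c n} {Γ Γ' : Ctx n} {f X Y s A} → measure Γ A < N →
  Split Γ (only f (X ⊸ Y)) Γ' → Each c Γ' → Mono c true X → Mono c false Y → Mono c false A →
  Γ ⊢ s ∶ A → Extraction c Γ f X Y Γ' s A
extract-focused : ∀ N {c n} {Γ Γ' : Ctx n} {f X Y s A} → measure Γ A < suc N →
  Split Γ (only f (X ⊸ Y)) Γ' → Each c Γ' → Mono c true X → Mono c false Y → Mono c false A →
  (∀ {A₁ A₂} → A ≢ A₁ ⊸ A₂) → Γ ⊢ s ∶ A → Extraction c Γ f X Y Γ' s A
extract-app : ∀ N {c n} {Γ Γ' Γg Δ₁ Δ₂ : Ctx n} {f g X Y Z W h r A} → measure Γ A < suc N →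
  Split Γ (only f (X ⊸ Y)) Γ' → Each c Γ' → Mono c true X → Mono c false Y → Mono c false A →
  Split Γ Δ₂ Γg → Split Γg (only g (Z ⊸ W)) Δ₁ → Δ₂ ⊢ h ∶ W ⊸ A → Δ₁ ⊢ r ∶ Z →
  Extraction c Γ f X Y Γ' (h · (` g · r)) A

extract (suc N) {Γ = Γ} {A = A ⊸ B} z pf ms mx my (ma , mb) d with e , q ← ⊢η d =
  Extraction-≐ q (extraction-lam pf ma
    (extract N (≤-trans (<-lam Γ A B) (s≤s⁻¹ z)) (right pf) (just false ma ms) mx my mb e))
extract (suc N) {A = tvar _} z pf ms mx my ma d = extract-focused N z pf ms mx my ma (λ ()) d
extract (suc N) {A = _ ⊗ _} z pf ms mx my ma d = extract-focused N z pf ms mx my ma (λ ()) d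

extract-focused N {Γ = Γ} {A = C} z pf ms mx my ma na d with tensor? Γ
extract-focused N {A = C} z pf ms mx my ma na d | inj₁ (x , A , B , Γx , px) with split-find pf px
... | inj₁ (_ , p , _) with () ← proj₁ (proj₂ (split-only p))
... | inj₂ (Γx' , pfx , p) with b , m ← Each-only x (proj₁ (Each-split p ms)) | _ , e , q ← ⊢ηlet px d =
  Extraction-≐ q (extraction-let px pf pfx p m
    (extract N (≤-trans (<-let C px) (s≤s⁻¹ z)) (right (right pfx))
      (just b (proj₁ m) (just b (proj₂ m) (proj₂ (Each-split p ms)))) mx my ma e))
extract-focused N {A = C} z pf ms mx my ma na d | inj₂ nt with head _ (s≤s ≤-refl) nt d
... | var x refl q with refl , refl , refl ← split-only pf = ⊥-elim (na refl)
... | lam _ _ = ⊥-elim (na refl)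
... | spine (factor _ _ _ _ q) with ⊢app p dh (⊢app p' (⊢var g) dr) ← ≐-type₂ q =
  Extraction-≐ q (extract-app N z pf ms mx my ma p p' dh dr)
... | pair {A} {B} q _ with ⊢pair p da db ← ≐-type₂ q with split-find pf p
...   | inj₁ (_ , pa , p') with msa , msb ← Each-split p' ms =
  let E = extract N (≤-trans (<-pairˡ A B p) (s≤s⁻¹ z)) pa msa mx my (proj₁ ma) da
  in Extraction-≐ q (extraction-frame pf p' (connected _ false msb (proj₂ ma) db) E
    λ x y dw e → let dk , e' = frame-pairˡ x y (Extraction.⊢k E) db dw
                 in -, dk , trans (c-pair p e (refl db)) (sym e'))
...   | inj₂ (_ , pb , p') with msa , msb ← Each-split p' ms =
  let E = extract N (≤-trans (<-pairʳ A B p) (s≤s⁻¹ z)) pb msb mx my (proj₂ ma) db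
  in Extraction-≐ q (extraction-frame pf (Split-comm p') (connected _ false msa (proj₁ ma) da) E
    λ x y dw e → let dk , e' = frame-pairʳ x y (Extraction.⊢k E) da dw
                 in -, dk , trans (c-pair p (refl da) e) (sym e'))

extract-app N {A = A} z pf ms mx my ma p p' dh dr with split-find pf p
... | inj₁ (_ , pf₂ , q) with ms₂ , msg ← Each-split q ms
  with msg' , ms₁ ← Each-split p' msg with Each-only _ msg'
-- With a `false` head `g`, the block `g · r` is `false` throughout and joins the continuation,
-- while `f` is extracted from `h`.
...   | false , mz , mw =
  let E = extract N (≤-trans (<-head A p p') (s≤s⁻¹ z)) pf₂ ms₂ mx my (mw , ma) dh
      dw = ⊢app p' (⊢var _) dr
  in extraction-frame pf q (MonoC-merge p' (MonoC-only _ (mz , mw)) (connected _ false ms₁ mz dr)) E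
    λ x y dw' e → let dk , e' = frame-app x y (Extraction.⊢k E) dw dw'
                  in -, dk , trans (c-app p e (refl dw)) (sym e')
-- With a `true` head, the block `g · r` belongs inside the argument of `f`, although it stands
-- outside.
...   | true , mz , mw =
  extraction-body pf p q (MonoC-merge p' (MonoC-only _ (mz , mw)) (connected _ true ms₁ mz dr)) mw dh
    (⊢app p' (⊢var _) dr)
    (extract N (≤-trans (<-body A p p') (s≤s⁻¹ z)) (right pf₂) (just true mw ms₂) mx my ma (proj₁ (⊢η dh)))
extract-app N {A = A} z pf ms mx my ma p p' dh dr | inj₂ (_ , pfg , q) with ms₂ , msg ← Each-split q ms with split-find pfg p'
-- The head is `f` itself, and connectedness shows that the existing split already follows the
-- colours.
... | inj₁ (_ , e , q') with refl , refl , refl ← split-only e with refl ← Split-∅ˡ⁻¹ q' =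
  extraction (Split-comm q) (connected _ true msg mx dr) (connected _ false ms₂ (my , ma) dh) dr dh
    (refl (⊢app p dh (⊢app p' (⊢var _) dr)))
... | inj₂ (_ , pf₁ , q') with msg' , ms₁ ← Each-split q' msg with Each-only _ msg'
...   | false , mz , mw =
  let E = extract N (≤-trans (<-arg A p p') (s≤s⁻¹ z)) pf₁ ms₁ mx my mz dr
      F = extraction-frame pfg (Split-comm q') (MonoC-only _ (mz , mw)) E
            λ x y dw e → let dk , e' = frame-arg x y (Extraction.⊢k E) (⊢var _) dw
                         in -, dk , trans (c-app p' (refl (⊢var _)) e) (sym e')
  in extraction-frame pf (Split-comm q) (connected _ false ms₂ (mw , ma) dh) F
    λ x y dw e → let dk , e' = frame-arg x y (Extraction.⊢k F) dh dw
                 in -, dk , trans (c-app p (refl dh) e) (sym e')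
-- Here `h` would turn an assumption of colour `true` into the `false` goal, contrary to
-- connectedness.
...   | true , mz , mw with just mw' _ ← connected _ false (just true mw ms₂) ma (proj₁ (⊢η dh)) =
  ⊥-elim (true≢false mw mw')

-- Coherence

AllAtoms : (ℕ → Bool) → Bool → List Lit → Set
AllAtoms c v xs = ∀ b a → 1 ≤ # (b , a) xs → c a ≡ v

AllAtoms-++ : ∀ {c v} xs ys → AllAtoms c v (xs ++ ys) → AllAtoms c v xs × AllAtoms c v ys
AllAtoms-++ xs ys f =
  (λ b a p → f b a (≤-trans p (≤-trans (m≤m+n _ _) (≤-reflexive (Eq.sym (#-++ _ xs ys)))))) ,
  (λ b a p → f b a (≤-trans p (≤-trans (m≤n+m _ _) (≤-reflexive (Eq.sym (#-++ _ xs ys))))))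

AllAtoms-Mono : ∀ {c v} b A → AllAtoms c v (occ b A) → Mono c v A
AllAtoms-Mono b (tvar x) f = f b x (≤-trans (≤-reflexive (Eq.sym (δ-refl (b , x)))) (m≤m+n _ _))
AllAtoms-Mono b (A ⊗ B) f with g , h ← AllAtoms-++ (occ b A) _ f = AllAtoms-Mono b A g , AllAtoms-Mono b B h
AllAtoms-Mono b (A ⊸ B) f with g , h ← AllAtoms-++ (occ (not b) A) _ f =
  AllAtoms-Mono (not b) A g , AllAtoms-Mono b B h

AllAtoms-MonoC : ∀ {c v n} (Γ : Ctx n) → AllAtoms c v (occC Γ) → MonoC c v Γ
AllAtoms-MonoC [] f            = []
AllAtoms-MonoC (nothing ∷ Γ) f = nothing (AllAtoms-MonoC Γ f)
AllAtoms-MonoC (just A ∷ Γ) f with g , h ← AllAtoms-++ (occ false A) _ f =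
  just (AllAtoms-Mono false A g) (AllAtoms-MonoC Γ h)

AllAtoms-seq : ∀ {c v n} (Γ : Ctx n) A → AllAtoms c v (seq Γ A) → MonoC c v Γ × Mono c v A
AllAtoms-seq Γ A f with g , h ← AllAtoms-++ (occC Γ) _ f = AllAtoms-MonoC Γ g , AllAtoms-Mono true A h

positive : ℕ → Bool
positive zero    = false
positive (suc _) = true

-- In a balanced list a name occurs at all only if it occurs positively, so counting positive
-- occurrences recognizes the names of `xs`.
colour : List Lit → ℕ → Bool
colour xs a = positive (# (true , a) xs)

colour-in : ∀ xs → Balanced xs → AllAtoms (colour xs) true xs
colour-in xs e true a p with suc _ ← # (true , a) xs = refl
colour-in xs e false a p rewrite e a with suc _ ← # (false , a) xs = refl

colour-out : ∀ xs ys → Balanced xs → Lin1 (xs ++ ys) → AllAtoms (colour xs) false ys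
colour-out xs ys e l b a p = cong positive (go b (n≤0⇒n≡0 (s≤s⁻¹
  (≤-trans (≤-trans (≤-reflexive (+-comm 1 _)) (+-monoʳ-≤ (# (b , a) xs) p))
    (≤-trans (≤-reflexive (Eq.sym (#-++ _ xs ys))) (l (b , a)))))))
  where
  go : ∀ b → # (b , a) xs ≡ 0 → # (true , a) xs ≡ 0
  go true q  = q
  go false q = Eq.trans (e a) q

Mono-split-unique : ∀ {c n} {Γ Γ₁ Γ₂ Δ₁ Δ₂ : Ctx n} → Split Γ Γ₁ Γ₂ → Split Γ Δ₁ Δ₂ →
  MonoC c true Γ₁ → MonoC c false Γ₂ → MonoC c true Δ₁ → MonoC c false Δ₂ → Γ₁ ≡ Δ₁ × Γ₂ ≡ Δ₂
Mono-split-unique [] [] _ _ _ _ = refl , refl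
Mono-split-unique (none s) (none r) (nothing a) (nothing b) (nothing c) (nothing d)
  with refl , refl ← Mono-split-unique s r a b c d = refl , refl
Mono-split-unique (left s) (left r) (just _ a) (nothing b) (just _ c) (nothing d)
  with refl , refl ← Mono-split-unique s r a b c d = refl , refl
Mono-split-unique (right s) (right r) (nothing a) (just _ b) (nothing c) (just _ d)
  with refl , refl ← Mono-split-unique s r a b c d = refl , refl
Mono-split-unique (left {A = A} s) (right r) (just p _) _ _ (just q _) = ⊥-elim (true≢false {A = A} p q)
Mono-split-unique (right {A = A} s) (left r) _ (just p _) (just q _) _ = ⊥-elim (true≢false {A = A} q p)

Each-merge : ∀ {c b b' n} {Γ Γ₁ Γ₂ : Ctx n} → Split Γ Γ₁ Γ₂ → MonoC c b Γ₁ → MonoC c b' Γ₂ → Each c Γ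
Each-merge [] [] []                            = []
Each-merge (none s) (nothing p) (nothing q)  = nothing (Each-merge s p q)
Each-merge (left s) (just x p) (nothing q)   = just _ x (Each-merge s p q)
Each-merge (right s) (nothing p) (just x q)  = just _ x (Each-merge s p q)

Lin1-++ˡ : ∀ xs ys → Lin1 (xs ++ ys) → Lin1 xs
Lin1-++ˡ xs ys = Lin1-++ʳ ys xs ∘ Lin1-≈ (≈-comm xs ys)

-- η-expansion and the splitting of tensors apply to both terms alike, so only heads can differ. The
-- first premise of one term is balanced and thus uses up its names by linearity; colouring these
-- names forces the other term to divide the context in the same way.
coherent : ∀ N {n} {Γ : Ctx n} {s t A} → measure Γ A < N → Linear Γ A →
  Γ ⊢ s ∶ A → Γ ⊢ t ∶ A → Γ ⊢ s ≐ t ∶ A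
coherent-focused : ∀ N {n} {Γ : Ctx n} {s t A} → measure Γ A < suc N → Linear Γ A →
  (∀ {A₁ A₂} → A ≢ A₁ ⊸ A₂) → Γ ⊢ s ∶ A → Γ ⊢ t ∶ A → Γ ⊢ s ≐ t ∶ A
coherent-spine : ∀ N {n} {Γ : Ctx n} {s t A} → measure Γ A < suc N → Linear Γ A →
  Factor Γ s A → Γ ⊢ t ∶ A → Γ ⊢ s ≐ t ∶ A

coherent (suc N) {Γ = Γ} {A = A ⊸ B} z l d e with d' , p ← ⊢η d | e' , q ← ⊢η e =
  trans p (trans (c-lam (coherent N (≤-trans (<-lam Γ A B) (s≤s⁻¹ z))
    (Lin1-≈ (permute 3 (λ g a b → g ⊕ (a ⊕ b) ⊜ (a ⊕ g) ⊕ b) ≈-refl (occC Γ) (occ false A) (occ true B)) l) d' e'))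
    (sym q))
coherent (suc N) {A = tvar _} z l d e = coherent-focused N z l (λ ()) d e
coherent (suc N) {A = _ ⊗ _} z l d e = coherent-focused N z l (λ ()) d e

coherent-focused N {Γ = Γ} {A = C} z l na d e with tensor? Γ
... | inj₁ (x , A , B , Γx , px) with _ , d' , p ← ⊢ηlet px d | _ , e' , q ← ⊢ηlet px e =
  trans p (trans (c-let px (refl (⊢var x)) (coherent N (≤-trans (<-let C px) (s≤s⁻¹ z))
    (Lin1-≈ (≈-trans (≈-++ (≈-trans (occC-split px) (≈-++ (occC-only x (A ⊗ B)) ≈-refl)) ≈-refl)
       (permute 4 (λ a b g c → ((a ⊕ b) ⊕ g) ⊕ c ⊜ (a ⊕ (b ⊕ g)) ⊕ c) ≈-refl
         (occ false A) (occ false B) (occC Γx) (occ true C))) l) d' e'))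
    (sym q))
... | inj₂ nt with head _ (s≤s ≤-refl) nt d | head _ (s≤s ≤-refl) nt e
...   | lam _ _  | _       = ⊥-elim (na refl)
...   | _        | lam _ _ = ⊥-elim (na refl)
...   | spine F  | _       = coherent-spine N z l F e
...   | _        | spine F = sym (coherent-spine N z l F d)
...   | var x refl _ | pair _ _ = ⊥-elim (nt (Split-∅ʳ _))
...   | pair _ _ | var x refl _ = ⊥-elim (nt (Split-∅ʳ _))
...   | var x refl p | var y eq q
  with refl , _ ← split-only (subst (λ Δ → Split Δ (only y C) ∅) (Eq.sym eq) (Split-∅ʳ _)) = trans p (sym q)
coherent-focused N {A = A ⊗ B} z l na d e | inj₂ nt | pair p _ | pair q _
  with ⊢pair {Γ₁ = Γa} {Γb} s da db ← ≐-type₂ p | ⊢pair s' da' db' ← ≐-type₂ q =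
  trans p (trans (go (Mono-split-unique s s' ma mb
    (connected c true (proj₁ msd) mA da') (connected c false (proj₂ msd) mB db'))) (sym q))
  where
  l' : Lin1 (seq Γa A ++ seq Γb B)
  l' = Lin1-≈ (≈-trans (≈-++ (occC-split s) ≈-refl)
    (permute 4 (λ a b c d → (a ⊕ c) ⊕ (b ⊕ d) ⊜ (a ⊕ b) ⊕ (c ⊕ d)) ≈-refl (occC Γa) (occ true A) (occC Γb) (occ true B))) l
  c = colour (seq Γa A)
  in' = AllAtoms-seq Γa A (colour-in (seq Γa A) (balanced da))
  out' = AllAtoms-seq Γb B (colour-out (seq Γa A) (seq Γb B) (balanced da) l')
  ma = proj₁ in' ; mA = proj₂ in' ; mb = proj₁ out' ; mB = proj₂ out'
  msd = Each-split s' (Each-merge s ma mb)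
  go : (Γa ≡ _ × Γb ≡ _) → _
  go (refl , refl) = c-pair s
    (coherent N (≤-trans (<-pairˡ A B s) (s≤s⁻¹ z)) (Lin1-++ˡ (seq Γa A) (seq Γb B) l') da da')
    (coherent N (≤-trans (<-pairʳ A B s) (s≤s⁻¹ z)) (Lin1-++ʳ (seq Γa A) (seq Γb B) l') db db')

coherent-spine N {Γ = Γ} {A = A} z l (factor {f} {X} {Y} {Γ'} {Γ₁} {Γ₂} {r} {k} pf sp dr dk q) e =
  trans q (finish (extract (suc N) z pf (Each-merge sp m₁ m₂) mX (proj₁ mYA) (proj₂ mYA) e))
  where
  l' : Lin1 (seq Γ₁ X ++ seq Γ₂ (Y ⊸ A))
  l' = Lin1-≈ (≈-trans (≈-++ (≈-trans (occC-split pf) (≈-++ (occC-only f (X ⊸ Y)) (occC-split sp))) ≈-refl)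
    (permute 5 (λ x y g h a → ((x ⊕ y) ⊕ (g ⊕ h)) ⊕ a ⊜ (g ⊕ x) ⊕ (h ⊕ (y ⊕ a))) ≈-refl
      (occ true X) (occ false Y) (occC Γ₁) (occC Γ₂) (occ true A))) l
  c = colour (seq Γ₁ X)
  in' = AllAtoms-seq Γ₁ X (colour-in (seq Γ₁ X) (balanced dr))
  out' = AllAtoms-seq Γ₂ (Y ⊸ A) (colour-out (seq Γ₁ X) (seq Γ₂ (Y ⊸ A)) (balanced dr) l')
  m₁ = proj₁ in' ; mX = proj₂ in' ; m₂ = proj₁ out' ; mYA = proj₂ out'
  finish : ∀ {t} → Extraction c Γ f X Y Γ' t A → Γ ⊢ k · (` f · r) ≐ t ∶ A
  finish (extraction sp' m₁' m₂' dr' dk' q')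
    with refl , refl ← Mono-split-unique sp sp' m₁ m₂ m₁' m₂'
    with _ , a , b ← Split-assocˡ pf sp =
    trans (c-app (Split-comm a)
      (coherent N (≤-trans (<-head A (Split-comm a) b) (s≤s⁻¹ z)) (Lin1-++ʳ (seq Γ₁ X) (seq Γ₂ (Y ⊸ A)) l') dk dk')
      (c-app b (refl (⊢var f))
        (coherent N (≤-trans (<-arg A (Split-comm a) b) (s≤s⁻¹ z)) (Lin1-++ˡ (seq Γ₁ X) (seq Γ₂ (Y ⊸ A)) l') dr dr')))
      (sym q')

-- Comparing two linkings

#-∈ : ∀ {ρ b x xs} → (b , x) ∈ xs → 1 ≤ # (b , ρ x) (renL ρ xs)
#-∈ {ρ} {b} {x} (here refl) = ≤-trans (≤-reflexive (Eq.sym (δ-refl (b , ρ x)))) (m≤m+n _ _)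
#-∈ {ρ} (there i) = ≤-trans (#-∈ {ρ} i) (m≤n+m _ _)

#-∈₂ : ∀ {ρ b x y xs} → x ≢ y → ρ x ≡ ρ y → (b , x) ∈ xs → (b , y) ∈ xs → 2 ≤ # (b , ρ x) (renL ρ xs)
#-∈₂ ne e (here refl) (here refl) = contradiction refl ne
#-∈₂ {ρ} {b} {x} ne e (here refl) (there j) rewrite e =
  +-mono-≤ (≤-reflexive (Eq.sym (δ-refl (b , ρ _)))) (#-∈ {ρ} j)
#-∈₂ {ρ} {b} {x} ne e (there i) (here refl) =
  +-mono-≤ (≤-reflexive (Eq.sym (Eq.trans (cong (λ z → δ (b , z) (b , ρ _)) e) (δ-refl (b , ρ _))))) (#-∈ {ρ} i)
#-∈₂ {ρ} ne e (there i) (there j) = ≤-trans (#-∈₂ {ρ} ne e i j) (m≤n+m _ _)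

Lin1-inj : ∀ {ρ xs} → Lin1 (renL ρ xs) → ∀ {b x y} → (b , x) ∈ xs → (b , y) ∈ xs → ρ x ≡ ρ y → x ≡ y
Lin1-inj {ρ} l {b} {x} {y} i j e with x ≟ y
... | yes p = p
... | no ne with s≤s () ← ≤-trans (#-∈₂ {ρ} ne e i j) (l (b , ρ x))

δ-≤ : ∀ (ρ : ℕ → ℕ) b x b' y → δ (b , x) (b' , y) ≤ δ (b , ρ x) (b' , ρ y)
δ-≤ ρ b x b' y with (b , x) ≟ˡ (b' , y)
... | yes refl = ≤-reflexive (Eq.sym (δ-refl (b , ρ x)))
... | no _     = z≤n

#-≤ : ∀ ρ b x xs → # (b , x) xs ≤ # (b , ρ x) (renL ρ xs)
#-≤ ρ b x []              = z≤n
#-≤ ρ b x ((b' , y) ∷ xs) = +-mono-≤ (δ-≤ ρ b x b' y) (#-≤ ρ b x xs)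

#-unique : ∀ {ρ b x xs} → Lin1 (renL ρ xs) → (b , x) ∈ xs → # (b , x) xs ≡ 1
#-unique {ρ} {b} {x} {xs} l i = ≤-antisym (≤-trans (#-≤ ρ b x xs) (l (b , ρ x)))
  (≤-trans (#-∈ {id} i) (≤-reflexive (cong (# (b , x)) (map-id xs))))

∈-# : ∀ ρ b a xs → 1 ≤ # (b , a) (renL ρ xs) → ∃ λ x → (b , x) ∈ xs × ρ x ≡ a
∈-# ρ b a ((b' , x) ∷ xs) p with (b , a) ≟ˡ (b' , ρ x)
... | yes refl = x , here refl , refl
... | no _ with y , i , e ← ∈-# ρ b a xs p = y , there i , e

Agree Disagree : (ρ₁ ρ₂ : ℕ → ℕ) → Lit → Lit → Set
Agree ρ₁ ρ₂ (b , x) (b' , y) = b ≡ false → b' ≡ true → ρ₁ y ≡ ρ₁ x → ρ₂ y ≡ ρ₂ x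
Disagree ρ₁ ρ₂ (b , x) (b' , y) = b ≡ false × b' ≡ true × ρ₁ y ≡ ρ₁ x × ρ₂ y ≢ ρ₂ x

agree? : ∀ ρ₁ ρ₂ l l' → Agree ρ₁ ρ₂ l l' ⊎ Disagree ρ₁ ρ₂ l l'
agree? ρ₁ ρ₂ (true , x) l'          = inj₁ λ ()
agree? ρ₁ ρ₂ (false , x) (false , y) = inj₁ λ _ ()
agree? ρ₁ ρ₂ (false , x) (true , y) with ρ₁ y ≟ ρ₁ x | ρ₂ y ≟ ρ₂ x
... | no ne | _     = inj₁ λ _ _ e → contradiction e ne
... | yes _ | yes e = inj₁ λ _ _ _ → e
... | yes e | no ne = inj₂ (refl , refl , e , ne)

-- The renaming κ with ρ₂ = κ ∘ ρ₁ (if there is one); 0 is a junk value.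
transfer : (ρ₁ ρ₂ : ℕ → ℕ) → List Lit → ℕ → ℕ
transfer ρ₁ ρ₂ [] a = 0
transfer ρ₁ ρ₂ ((false , x) ∷ xs) a = transfer ρ₁ ρ₂ xs a
transfer ρ₁ ρ₂ ((true , x) ∷ xs) a with ρ₁ x ≟ a
... | yes _ = ρ₂ x
... | no _  = transfer ρ₁ ρ₂ xs a

transfer-∈ : ∀ ρ₁ ρ₂ xs a {x} → (true , x) ∈ xs → ρ₁ x ≡ a →
  ∃ λ y → (true , y) ∈ xs × ρ₁ y ≡ a × transfer ρ₁ ρ₂ xs a ≡ ρ₂ y
transfer-∈ ρ₁ ρ₂ ((false , y) ∷ xs) a (there i) e with z , j , p ← transfer-∈ ρ₁ ρ₂ xs a i e = z , there j , p
transfer-∈ ρ₁ ρ₂ ((true , y) ∷ xs) a i e with ρ₁ y ≟ a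
... | yes p = y , here refl , p , refl
transfer-∈ ρ₁ ρ₂ ((true , y) ∷ xs) a (here refl) e | no ne = contradiction e ne
transfer-∈ ρ₁ ρ₂ ((true , y) ∷ xs) a (there i) e | no ne with z , j , p ← transfer-∈ ρ₁ ρ₂ xs a i e = z , there j , p

⟪⟫ᵛ-cong : ∀ {f g : ℕ → ℕ} b A → (∀ {b' x} → (b' , x) ∈ occ b A → f x ≡ g x) → A ⟪ f ⟫ᵛ ≡ A ⟪ g ⟫ᵛ
⟪⟫ᵛ-cong b (tvar x) e = cong tvar (e (here refl))
⟪⟫ᵛ-cong b (A ⊗ B) e =
  cong₂ _⊗_ (⟪⟫ᵛ-cong b A (e ∘ ∈-++⁺ˡ)) (⟪⟫ᵛ-cong b B (e ∘ ∈-++⁺ʳ (occ b A)))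
⟪⟫ᵛ-cong b (A ⊸ B) e =
  cong₂ _⊸_ (⟪⟫ᵛ-cong (not b) A (e ∘ ∈-++⁺ˡ)) (⟪⟫ᵛ-cong b B (e ∘ ∈-++⁺ʳ (occ (not b) A)))

-- One inclusion suffices: if each link under `ρ₁` is also one under `ρ₂`, then `κ` can be read off
-- the positive atoms. It is right on negative atoms too, because balance gives each of them a
-- positive partner.
compare : ∀ S (ρ₁ ρ₂ : ℕ → ℕ) → Lin1 (renL ρ₁ (occ true S)) → Balanced (renL ρ₁ (occ true S)) →
  (∃ λ κ → S ⟪ ρ₁ ⟫ᵛ ⟪ κ ⟫ᵛ ≡ S ⟪ ρ₂ ⟫ᵛ) ⊎
  (∃₂ λ n p → (false , n) ∈ occ true S × (true , p) ∈ occ true S × ρ₁ p ≡ ρ₁ n × ρ₂ p ≢ ρ₂ n)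
compare S ρ₁ ρ₂ l bal with All.decide (λ n → All.decide (agree? ρ₁ ρ₂ n) (occ true S)) (occ true S)
... | inj₂ any with (_ , n) , n∈ , any' ← find any with (_ , p) , p∈ , refl , refl , e , ne ← find any' =
  inj₂ (n , p , n∈ , p∈ , e , ne)
... | inj₁ all = inj₁ (κ , Eq.trans (⟪⟫-∘ S (λ _ → refl)) (⟪⟫ᵛ-cong true S λ {b} → eq b))
  where
  L = occ true S
  κ = transfer ρ₁ ρ₂ L
  eq : ∀ b {x} → (b , x) ∈ L → κ (ρ₁ x) ≡ ρ₂ x
  eq true {x} i with y , j , e , q ← transfer-∈ ρ₁ ρ₂ L (ρ₁ x) i refl =
    Eq.trans q (cong ρ₂ (Lin1-inj {ρ₁} l j i e))
  eq false {x} i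
    with z , i' , e' ← ∈-# ρ₁ true (ρ₁ x) L (subst (1 ≤_) (Eq.sym (bal (ρ₁ x))) (#-∈ {ρ₁} i))
    with y , j , e , q ← transfer-∈ ρ₁ ρ₂ L (ρ₁ x) i' e' =
    Eq.trans q (All.lookup (All.lookup all i) j refl refl e)

theorem1 : (A B : Ty) (s1 s2 u1 u2 : Tm 0) →
    [] ⊢ s1 ∶ A → [] ⊢ s2 ∶ A → ¬ ([] ⊢ s1 ≐ s2 ∶ A) →
    [] ⊢ u1 ∶ B → [] ⊢ u2 ∶ B →
    Σ (Tm 0) λ t →
    PolyTypable t s1 A B × PolyTypable t s2 A B ×
    ([] ⊢ t · s1 ≐ u1 ∶ B) × ([] ⊢ t · s2 ≐ u2 ∶ B)
theorem1 A B s1 s2 u1 u2 d1 d2 ne e1 e2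
  with linearization [] A₁ θ₁ t₁ l₁ _ q₁ ← linearize d1
     | linearization [] A₂ θ₂ t₂ l₂ _ q₂ ← linearize d2
  with ρ₁ , refl ← skeleton-universal A₁ θ₁ q₁ | ρ₂ , refl ← skeleton-universal A₂ θ₂ q₂
  with l₁' ← subst Lin1 (occ-ren true (skeleton A) ρ₁) l₁ | l₂' ← subst Lin1 (occ-ren true (skeleton A) ρ₂) l₂
  with compare (skeleton A) ρ₁ ρ₂ l₁' (subst Balanced (occ-ren true (skeleton A) ρ₁) (balanced t₁))
-- Instantiated by `κ`, the type of `s1` becomes the linear type of `s2`. Coherence there, followed
-- by the instantiation `θ₂`, contradicts the assumed inequality at `A`.
... | inj₁ (κ , e) = ⊥-elim (ne (subst (λ C → [] ⊢ s1 ≐ s2 ∶ C) q₂ (≐⟪⟫ (tvar ∘ θ₂)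
        (coherent _ ≤-refl l₂ (subst (λ C → [] ⊢ s1 ∶ C) e (⊢⟪⟫ (tvar ∘ κ) t₁)) t₂))))
... | inj₂ (n , p , n∈ , p∈ , linked , unlinked) =
  t , polyTypable (proj₁ r₁) d1 , polyTypable (proj₁ r₂) d2 , proj₂ r₁ , proj₂ r₂
  where
  S = skeleton A
  -- Built over the skeleton instead of `A`, since there `n` and `p` name single occurrences.
  t = separator S B n p u1 u2
  lin-t : Lin t
  lin-t = lin-separator {S} {B} {n} {p} (⊢lin e1) (⊢lin e2)
  r₁ = ⟶*-expand (lin-· lin-t (⊢lin d1))
    (separator-step {A = S} {n = n} {p} {i = first} e1 e2
      (Separation.Run₁.result n p ρ₁ linked S (#-unique {ρ₁} l₁' n∈) (Lin1-inj {ρ₁} l₁') n∈ p∈ t₁)) e1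
  r₂ = ⟶*-expand (lin-· lin-t (⊢lin d2))
    (separator-step {A = S} {n = n} {p} {i = second} e1 e2
      (Separation.Run₂.result n p ρ₂ unlinked S (#-unique {ρ₁} l₁' n∈) (Lin1-inj {ρ₂} l₂') n∈ t₂)) e2
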